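{- Let $q>2$ be a prime power and let $\mathbb{F}_q$ be the finite field with $q$ elements. Set $\theta=\theta(q-1)$, $\tau=\tau(q-1)$ and $W=W(q-1)$. Then for arbitrary non-zero $u,v\in\mathbb{F}_q$, $$\left|N(q,u,v)-\theta^3\tau\cdot (q-1)\,q\right|\le \theta^4W^3\cdot (q-1)\sqrt{q}.$$
   Context: A primitive element of $\mathbb{F}_q$ is a generator of the cyclic group $\mathbb{F}_q^*$. For non-zero $u,v\in\mathbb{F}_q$, an ordered pair $(a,b)$ of primitive elements of $\mathbb{F}_q$ is called $(u,v)$-primitive if additionally $ua+vb$ and $va^{ -1}+ub^{ -1}$ are both primitive; $N(q,u,v)$ denotes the number of $(u,v)$-primitive pairs. For a positive integer $m$: $\omega(m)$ is the number of distinct prime divisors of $m$, $W(m)=2^{\omega(m)}$, $\theta(m)=\phi(m)/m$ with $\phi$ Euler's function, and $\tau(m)=\prod_{l\mid m}\left(1-\frac{1}{l-1}+\frac{1}{(l-1)^2}\right)$, the product over the distinct primes $l$ dividing $m$. -}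

module Defs where

open import Level using (Level; _⊔_) renaming (suc to lsuc)
open import Data.Nat as ℕ using (ℕ; zero; suc; _∸_)
open import Data.Nat.GCD using (gcd)
open import Data.Nat.Divisibility using (_∣?_)
open import Data.Nat.Primality using (Prime; prime?)
open import Data.Fin using (Fin)
open import Data.List using (List; length; filter; map; upTo; foldr)
open import Data.Product using (Σ; ∃; ∃-syntax; _×_; _,_)
open import Data.Integer using (+_)
open import Data.Rational as ℚ using (ℚ; _/_; 0ℚ; 1ℚ)
open import Relation.Nullary using (¬_)
open import Relation.Nullary.Decidable using (_×-dec_)
open import Relation.Binary.PropositionalEquality using (_≡_)
open import Function.Definitions using (Injective)
open import Algebra.Bundles using (CommutativeRing)

record FiniteField (c ℓ : Level) (q : ℕ) : Set (lsuc (c ⊔ ℓ)) where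
  field
    commRing : CommutativeRing c ℓ
  open CommutativeRing commRing public
  field
    0≉1      : ¬ (0# ≈ 1#)
    _⁻¹      : Carrier → Carrier
    ⁻¹-inv   : ∀ x → ¬ (x ≈ 0#) → (x * (x ⁻¹)) ≈ 1#
    enum     : Fin q → Carrier
    enum-surj : ∀ x → ∃[ i ] (enum i ≈ x)
    enum-inj  : ∀ i j → enum i ≈ enum j → i ≡ j

  pow : Carrier → ℕ → Carrier
  pow x zero    = 1#
  pow x (suc k) = x * pow x k

  IsPrimitive : Carrier → Set (c ⊔ ℓ)
  IsPrimitive a = ¬ (a ≈ 0#) × (∀ x → ¬ (x ≈ 0#) → ∃[ k ] (pow a k ≈ x))

  IsUVPrimitive : Carrier → Carrier → Carrier → Carrier → Set (c ⊔ ℓ)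
  IsUVPrimitive u v a b =
    IsPrimitive a × IsPrimitive b
    × IsPrimitive ((u * a) + (v * b))
    × IsPrimitive ((v * (a ⁻¹)) + (u * (b ⁻¹)))

HasCount : ∀ {a p} {A : Set a} → (A → Set p) → ℕ → Set (a ⊔ p)
HasCount {A = A} P n =
  Σ (Fin n → A) λ f → Injective _≡_ _≡_ f × (∀ i → P (f i)) × (∀ x → P x → ∃[ i ] (f i ≡ x))

IsN : ∀ {c ℓ q} (F : FiniteField c ℓ q) → FiniteField.Carrier F → FiniteField.Carrier F → ℕ → Set (c ⊔ ℓ)
IsN {q = q} F u v n =
  HasCount {A = Fin q × Fin q} (λ { (i , j) → IsUVPrimitive u v (enum i) (enum j) }) n
  where open FiniteField F

primeDivisors : ℕ → List ℕ
primeDivisors m = filter (λ l → prime? l ×-dec (l ∣? m)) (upTo (suc m))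

ω : ℕ → ℕ
ω m = length (primeDivisors m)

W : ℕ → ℕ
W m = 2 ℕ.^ ω m

φ : ℕ → ℕ
φ m = length (filter (λ k → gcd k m ℕ.≟ 1) (map suc (upTo m)))

-- θ(m) = φ(m)/m  (only used for m ≥ 1; value at 0 is a dummy)
θ : ℕ → ℚ
θ zero    = 0ℚ
θ (suc n) = (+ φ (suc n)) / suc n

-- factor 1 - 1/(l-1) + 1/(l-1)^2 for a prime l (l ≥ 2; dummy 1 otherwise)
τfactor : ℕ → ℚ
τfactor (suc (suc k)) = (1ℚ ℚ.- ((+ 1) / suc k)) ℚ.+ ((+ 1) / (suc k ℕ.* suc k))
τfactor _ = 1ℚ

τ : ℕ → ℚ
τ m = foldr (λ l r → τfactor l ℚ.* r) 1ℚ (primeDivisors m)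

ι : ℕ → ℚ
ι n = (+ n) / 1

IsPrimePower : ℕ → Set
IsPrimePower q = ∃[ p ] ∃[ k ] (Prime p × q ≡ p ℕ.^ suc k)

-- |N - θ³τ(q-1)q| ≤ θ⁴W³(q-1)√q, written with both (non-negative) sides squared:
-- (N - θ³τ(q-1)q)² ≤ (θ⁴W³(q-1))² · q, where θ,τ,W are evaluated at q-1.
MainBound : ℕ → ℕ → Set
MainBound q N = (D ℚ.* D) ℚ.≤ ((B ℚ.* B) ℚ.* ι q)
  where
  th = θ (q ∸ 1)
  ta = τ (q ∸ 1)
  w  = ι (W (q ∸ 1))
  D  = ι N ℚ.- ((((th ℚ.* th) ℚ.* th) ℚ.* ta) ℚ.* (ι (q ∸ 1) ℚ.* ι q))
  B  = ((((th ℚ.* th) ℚ.* th) ℚ.* th) ℚ.* ((w ℚ.* w) ℚ.* w)) ℚ.* ι (q ∸ 1)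

{-# OPTIONS --safe #-}
module Submission where

-- With respect to a primitive element γ, and with n = q - 1, N is the sum over a, b, c mod n of
-- L(a,b,c) g(a) g(b) g(c) g(c - a - b), where L indicates uγᵃ + vγᵇ = γᶜ and g indicates that the exponent
-- is prime to n. Instead of characters and Jacobi sums, consider the operator T with kernel L, which maps
-- F(b,y) to (TF)(c,y) = ∑ L(a,b,c) F(b,y+a). A count of the solutions shows that T*T is q times the
-- identity up to marginal sums; with S = ∑ F this gives ‖n²TF - qS‖ ≤ n²√q ‖F‖ for n ≥ 3.
-- On the other hand, g(x - y) factors through a weighted ℓ² space with constant θW, one prime divisor of n
-- at a time. Doing this to g(a) and g(c - a - b) turns N into a weighted sum of pairings ⟨TF,H⟩, and the
-- S-terms into the main term. By Cauchy–Schwarz the error is at most θ³W²(q-1)√q, and 1 ≤ θW.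

-- The squared bound is an inequality between rationals, and everything stays in ℚ: in both places
-- where roots of unity would enter, ℓ² information suffices. Characters of the exponent a are
-- replaced by the free translation variable y of F(b,y); the sum of the absolute Fourier
-- coefficients of g is replaced by a factorisation with the same constant. The argument c - a - b
-- comes from v/x + u/y = (ux + vy)/(xy) for x = γᵃ, y = γᵇ and ux + vy = γᶜ. For each b there are n
-- - 1 pairs (a,c) on the line, so TF has mean (n - 1)S/n². The deviation is nevertheless measured
-- from qS/n², because the main term of the theorem carries the factor q(q - 1). Moving the centre
-- is affordable: the three marginal sums are each at least S²/n by Cauchy-Schwarz, and once they
-- are subtracted the remaining multiple of S² is -n²(n - 3). This is nonpositive from n = 3 on, so
-- q = 3 has to be treated by itself.

module Exponents where

  open import Data.Nat as ℕ using (ℕ; zero; suc; NonZero)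
  import Data.Nat.Properties as ℕ
  open import Data.List using (List; []; _∷_; _++_; map; upTo; applyUpTo; cartesianProduct; length; filter; foldr)
  open import Data.Product using (_×_; _,_; proj₁; proj₂; ∃-syntax)
  open import Data.Rational as ℚ using (ℚ; 0ℚ; 1ℚ; _+_; _*_; _-_; -_; _≤_; _<_; toℚᵘ)
  import Data.Rational.Properties as ℚ
  open import Data.Rational.Solver using (module +-*-Solver)
  open import Data.Sum using (inj₁; inj₂)
  open import Function using (_∘_; id)
  open import Relation.Binary.PropositionalEquality
  open import Defs using (ι; primeDivisors; W; φ; θ; τ; τfactor)
  open import Data.Nat.DivMod using (_%_; [m+n]%n≡m%n; [m+kn]%n≡m%n; %-distribˡ-+; m<n⇒m%n≡m; m≡m%n+[m/n]*n)
  open import Data.Nat.Divisibility using (_∣_; divides; m%n≡0⇒n∣m; n∣m⇒m%n≡0; _∣?_; ∣-trans; m∣m*n; n∣m*n; ∣1⇒≡1; ∣⇒≤)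
  open import Data.Nat.Coprimality using (Coprime; coprime-Bézout)
  open import Data.Nat.GCD using (module Bézout; gcd; gcd-greatest; gcd[m,n]∣m; gcd[m,n]∣n; gcd[m,n]≢0)
  import Data.Integer as ℤ
  import Data.Integer.Properties as ℤ
  open import Data.Bool using (if_then_else_; true; false)
  import Data.Rational.Unnormalised as ℚᵘ
  import Data.Rational.Unnormalised.Properties as ℚᵘ
  open import Relation.Nullary using (Dec; yes; no; does; ¬_; contradiction; _because_)
  open import Relation.Nullary.Decidable using (dec-true; dec-false; _×-dec_)
  open import Data.Nat.ListAction using (product)
  open import Data.Nat.Primality using (Prime; prime?; prime⇒nonZero; prime⇒nonTrivial; prime⇒irreducible; euclidsLemma)
  open import Data.Nat.Primality.Factorisation using (factorise)
  open import Data.List.Membership.Propositional using (_∈_)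
  open import Data.List.Membership.Propositional.Properties using (∈-filter⁺; ∈-upTo⁺)
  open import Data.List.Relation.Unary.All as All using (All; []; _∷_)
  open import Data.List.Relation.Unary.All.Properties using (all-filter)
  open import Data.List.Relation.Unary.AllPairs using ([]; _∷_)
  open import Data.List.Relation.Unary.Any using (here; there)
  open import Data.List.Relation.Unary.Unique.Propositional using (Unique)
  open import Data.List.Relation.Unary.Unique.Propositional.Properties using (upTo⁺; filter⁺)
  open import Data.Maybe using (Maybe; nothing; just)
  open import Data.Unit using (tt)
  open import Relation.Unary using (Pred; Decidable)
  open +-*-Solver using (solve; _:=_; _:+_; _:*_; _:-_; con; :-_)
  open ≡-Reasoning

  -- Finite sums

  0≤p*p : ∀ p → 0ℚ ≤ p * p
  0≤p*p p with ℚ.≤-total 0ℚ p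
  ... | inj₁ 0≤p = ℚ.nonNegative⁻¹ _ {{ℚ.nonNeg*nonNeg⇒nonNeg p {{ℚ.nonNegative 0≤p}} p {{ℚ.nonNegative 0≤p}}}}
  ... | inj₂ p≤0 = ℚ.nonNegative⁻¹ _ {{ℚ.nonPos*nonPos⇒nonPos p {{ℚ.nonPositive p≤0}} p {{ℚ.nonPositive p≤0}}}}

  0≤p*q : ∀ {p q} → 0ℚ ≤ p → 0ℚ ≤ q → 0ℚ ≤ p * q
  0≤p*q {p} {q} 0≤p 0≤q = ℚ.nonNegative⁻¹ _ {{ℚ.nonNeg*nonNeg⇒nonNeg p {{ℚ.nonNegative 0≤p}} q {{ℚ.nonNegative 0≤q}}}}

  0≤p+q : ∀ {p q} → 0ℚ ≤ p → 0ℚ ≤ q → 0ℚ ≤ p + q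
  0≤p+q 0≤p 0≤q = ℚ.+-mono-≤ 0≤p 0≤q

  p≤p+q : ∀ p {q} → 0ℚ ≤ q → p ≤ p + q
  p≤p+q p {q} 0≤q = subst (λ r → r ≤ p + q) (ℚ.+-identityʳ p) (ℚ.+-monoʳ-≤ p 0≤q)

  p-q≤p : ∀ p {q} → 0ℚ ≤ q → p - q ≤ p
  p-q≤p p {q} 0≤q = subst (λ r → p - q ≤ r) (ℚ.+-identityʳ p) (ℚ.+-monoʳ-≤ p (ℚ.neg-antimono-≤ 0≤q))

  0≤p-q⇒q≤p : ∀ {p q} → 0ℚ ≤ p - q → q ≤ p
  0≤p-q⇒q≤p {p} {q} h = subst (q ≤_) (solve 2 (λ p q → q :+ (p :- q) := p) refl p q) (p≤p+q q h)

  q≤p⇒0≤p-q : ∀ {p q} → q ≤ p → 0ℚ ≤ p - q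
  q≤p⇒0≤p-q {p} {q} h = subst (_≤ p - q) (ℚ.+-inverseʳ q) (ℚ.+-monoˡ-≤ (- q) h)

  *-mono-≤ : ∀ {p q r s} → 0ℚ ≤ p → 0ℚ ≤ s → p ≤ q → r ≤ s → p * r ≤ q * s
  *-mono-≤ {p} {q} {r} {s} 0≤p 0≤s p≤q r≤s = ℚ.≤-trans
    (ℚ.*-monoˡ-≤-nonNeg p {{ℚ.nonNegative 0≤p}} r≤s)
    (ℚ.*-monoʳ-≤-nonNeg s {{ℚ.nonNegative 0≤s}} p≤q)

  module _ {a} {A : Set a} where

    ∑ : List A → (A → ℚ) → ℚ
    ∑ []       f = 0ℚ
    ∑ (x ∷ xs) f = f x + ∑ xs f

    syntax ∑ xs (λ x → e) = ∑[ x ∈ xs ] e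

    ∑-cong : ∀ xs {f g : A → ℚ} → (∀ x → f x ≡ g x) → ∑ xs f ≡ ∑ xs g
    ∑-cong []       f≗g = refl
    ∑-cong (x ∷ xs) f≗g = cong₂ _+_ (f≗g x) (∑-cong xs f≗g)

    ∑-zero : ∀ (xs : List A) → ∑[ x ∈ xs ] 0ℚ ≡ 0ℚ
    ∑-zero []       = refl
    ∑-zero (x ∷ xs) = trans (ℚ.+-identityˡ _) (∑-zero xs)

    ∑-+ : ∀ xs (f g : A → ℚ) → ∑[ x ∈ xs ] (f x + g x) ≡ ∑ xs f + ∑ xs g
    ∑-+ []       f g = refl
    ∑-+ (x ∷ xs) f g = begin
      f x + g x + ∑[ x ∈ xs ] (f x + g x)    ≡⟨ cong (f x + g x +_) (∑-+ xs f g) ⟩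
      f x + g x + (∑ xs f + ∑ xs g)          ≡⟨ solve 4 (λ a b c d → a :+ b :+ (c :+ d) := a :+ c :+ (b :+ d)) refl (f x) (g x) _ _ ⟩
      f x + ∑ xs f + (g x + ∑ xs g)          ∎

    ∑-*ˡ : ∀ c xs (f : A → ℚ) → ∑[ x ∈ xs ] (c * f x) ≡ c * ∑ xs f
    ∑-*ˡ c []       f = sym (ℚ.*-zeroʳ c)
    ∑-*ˡ c (x ∷ xs) f = trans (cong (c * f x +_) (∑-*ˡ c xs f)) (sym (ℚ.*-distribˡ-+ c _ _))

    ∑-*ʳ : ∀ c xs (f : A → ℚ) → ∑[ x ∈ xs ] (f x * c) ≡ ∑ xs f * c
    ∑-*ʳ c xs f = begin
      ∑[ x ∈ xs ] (f x * c)  ≡⟨ ∑-cong xs (λ x → ℚ.*-comm (f x) c) ⟩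
      ∑[ x ∈ xs ] (c * f x)  ≡⟨ ∑-*ˡ c xs f ⟩
      c * ∑ xs f             ≡⟨ ℚ.*-comm c _ ⟩
      ∑ xs f * c             ∎

    ∑-neg : ∀ xs (f : A → ℚ) → ∑[ x ∈ xs ] (- f x) ≡ - ∑ xs f
    ∑-neg []       f = refl
    ∑-neg (x ∷ xs) f = trans (cong (- f x +_) (∑-neg xs f)) (sym (ℚ.neg-distrib-+ (f x) (∑ xs f)))

    ∑-- : ∀ xs (f g : A → ℚ) → ∑[ x ∈ xs ] (f x - g x) ≡ ∑ xs f - ∑ xs g
    ∑-- xs f g = trans (∑-+ xs f (λ x → - g x)) (cong (∑ xs f +_) (∑-neg xs g))

    ∑-+- : ∀ xs (f g h : A → ℚ) → ∑[ x ∈ xs ] (f x + g x - h x) ≡ ∑ xs f + ∑ xs g - ∑ xs h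
    ∑-+- xs f g h = trans (∑-- xs (λ x → f x + g x) h) (cong (λ s → s - ∑ xs h) (∑-+ xs f g))

    0≤∑ : ∀ xs {f : A → ℚ} → (∀ x → 0ℚ ≤ f x) → 0ℚ ≤ ∑ xs f
    0≤∑ []       0≤f = ℚ.≤-refl
    0≤∑ (x ∷ xs) 0≤f = 0≤p+q (0≤f x) (0≤∑ xs 0≤f)

    ∑-mono : ∀ xs {f g : A → ℚ} → (∀ x → f x ≤ g x) → ∑ xs f ≤ ∑ xs g
    ∑-mono []       f≤g = ℚ.≤-refl
    ∑-mono (x ∷ xs) f≤g = ℚ.+-mono-≤ (f≤g x) (∑-mono xs f≤g)

    ∑-++ : ∀ xs ys (f : A → ℚ) → ∑ (xs ++ ys) f ≡ ∑ xs f + ∑ ys f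
    ∑-++ []       ys f = sym (ℚ.+-identityˡ _)
    ∑-++ (x ∷ xs) ys f = trans (cong (f x +_) (∑-++ xs ys f)) (sym (ℚ.+-assoc (f x) _ _))

  module _ {a b} {A : Set a} {B : Set b} where

    ∑-swap : ∀ (xs : List A) (ys : List B) (f : A → B → ℚ) →
             ∑[ x ∈ xs ] ∑[ y ∈ ys ] f x y ≡ ∑[ y ∈ ys ] ∑[ x ∈ xs ] f x y
    ∑-swap []       ys f = sym (∑-zero ys)
    ∑-swap (x ∷ xs) ys f = trans (cong (∑ ys (f x) +_) (∑-swap xs ys f)) (sym (∑-+ ys (f x) _))

    ∑-map : ∀ (h : A → B) xs (f : B → ℚ) → ∑ (map h xs) f ≡ ∑ xs (f ∘ h)
    ∑-map h []       f = refl
    ∑-map h (x ∷ xs) f = cong (f (h x) +_) (∑-map h xs f)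

    ∑-×ˡ : ∀ (xs : List A) (ys : List B) (f : A → ℚ) (g : B → ℚ) →
          ∑[ x ∈ xs ] ∑[ y ∈ ys ] (f x * g y) ≡ ∑ xs f * ∑ ys g
    ∑-×ˡ xs ys f g = trans (∑-cong xs (λ x → ∑-*ˡ (f x) ys g)) (∑-*ʳ (∑ ys g) xs f)

  module _ {a b} {A : Set a} {B : Set b} where

    ∑-cartesianProduct : ∀ (xs : List A) (ys : List B) (f : A × B → ℚ) →
                         ∑ (cartesianProduct xs ys) f ≡ ∑[ x ∈ xs ] ∑[ y ∈ ys ] f (x , y)
    ∑-cartesianProduct []       ys f = refl
    ∑-cartesianProduct (x ∷ xs) ys f = trans (∑-++ (map (x ,_) ys) _ f)
      (cong₂ _+_ (∑-map (x ,_) ys f) (∑-cartesianProduct xs ys f))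

  module _ {a} {A : Set a} where

    -- Lagrange's identity: the difference of the two sides is half of ∑ w w′ (x y′ - x′ y)².
    cauchy-schwarz : ∀ (xs : List A) (w f g : A → ℚ) → (∀ x → 0ℚ ≤ w x) →
      ∑[ x ∈ xs ] (w x * (f x * g x)) * ∑[ x ∈ xs ] (w x * (f x * g x)) ≤
      ∑[ x ∈ xs ] (w x * (f x * f x)) * ∑[ x ∈ xs ] (w x * (g x * g x))
    cauchy-schwarz xs w f g 0≤w = ℚ.*-cancelˡ-≤-pos (1ℚ + 1ℚ)
      (0≤p-q⇒q≤p (subst (0ℚ ≤_) lagrange
        (0≤∑ xs λ x → 0≤∑ xs λ y → 0≤p*q (0≤p*q (0≤w x) (0≤w y)) (0≤p*p (f x * g y - f y * g x)))))
      where
      F G H : A → ℚ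
      F x = w x * (f x * f x)
      G x = w x * (g x * g x)
      H x = w x * (f x * g x)
      lagrange : ∑[ x ∈ xs ] ∑[ y ∈ xs ] (w x * w y * ((f x * g y - f y * g x) * (f x * g y - f y * g x)))
                 ≡ (1ℚ + 1ℚ) * (∑ xs F * ∑ xs G) - (1ℚ + 1ℚ) * (∑ xs H * ∑ xs H)
      lagrange = begin
        ∑[ x ∈ xs ] ∑[ y ∈ xs ] (w x * w y * ((f x * g y - f y * g x) * (f x * g y - f y * g x)))
          ≡⟨ ∑-cong xs (λ x → ∑-cong xs λ y → expand (w x) (w y) (f x) (g x) (f y) (g y)) ⟩
        ∑[ x ∈ xs ] ∑[ y ∈ xs ] (F x * G y + G x * F y - (1ℚ + 1ℚ) * H x * H y)
          ≡⟨ ∑-cong xs (λ x → ∑-+- xs _ _ _) ⟩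
        ∑[ x ∈ xs ] (∑[ y ∈ xs ] (F x * G y) + ∑[ y ∈ xs ] (G x * F y) - ∑[ y ∈ xs ] ((1ℚ + 1ℚ) * H x * H y))
          ≡⟨ ∑-+- xs _ _ _ ⟩
        ∑[ x ∈ xs ] ∑[ y ∈ xs ] (F x * G y) + ∑[ x ∈ xs ] ∑[ y ∈ xs ] (G x * F y) - ∑[ x ∈ xs ] ∑[ y ∈ xs ] ((1ℚ + 1ℚ) * H x * H y)
          ≡⟨ cong₂ _-_ (cong₂ _+_ (∑-×ˡ xs xs F G) (∑-×ˡ xs xs G F)) (trans (∑-×ˡ xs xs _ H) (cong (_* ∑ xs H) (∑-*ˡ (1ℚ + 1ℚ) xs H))) ⟩
        ∑ xs F * ∑ xs G + ∑ xs G * ∑ xs F - (1ℚ + 1ℚ) * ∑ xs H * ∑ xs H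
          ≡⟨ solve 3 (λ a b c → a :* b :+ b :* a :- (con (1ℚ + 1ℚ)) :* c :* c := (con (1ℚ + 1ℚ)) :* (a :* b) :- (con (1ℚ + 1ℚ)) :* (c :* c)) refl (∑ xs F) (∑ xs G) (∑ xs H) ⟩
        (1ℚ + 1ℚ) * (∑ xs F * ∑ xs G) - (1ℚ + 1ℚ) * (∑ xs H * ∑ xs H) ∎
        where
        expand : ∀ w w′ x y x′ y′ → w * w′ * ((x * y′ - x′ * y) * (x * y′ - x′ * y)) ≡
                 w * (x * x) * (w′ * (y′ * y′)) + w * (y * y) * (w′ * (x′ * x′)) - (1ℚ + 1ℚ) * (w * (x * y)) * (w′ * (x′ * y′))
        expand = solve 6 (λ w w′ x y x′ y′ → w :* w′ :* ((x :* y′ :- x′ :* y) :* (x :* y′ :- x′ :* y)) :=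
                 w :* (x :* x) :* (w′ :* (y′ :* y′)) :+ w :* (y :* y) :* (w′ :* (x′ :* x′)) :- (con (1ℚ + 1ℚ)) :* (w :* (x :* y)) :* (w′ :* (x′ :* y′))) refl

  Periodic : ∀ {a} {A : Set a} → ℕ → (ℕ → A) → Set a
  Periodic n f = ∀ x → f (x ℕ.+ n) ≡ f x

  ∑-applyUpTo-suc : ∀ (h : ℕ → ℕ) n (f : ℕ → ℚ) → ∑ (applyUpTo h (suc n)) f ≡ ∑ (applyUpTo h n) f + f (h n)
  ∑-applyUpTo-suc h zero    f = ℚ.+-comm (f (h 0)) 0ℚ
  ∑-applyUpTo-suc h (suc n) f = trans (cong (f (h 0) +_) (∑-applyUpTo-suc (h ∘ suc) n f)) (sym (ℚ.+-assoc (f (h 0)) _ _))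

  ∑-applyUpTo : ∀ (h : ℕ → ℕ) n (f : ℕ → ℚ) → ∑ (applyUpTo h n) f ≡ ∑ (upTo n) (f ∘ h)
  ∑-applyUpTo h zero    f = refl
  ∑-applyUpTo h (suc n) f = begin
    ∑ (applyUpTo h (suc n)) f     ≡⟨ ∑-applyUpTo-suc h n f ⟩
    ∑ (applyUpTo h n) f + f (h n) ≡⟨ cong (_+ f (h n)) (∑-applyUpTo h n f) ⟩
    ∑ (upTo n) (f ∘ h) + f (h n)  ≡⟨ ∑-applyUpTo-suc id n (f ∘ h) ⟨
    ∑ (upTo (suc n)) (f ∘ h)      ∎

  ∑-upTo-cong : ∀ n {f g : ℕ → ℚ} → (∀ x → x ℕ.< n → f x ≡ g x) → ∑ (upTo n) f ≡ ∑ (upTo n) g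
  ∑-upTo-cong zero    f≗g = refl
  ∑-upTo-cong (suc n) {f} {g} f≗g = begin
    ∑ (upTo (suc n)) f   ≡⟨ ∑-applyUpTo-suc id n f ⟩
    ∑ (upTo n) f + f n   ≡⟨ cong₂ _+_ (∑-upTo-cong n (λ x x<n → f≗g x (ℕ.m<n⇒m<1+n x<n))) (f≗g n ℕ.≤-refl) ⟩
    ∑ (upTo n) g + g n   ≡⟨ ∑-applyUpTo-suc id n g ⟨
    ∑ (upTo (suc n)) g   ∎

  ∑-shift₁ : ∀ n (f : ℕ → ℚ) → f n ≡ f 0 → ∑ (upTo n) (f ∘ suc) ≡ ∑ (upTo n) f
  ∑-shift₁ n f fn≡f0 = begin
    ∑ (upTo n) (f ∘ suc)                   ≡⟨ solve 2 (λ s a → s := a :+ s :- a) refl _ (f 0) ⟩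
    f 0 + ∑ (upTo n) (f ∘ suc) - f 0       ≡⟨ cong (λ s → f 0 + s - f 0) (∑-applyUpTo suc n f) ⟨
    f 0 + ∑ (applyUpTo suc n) f - f 0      ≡⟨ cong (_- f 0) (∑-applyUpTo-suc id n f) ⟩
    ∑ (upTo n) f + f n - f 0               ≡⟨ cong (λ c → ∑ (upTo n) f + c - f 0) fn≡f0 ⟩
    ∑ (upTo n) f + f 0 - f 0               ≡⟨ solve 2 (λ s a → s :+ a :- a := s) refl (∑ (upTo n) f) (f 0) ⟩
    ∑ (upTo n) f                           ∎

  ∑-shift : ∀ n {f : ℕ → ℚ} → Periodic n f → ∀ k → ∑[ x ∈ upTo n ] f (x ℕ.+ k) ≡ ∑ (upTo n) f
  ∑-shift n {f} per zero    = ∑-cong (upTo n) (λ x → cong f (ℕ.+-identityʳ x))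
  ∑-shift n {f} per (suc k) = begin
    ∑[ x ∈ upTo n ] f (x ℕ.+ suc k)    ≡⟨ ∑-cong (upTo n) (λ x → cong f (ℕ.+-suc x k)) ⟩
    ∑[ x ∈ upTo n ] f (suc x ℕ.+ k)    ≡⟨ ∑-shift₁ n (λ x → f (x ℕ.+ k)) (trans (cong f (ℕ.+-comm n k)) (per k)) ⟩
    ∑[ x ∈ upTo n ] f (x ℕ.+ k)        ≡⟨ ∑-shift n per k ⟩
    ∑ (upTo n) f                       ∎

  -- Residues and periodic functions

  toℚᵘ-/ : ∀ i d → toℚᵘ (i ℚ./ suc d) ℚᵘ.≃ ℚᵘ.mkℚᵘ i d
  toℚᵘ-/ i d = ℚ.toℚᵘ-fromℚᵘ (ℚᵘ.mkℚᵘ i d)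

  ι-+ : ∀ m n → ι (m ℕ.+ n) ≡ ι m + ι n
  ι-+ m n = ℚ.toℚᵘ-injective (ℚᵘ.≃-trans (toℚᵘ-/ (ℤ.+ (m ℕ.+ n)) 0) (ℚᵘ.≃-trans
    (ℚᵘ.*≡* (cong (λ i → i ℤ.* ℤ.+ 1) (sym (cong₂ ℤ._+_ (ℤ.*-identityʳ (ℤ.+ m)) (ℤ.*-identityʳ (ℤ.+ n))))))
    (ℚᵘ.≃-sym (ℚᵘ.≃-trans (ℚ.toℚᵘ-homo-+ (ι m) (ι n)) (ℚᵘ.+-cong (toℚᵘ-/ (ℤ.+ m) 0) (toℚᵘ-/ (ℤ.+ n) 0))))))

  ι-* : ∀ m n → ι (m ℕ.* n) ≡ ι m * ι n
  ι-* m n = ℚ.toℚᵘ-injective (ℚᵘ.≃-trans (toℚᵘ-/ (ℤ.+ (m ℕ.* n)) 0) (ℚᵘ.≃-trans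
    (ℚᵘ.*≡* (cong (λ i → i ℤ.* ℤ.+ 1) (ℤ.pos-* m n)))
    (ℚᵘ.≃-sym (ℚᵘ.≃-trans (ℚ.toℚᵘ-homo-* (ι m) (ι n)) (ℚᵘ.*-cong (toℚᵘ-/ (ℤ.+ m) 0) (toℚᵘ-/ (ℤ.+ n) 0))))))

  /-*-cancel : ∀ k d → (ℤ.+ k ℚ./ suc d) * ι (suc d) ≡ ι k
  /-*-cancel k d = ℚ.toℚᵘ-injective (ℚᵘ.≃-trans (ℚ.toℚᵘ-homo-* (ℤ.+ k ℚ./ suc d) (ι (suc d)))
    (ℚᵘ.≃-trans (ℚᵘ.*-cong (toℚᵘ-/ (ℤ.+ k) d) (toℚᵘ-/ (ℤ.+ suc d) 0)) (ℚᵘ.≃-trans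
    (ℚᵘ.*≡* (trans (ℤ.*-identityʳ _) (cong (ℤ._*_ (ℤ.+ k)) (sym (ℤ.*-identityʳ (ℤ.+ suc d))))))
    (ℚᵘ.≃-sym (toℚᵘ-/ (ℤ.+ k) 0)))))

  0<ι : ∀ n → 0ℚ < ι (suc n)
  0<ι n = ℚ.positive⁻¹ (ι (suc n)) {{ℚ.normalize-pos (suc n) 1}}

  0≤ι : ∀ n → 0ℚ ≤ ι n
  0≤ι n = ℚ.nonNegative⁻¹ (ι n) {{ℚ.normalize-nonNeg n 1}}

  ι-suc : ∀ n → ι (suc n) ≡ 1ℚ + ι n
  ι-suc n = ι-+ 1 n

  ι-mono : ∀ {m n} → m ℕ.≤ n → ι m ≤ ι n
  ι-mono {m} {n} m≤n = subst (λ k → ι m ≤ ι k) (ℕ.m+[n∸m]≡n m≤n)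
    (subst (ι m ≤_) (sym (ι-+ m (n ℕ.∸ m))) (p≤p+q (ι m) (0≤ι (n ℕ.∸ m))))

  *-cancelˡ : ∀ {r p q} → 0ℚ < r → r * p ≡ r * q → p ≡ q
  *-cancelˡ {r} 0<r eq = ℚ.≤-antisym
    (ℚ.*-cancelˡ-≤-pos r {{ℚ.positive 0<r}} (ℚ.≤-reflexive eq))
    (ℚ.*-cancelˡ-≤-pos r {{ℚ.positive 0<r}} (ℚ.≤-reflexive (sym eq)))

  ∑-const : ∀ {a} {A : Set a} (xs : List A) c → ∑[ x ∈ xs ] c ≡ ι (length xs) * c
  ∑-const []       c = sym (ℚ.*-zeroˡ c)
  ∑-const (x ∷ xs) c = begin
    c + ∑[ x ∈ xs ] c           ≡⟨ cong (c +_) (∑-const xs c) ⟩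
    c + ι (length xs) * c       ≡⟨ solve 2 (λ c m → c :+ m :* c := (con 1ℚ :+ m) :* c) refl c (ι (length xs)) ⟩
    (1ℚ + ι (length xs)) * c    ≡⟨ cong (_* c) (ι-suc (length xs)) ⟨
    ι (suc (length xs)) * c     ∎

  ∑-upTo-const : ∀ n c → ∑[ x ∈ upTo n ] c ≡ ι n * c
  ∑-upTo-const zero    c = sym (ℚ.*-zeroˡ c)
  ∑-upTo-const (suc n) c = begin
    ∑[ x ∈ upTo (suc n) ] c    ≡⟨ ∑-applyUpTo-suc id n (λ _ → c) ⟩
    ∑[ x ∈ upTo n ] c + c      ≡⟨ cong (_+ c) (∑-upTo-const n c) ⟩
    ι n * c + c                ≡⟨ solve 2 (λ c m → m :* c :+ c := (con 1ℚ :+ m) :* c) refl c (ι n) ⟩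
    (1ℚ + ι n) * c             ≡⟨ cong (_* c) (ι-suc n) ⟨
    ι (suc n) * c              ∎

  module _ {p} {P : Set p} where

    𝟙 : Dec P → ℚ
    𝟙 P? = if does P? then 1ℚ else 0ℚ

    𝟙-true : (P? : Dec P) → P → 𝟙 P? ≡ 1ℚ
    𝟙-true P? h = cong (if_then 1ℚ else 0ℚ) (dec-true P? h)

    𝟙-false : (P? : Dec P) → ¬ P → 𝟙 P? ≡ 0ℚ
    𝟙-false P? h = cong (if_then 1ℚ else 0ℚ) (dec-false P? h)

    𝟙-unique : ∀ {q} (P? : Dec P) → (P → q ≡ 1ℚ) → (¬ P → q ≡ 0ℚ) → q ≡ 𝟙 P?
    𝟙-unique (yes p) eq₁ eq₀ = eq₁ p
    𝟙-unique (no ¬p) eq₁ eq₀ = eq₀ ¬p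

    𝟙-idem : (P? : Dec P) → 𝟙 P? * 𝟙 P? ≡ 𝟙 P?
    𝟙-idem (yes _) = refl
    𝟙-idem (no _)  = refl

  𝟙-cong : ∀ {p q} {P : Set p} {Q : Set q} (P? : Dec P) (Q? : Dec Q) → (P → Q) → (Q → P) → 𝟙 P? ≡ 𝟙 Q?
  𝟙-cong P? (yes q) P→Q Q→P = 𝟙-true P? (Q→P q)
  𝟙-cong P? (no ¬q) P→Q Q→P = 𝟙-false P? (¬q ∘ P→Q)

  -- The residue of x mod l; the junk value mod 0 x = x makes congruence mod 0 equality.
  mod : ℕ → ℕ → ℕ
  mod zero    x = x
  mod (suc l) x = x % suc l

  mod-periodic : ∀ l → Periodic l (mod l)
  mod-periodic zero    x = ℕ.+-identityʳ x
  mod-periodic (suc l) x = [m+n]%n≡m%n x (suc l)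

  mod-+ʳ : ∀ l {x y} z → mod l x ≡ mod l y → mod l (x ℕ.+ z) ≡ mod l (y ℕ.+ z)
  mod-+ʳ zero        z eq = cong (ℕ._+ z) eq
  mod-+ʳ (suc l) {x} {y} z eq = begin
    (x ℕ.+ z) % suc l                      ≡⟨ %-distribˡ-+ x z (suc l) ⟩
    (x % suc l ℕ.+ z % suc l) % suc l      ≡⟨ cong (λ r → (r ℕ.+ z % suc l) % suc l) eq ⟩
    (y % suc l ℕ.+ z % suc l) % suc l      ≡⟨ %-distribˡ-+ y z (suc l) ⟨
    (y ℕ.+ z) % suc l                      ∎

  mod-+ˡ : ∀ l {x y} z → mod l x ≡ mod l y → mod l (z ℕ.+ x) ≡ mod l (z ℕ.+ y)
  mod-+ˡ l {x} {y} z eq = subst₂ (λ a b → mod l a ≡ mod l b) (ℕ.+-comm x z) (ℕ.+-comm y z) (mod-+ʳ l z eq)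

  mod-cancelʳ : ∀ l {x y} z → mod l (x ℕ.+ z) ≡ mod l (y ℕ.+ z) → mod l x ≡ mod l y
  mod-cancelʳ zero            z eq = ℕ.+-cancelʳ-≡ z _ _ eq
  mod-cancelʳ (suc l) {x} {y} z eq = begin
    -- Subtracting `z` modulo `suc l` is adding `l * z`, because `z + l * z` is a multiple of
    -- `suc l`.
    x % suc l                        ≡⟨ undo x ⟨
    (x ℕ.+ z ℕ.+ l ℕ.* z) % suc l    ≡⟨ mod-+ʳ (suc l) {x ℕ.+ z} {y ℕ.+ z} (l ℕ.* z) eq ⟩
    (y ℕ.+ z ℕ.+ l ℕ.* z) % suc l    ≡⟨ undo y ⟩
    y % suc l                        ∎
    where
    undo : ∀ x → (x ℕ.+ z ℕ.+ l ℕ.* z) % suc l ≡ x % suc l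
    undo x = begin
      (x ℕ.+ z ℕ.+ l ℕ.* z) % suc l    ≡⟨ cong (_% suc l) (ℕ.+-assoc x z (l ℕ.* z)) ⟩
      (x ℕ.+ suc l ℕ.* z) % suc l      ≡⟨ cong (λ k → (x ℕ.+ k) % suc l) (ℕ.*-comm (suc l) z) ⟩
      (x ℕ.+ z ℕ.* suc l) % suc l      ≡⟨ [m+kn]%n≡m%n x z (suc l) ⟩
      x % suc l                        ∎

  mod-cancelˡ : ∀ l {x y} z → mod l (z ℕ.+ x) ≡ mod l (z ℕ.+ y) → mod l x ≡ mod l y
  mod-cancelˡ l {x} {y} z eq = mod-cancelʳ l z (subst₂ (λ a b → mod l a ≡ mod l b) (ℕ.+-comm z x) (ℕ.+-comm z y) eq)

  mod-< : ∀ {l x} → x ℕ.< l → mod l x ≡ x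
  mod-< {suc l} x<l = m<n⇒m%n≡m x<l

  -- The residue of 0 is written `mod l 0` because it reduces to 0 only after a case split on `l`;
  -- this also matches the shape of `e l x 0`.
  ∣⇒mod≡0 : ∀ {l x} → l ∣ x → mod l x ≡ mod l 0
  ∣⇒mod≡0 {zero}  (divides k eq) = trans eq (ℕ.*-zeroʳ k)
  ∣⇒mod≡0 {suc l} {x} l∣x = n∣m⇒m%n≡0 x (suc l) l∣x

  mod≡0⇒∣ : ∀ {l x} → mod l x ≡ mod l 0 → l ∣ x
  mod≡0⇒∣ {zero}  refl = divides 0 refl
  mod≡0⇒∣ {suc l} {x} eq = m%n≡0⇒n∣m x (suc l) eq

  module _ {a} {A : Set a} {f : ℕ → A} where

    periodic-* : ∀ {n} → Periodic n f → ∀ k x → f (x ℕ.+ k ℕ.* n) ≡ f x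
    periodic-*     per zero    x = cong f (ℕ.+-identityʳ x)
    periodic-* {n} per (suc k) x = begin
      f (x ℕ.+ (n ℕ.+ k ℕ.* n))    ≡⟨ cong f (ℕ.+-assoc x n (k ℕ.* n)) ⟨
      f (x ℕ.+ n ℕ.+ k ℕ.* n)      ≡⟨ periodic-* per k (x ℕ.+ n) ⟩
      f (x ℕ.+ n)                  ≡⟨ per x ⟩
      f x                          ∎

    periodic-mod : ∀ {n} → Periodic n f → ∀ x → f (mod n x) ≡ f x
    periodic-mod {zero}  per x = refl
    periodic-mod {suc n} per x = trans (sym (periodic-* per (x ℕ./ suc n) (x % suc n))) (cong f (sym (m≡m%n+[m/n]*n x (suc n))))

    periodic-cong : ∀ {n} → Periodic n f → ∀ {x y} → mod n x ≡ mod n y → f x ≡ f y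
    periodic-cong per {x} {y} eq = trans (sym (periodic-mod per x)) (trans (cong f eq) (periodic-mod per y))

    periodic-∣ : ∀ {d n} → Periodic d f → d ∣ n → Periodic n f
    periodic-∣ {d} per (divides k refl) x = periodic-* per k x

    -- By Bézout, 1 is the difference of a multiple of one period and a multiple of the other, so a
    -- step by 1 does not change the value.
    coprime-periods : ∀ {m n} → Periodic m f → Periodic n f → Coprime m n → ∀ x → f x ≡ f 0
    coprime-periods {m} {n} perₘ perₙ c zero    = refl
    coprime-periods {m} {n} perₘ perₙ c (suc x) = trans (step (coprime-Bézout c)) (coprime-periods perₘ perₙ c x)
      where
      lift : ∀ {i j} → 1 ℕ.+ j ≡ i → suc x ℕ.+ j ≡ x ℕ.+ i
      lift {i} {j} eq = trans (sym (ℕ.+-suc x j)) (cong (x ℕ.+_) eq)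
      step : Bézout.Identity 1 m n → f (suc x) ≡ f x
      step (Bézout.+- i j eq) = trans (sym (periodic-* perₙ j (suc x))) (trans (cong f (lift eq)) (periodic-* perₘ i x))
      step (Bézout.-+ i j eq) = trans (sym (periodic-* perₘ i (suc x))) (trans (cong f (lift eq)) (periodic-* perₙ j x))

  e : ℕ → ℕ → ℕ → ℚ
  e l x y = 𝟙 (mod l x ℕ.≟ mod l y)

  e-sym : ∀ l x y → e l x y ≡ e l y x
  e-sym l x y = 𝟙-cong (mod l x ℕ.≟ mod l y) (mod l y ℕ.≟ mod l x) sym sym

  e-periodicˡ : ∀ l y → Periodic l (λ x → e l x y)
  e-periodicˡ l y x = cong (λ r → 𝟙 (r ℕ.≟ mod l y)) (mod-periodic l x)

  e-+ : ∀ l x y z → e l (x ℕ.+ z) (y ℕ.+ z) ≡ e l x y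
  e-+ l x y z = 𝟙-cong (mod l (x ℕ.+ z) ℕ.≟ mod l (y ℕ.+ z)) (mod l x ℕ.≟ mod l y) (mod-cancelʳ l z) (mod-+ʳ l z)

  e-refl : ∀ l x → e l x x ≡ 1ℚ
  e-refl l x = 𝟙-true (mod l x ℕ.≟ mod l x) refl

  -- `e n` is the Kronecker delta on the integers modulo n. Shifting the range by `y` moves its only
  -- non-zero term to the head of the list.
  ∑-e : ∀ n .{{_ : NonZero n}} {f : ℕ → ℚ} → Periodic n f → ∀ y → ∑[ x ∈ upTo n ] (e n x y * f x) ≡ f y
  ∑-e n@(suc m) {f} per y = begin
    ∑[ x ∈ upTo n ] (e n x y * f x)
      ≡⟨ ∑-shift n (λ x → cong₂ _*_ (e-periodicˡ n y x) (per x)) y ⟨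
    ∑[ x ∈ upTo n ] (e n (x ℕ.+ y) y * f (x ℕ.+ y))
      ≡⟨ cong₂ _+_ (cong (_* f y) (e-refl n y)) (∑-applyUpTo suc m _) ⟩
    1ℚ * f y + ∑[ x ∈ upTo m ] (e n (suc x ℕ.+ y) y * f (suc x ℕ.+ y))
      ≡⟨ cong (1ℚ * f y +_) (trans (∑-upTo-cong m λ x x<m → trans (cong (_* f (suc x ℕ.+ y)) (off x x<m)) (ℚ.*-zeroˡ (f (suc x ℕ.+ y)))) (∑-zero (upTo m))) ⟩
    1ℚ * f y + 0ℚ
      ≡⟨ trans (ℚ.+-identityʳ _) (ℚ.*-identityˡ (f y)) ⟩
    f y ∎
    where
    off : ∀ x → x ℕ.< m → e n (suc x ℕ.+ y) y ≡ 0ℚ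
    off x x<m = trans (e-+ n (suc x) 0 y)
      (𝟙-false (mod n (suc x) ℕ.≟ 0) λ eq → contradiction (trans (sym (mod-< (ℕ.s≤s x<m))) eq) λ ())

  ∑-e-1 : ∀ n .{{_ : NonZero n}} y → ∑[ x ∈ upTo n ] e n x y ≡ 1ℚ
  ∑-e-1 n y = trans (∑-cong (upTo n) λ x → sym (ℚ.*-identityʳ _)) (∑-e n (λ _ → refl) y)

  -- The correlation H j = ∑ u x f (x + j) has both periods, hence is constant.
  ∑-*-coprime-periods : ∀ n {r l} {u f : ℕ → ℚ} → Periodic n u → Periodic n f → Periodic r u → Periodic l f → Coprime r l →
    ι l * ∑[ x ∈ upTo n ] (u x * f x) ≡ ∑ (upTo n) u * ∑ (upTo l) f
  ∑-*-coprime-periods n {r} {l} {u} {f} uₙ fₙ uᵣ fₗ c = begin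
    ι l * ∑[ x ∈ upTo n ] (u x * f x)            ≡⟨ cong (ι l *_) (∑-cong (upTo n) λ x → cong (λ y → u x * f y) (ℕ.+-identityʳ x)) ⟨
    ι l * H 0                                    ≡⟨ ∑-upTo-const l (H 0) ⟨
    ∑[ j ∈ upTo l ] H 0                          ≡⟨ ∑-cong (upTo l) (coprime-periods Hᵣ Hₗ c) ⟨
    ∑[ j ∈ upTo l ] H j                          ≡⟨ ∑-swap (upTo l) (upTo n) _ ⟩
    ∑[ x ∈ upTo n ] ∑[ j ∈ upTo l ] (u x * f (x ℕ.+ j))
      ≡⟨ ∑-cong (upTo n) (λ x → trans (∑-*ˡ (u x) (upTo l) _) (cong (u x *_) (trans (∑-cong (upTo l) λ j → cong f (ℕ.+-comm x j)) (∑-shift l fₗ x)))) ⟩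
    ∑[ x ∈ upTo n ] (u x * ∑ (upTo l) f)         ≡⟨ ∑-*ʳ (∑ (upTo l) f) (upTo n) u ⟩
    ∑ (upTo n) u * ∑ (upTo l) f                  ∎
    where
    H : ℕ → ℚ
    H j = ∑[ x ∈ upTo n ] (u x * f (x ℕ.+ j))
    Hₗ : Periodic l H
    Hₗ j = ∑-cong (upTo n) λ x → cong (u x *_) (trans (cong f (sym (ℕ.+-assoc x j l))) (fₗ (x ℕ.+ j)))
    exchange : ∀ x j k → x ℕ.+ j ℕ.+ k ≡ x ℕ.+ k ℕ.+ j
    exchange x j k = trans (ℕ.+-assoc x j k) (trans (cong (x ℕ.+_) (ℕ.+-comm j k)) (sym (ℕ.+-assoc x k j)))
    Hᵣ : Periodic r H
    Hᵣ j = begin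
      ∑[ x ∈ upTo n ] (u x * f (x ℕ.+ (j ℕ.+ r)))
        ≡⟨ ∑-cong (upTo n) (λ x → cong₂ _*_ (sym (uᵣ x)) (cong f (trans (sym (ℕ.+-assoc x j r)) (exchange x j r)))) ⟩
      ∑[ x ∈ upTo n ] (u (x ℕ.+ r) * f (x ℕ.+ r ℕ.+ j))
        ≡⟨ ∑-shift n (λ x → cong₂ _*_ (uₙ x) (trans (cong f (exchange x n j)) (fₙ (x ℕ.+ j)))) r ⟩
      H j ∎

  -- The incidence operator

  ∑-square-≤ : ∀ n (f : ℕ → ℚ) → ∑ (upTo n) f * ∑ (upTo n) f ≤ ι n * ∑[ x ∈ upTo n ] (f x * f x)
  ∑-square-≤ n f = subst₂ _≤_
    (cong₂ _*_ unit unit)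
    (trans (cong₂ _*_ (∑-cong (upTo n) λ x → ℚ.*-identityˡ _) (trans (∑-upTo-const n (1ℚ * (1ℚ * 1ℚ))) (ℚ.*-identityʳ (ι n)))) (ℚ.*-comm _ (ι n)))
    (cauchy-schwarz (upTo n) (λ _ → 1ℚ) f (λ _ → 1ℚ) (λ _ → 0≤ι 1))
    where
    unit : ∑[ x ∈ upTo n ] (1ℚ * (f x * 1ℚ)) ≡ ∑ (upTo n) f
    unit = ∑-cong (upTo n) λ x → trans (ℚ.*-identityˡ _) (ℚ.*-identityʳ (f x))

  module _ {a b} {A : Set a} {B : Set b} where

    ∑∑-cong : ∀ (xs : List A) (ys : List B) {f g : A → B → ℚ} → (∀ x y → f x y ≡ g x y) →
              ∑[ x ∈ xs ] ∑[ y ∈ ys ] f x y ≡ ∑[ x ∈ xs ] ∑[ y ∈ ys ] g x y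
    ∑∑-cong xs ys f≗g = ∑-cong xs λ x → ∑-cong ys (f≗g x)

    ∑∑-*ˡ : ∀ c (xs : List A) (ys : List B) (f : A → B → ℚ) →
            ∑[ x ∈ xs ] ∑[ y ∈ ys ] (c * f x y) ≡ c * ∑[ x ∈ xs ] ∑[ y ∈ ys ] f x y
    ∑∑-*ˡ c xs ys f = trans (∑-cong xs λ x → ∑-*ˡ c ys (f x)) (∑-*ˡ c xs _)

    ∑∑-+ : ∀ (xs : List A) (ys : List B) (f g : A → B → ℚ) →
            ∑[ x ∈ xs ] ∑[ y ∈ ys ] (f x y + g x y) ≡ ∑[ x ∈ xs ] ∑[ y ∈ ys ] f x y + ∑[ x ∈ xs ] ∑[ y ∈ ys ] g x y
    ∑∑-+ xs ys f g = trans (∑-cong xs λ x → ∑-+ ys (f x) (g x)) (∑-+ xs _ _)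

    ∑∑-- : ∀ (xs : List A) (ys : List B) (f g : A → B → ℚ) →
            ∑[ x ∈ xs ] ∑[ y ∈ ys ] (f x y - g x y) ≡ ∑[ x ∈ xs ] ∑[ y ∈ ys ] f x y - ∑[ x ∈ xs ] ∑[ y ∈ ys ] g x y
    ∑∑-- xs ys f g = trans (∑-cong xs λ x → ∑-- ys (f x) (g x)) (∑-- xs _ _)

    ∑-× : ∀ (xs : List A) (ys : List B) (f : A → ℚ) (g : B → ℚ) →
          ∑ xs f * ∑ ys g ≡ ∑[ x ∈ xs ] ∑[ y ∈ ys ] (f x * g y)
    ∑-× xs ys f g = sym (∑-×ˡ xs ys f g)

  -- In the application L a b c indicates uγᵃ + vγᵇ = γᶜ, and L-gram counts the a for which
  -- uγᵃ + vγᵇ = uγᵃ⁺ᵟ + vγᵇ′ ≠ 0.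
  module Incidence
    (n : ℕ) .{{_ : NonZero n}}
    (L : ℕ → ℕ → ℕ → ℚ)
    (L-periodic : ∀ b c → Periodic n (λ a → L a b c))
    (L-idem : ∀ a b c → L a b c * L a b c ≡ L a b c)
    (L-gram : ∀ b b′ δ → ∑[ a ∈ upTo n ] ∑[ c ∈ upTo n ] (L a b c * L (a ℕ.+ δ) b′ c) ≡
       1ℚ - e n δ 0 - e n b′ b - e n b′ (b ℕ.+ δ) + ι (suc n) * (e n δ 0 * e n b′ b))
    where

    private
      R = upTo n
      m = ι n
      q = ι (suc n)

    -- The case b′ = b, δ = 0 of `L-gram`, read through idempotence: 1 - 1 - 1 - 1 + q = n - 1.
    L-total : ∀ b → ∑[ a ∈ R ] ∑[ c ∈ R ] L a b c ≡ m - 1ℚ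
    L-total b = begin
      ∑[ a ∈ R ] ∑[ c ∈ R ] L a b c
        ≡⟨ ∑∑-cong R R (λ a c → trans (sym (L-idem a b c)) (cong (λ x → L a b c * L x b c) (sym (ℕ.+-identityʳ a)))) ⟩
      ∑[ a ∈ R ] ∑[ c ∈ R ] (L a b c * L (a ℕ.+ 0) b c)
        ≡⟨ L-gram b b 0 ⟩
      1ℚ - e n 0 0 - e n b b - e n b (b ℕ.+ 0) + q * (e n 0 0 * e n b b)
        ≡⟨ cong₂ (λ u v → 1ℚ - u - v - e n b (b ℕ.+ 0) + q * (u * v)) (e-refl n 0) (e-refl n b) ⟩
      1ℚ - 1ℚ - 1ℚ - e n b (b ℕ.+ 0) + q * (1ℚ * 1ℚ)
        ≡⟨ cong (λ u → 1ℚ - 1ℚ - 1ℚ - u + q * (1ℚ * 1ℚ)) (trans (cong (e n b) (ℕ.+-identityʳ b)) (e-refl n b)) ⟩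
      1ℚ - 1ℚ - 1ℚ - 1ℚ + q * (1ℚ * 1ℚ)
        ≡⟨ cong (λ u → 1ℚ - 1ℚ - 1ℚ - 1ℚ + u * (1ℚ * 1ℚ)) (ι-suc n) ⟩
      1ℚ - 1ℚ - 1ℚ - 1ℚ + (1ℚ + m) * (1ℚ * 1ℚ)
        ≡⟨ solve 1 (λ m → con 1ℚ :- con 1ℚ :- con 1ℚ :- con 1ℚ :+ (con 1ℚ :+ m) :* (con 1ℚ :* con 1ℚ) := m :- con 1ℚ) refl m ⟩
      m - 1ℚ ∎

    module _ (F : ℕ → ℕ → ℚ) where

      -- On functions f(b)χ(y), with χ a character modulo n, this acts on f by the matrix with
      -- entries ∑ₐ L(a,b,c)χ(a). Carrying `y` along treats the matrices of all χ at once, without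
      -- naming a character.
      T : ℕ → ℕ → ℚ
      T c y = ∑[ b ∈ R ] ∑[ a ∈ R ] (L a b c * F b (y ℕ.+ a))

      total : ℚ
      total = ∑[ b ∈ R ] ∑[ y ∈ R ] F b y

      normSq : ℚ
      normSq = ∑[ b ∈ R ] ∑[ y ∈ R ] (F b y * F b y)

    module _ {F : ℕ → ℕ → ℚ} (Fᵇ : ∀ y → Periodic n (λ b → F b y)) (Fʸ : ∀ b → Periodic n (F b)) where

      private
        S = total F
        -- These are the three marginals of F. In `T-normSq` the squares of `row`, `col` and `diag`
        -- stem from the terms of `L-gram` for b′ = b, for δ = 0 and for b′ = b + δ respectively.
        -- `U` is the part of `T F` due to a single b.
        row : ℕ → ℚ
        row b = ∑ R (F b)
        col : ℕ → ℚ
        col y = ∑[ b ∈ R ] F b y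
        diag : ℕ → ℚ
        diag t = ∑[ b ∈ R ] F b (t ℕ.+ b)
        U : ℕ → ℕ → ℕ → ℚ
        U b c y = ∑[ a ∈ R ] (L a b c * F b (y ℕ.+ a))
        C : ℕ → ℕ → ℕ → ℚ
        C b b′ δ = ∑[ y ∈ R ] (F b y * F b′ (y ℕ.+ δ))

        +-perm : ∀ y δ a → y ℕ.+ (δ ℕ.+ a) ≡ y ℕ.+ a ℕ.+ δ
        +-perm y δ a = trans (cong (y ℕ.+_) (ℕ.+-comm δ a)) (sym (ℕ.+-assoc y a δ))

        +-periodic : ∀ b y → Periodic n (λ a → F b (y ℕ.+ a))
        +-periodic b y a = trans (cong (F b) (sym (ℕ.+-assoc y a n))) (Fʸ b (y ℕ.+ a))

        C-shift : ∀ b b′ δ a → ∑[ y ∈ R ] (F b (y ℕ.+ a) * F b′ (y ℕ.+ (δ ℕ.+ a))) ≡ C b b′ δ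
        C-shift b b′ δ a = trans
          (∑-cong R λ y → cong (λ z → F b (y ℕ.+ a) * F b′ z) (+-perm y δ a))
          (∑-shift n (λ y → cong₂ _*_ (Fʸ b y) (trans (cong (F b′) (trans (ℕ.+-assoc y n δ) (+-perm y n δ))) (Fʸ b′ (y ℕ.+ δ)))) a)

        -- With the second exponent written as δ + a, shifting y by a removes a and c from the
        -- correlation of F. They survive only in the product of the two incidences, which `L-gram`
        -- evaluates.
        U-correlation : ∀ b b′ → ∑[ c ∈ R ] ∑[ y ∈ R ] (U b c y * U b′ c y) ≡
          ∑[ δ ∈ R ] ((∑[ a ∈ R ] ∑[ c ∈ R ] (L a b c * L (a ℕ.+ δ) b′ c)) * C b b′ δ)
        U-correlation b b′ = begin
          ∑[ c ∈ R ] ∑[ y ∈ R ] (U b c y * U b′ c y)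
            ≡⟨ ∑∑-cong R R (λ c y → trans (∑-× R R _ _) (∑-cong R λ a → sym (∑-shift n (λ a′ → cong (L a b c * F b (y ℕ.+ a) *_) (cong₂ _*_ (L-periodic b′ c a′) (+-periodic b′ y a′))) a))) ⟩
          ∑[ c ∈ R ] ∑[ y ∈ R ] ∑[ a ∈ R ] ∑[ δ ∈ R ] (L a b c * F b (y ℕ.+ a) * (L (δ ℕ.+ a) b′ c * F b′ (y ℕ.+ (δ ℕ.+ a))))
            ≡⟨ ∑-cong R (λ c → trans (∑-swap R R _) (∑-cong R λ a → ∑-swap R R _)) ⟩
          ∑[ c ∈ R ] ∑[ a ∈ R ] ∑[ δ ∈ R ] ∑[ y ∈ R ] (L a b c * F b (y ℕ.+ a) * (L (δ ℕ.+ a) b′ c * F b′ (y ℕ.+ (δ ℕ.+ a))))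
            ≡⟨ ∑∑-cong R R (λ c a → ∑-cong R λ δ → trans (∑-cong R λ y → interchange (L a b c) _ (L (δ ℕ.+ a) b′ c) _) (trans (∑-*ˡ (L a b c * L (δ ℕ.+ a) b′ c) R _) (cong₂ _*_ (cong (λ z → L a b c * L z b′ c) (ℕ.+-comm δ a)) (C-shift b b′ δ a)))) ⟩
          ∑[ c ∈ R ] ∑[ a ∈ R ] ∑[ δ ∈ R ] (L a b c * L (a ℕ.+ δ) b′ c * C b b′ δ)
            ≡⟨ trans (∑-cong R λ c → ∑-swap R R _) (∑-swap R R _) ⟩
          ∑[ δ ∈ R ] ∑[ c ∈ R ] ∑[ a ∈ R ] (L a b c * L (a ℕ.+ δ) b′ c * C b b′ δ)
            ≡⟨ ∑-cong R (λ δ → trans (∑-swap R R _) (trans (∑-cong R λ a → ∑-*ʳ (C b b′ δ) R _) (∑-*ʳ (C b b′ δ) R _))) ⟩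
          ∑[ δ ∈ R ] ((∑[ a ∈ R ] ∑[ c ∈ R ] (L a b c * L (a ℕ.+ δ) b′ c)) * C b b′ δ) ∎
          where
          interchange : ∀ s t u v → s * t * (u * v) ≡ s * u * (t * v)
          interchange = solve 4 (λ s t u v → s :* t :* (u :* v) := s :* u :* (t :* v)) refl

        C-periodic : ∀ b b′ → Periodic n (C b b′)
        C-periodic b b′ δ = ∑-cong R λ y → cong (F b y *_) (+-periodic b′ y δ)

        ∑C : ∀ b b′ → ∑ R (C b b′) ≡ row b * row b′
        ∑C b b′ = begin
          ∑[ δ ∈ R ] ∑[ y ∈ R ] (F b y * F b′ (y ℕ.+ δ))  ≡⟨ ∑-swap R R _ ⟩
          ∑[ y ∈ R ] ∑[ δ ∈ R ] (F b y * F b′ (y ℕ.+ δ))  ≡⟨ ∑-cong R (λ y → trans (∑-*ˡ (F b y) R _) (cong (F b y *_) (trans (∑-cong R λ δ → cong (F b′) (ℕ.+-comm y δ)) (∑-shift n (Fʸ b′) y)))) ⟩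
          ∑[ y ∈ R ] (F b y * row b′)                     ≡⟨ ∑-*ʳ (row b′) R (F b) ⟩
          row b * row b′                                  ∎

        ∑-e₀ : ∀ {f : ℕ → ℚ} → Periodic n f → ∑[ δ ∈ R ] (e n δ 0 * f δ) ≡ f 0
        ∑-e₀ per = ∑-e n per 0

        U-gram : ∀ b b′ → ∑[ c ∈ R ] ∑[ y ∈ R ] (U b c y * U b′ c y) ≡
          row b * row b′ - C b b′ 0 - e n b′ b * (row b * row b′) - ∑[ δ ∈ R ] (e n b′ (b ℕ.+ δ) * C b b′ δ) + q * (e n b′ b * C b b′ 0)
        U-gram b b′ = begin
          ∑[ c ∈ R ] ∑[ y ∈ R ] (U b c y * U b′ c y)
            ≡⟨ U-correlation b b′ ⟩
          ∑[ δ ∈ R ] ((∑[ a ∈ R ] ∑[ c ∈ R ] (L a b c * L (a ℕ.+ δ) b′ c)) * C b b′ δ)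
            ≡⟨ ∑-cong R (λ δ → trans (cong (_* C b b′ δ) (L-gram b b′ δ)) (expand (e n δ 0) (e n b′ b) (e n b′ (b ℕ.+ δ)) q (C b b′ δ))) ⟩
          ∑[ δ ∈ R ] (C b b′ δ - e n δ 0 * C b b′ δ - e n b′ b * C b b′ δ - e n b′ (b ℕ.+ δ) * C b b′ δ + q * e n b′ b * (e n δ 0 * C b b′ δ))
            ≡⟨ trans (∑-+ R _ _) (cong₂ _+_ (trans (∑-- R _ _) (cong₂ _-_ (trans (∑-- R _ _) (cong₂ _-_ (∑-- R _ _) (∑-*ˡ (e n b′ b) R _))) refl)) (∑-*ˡ (q * e n b′ b) R _)) ⟩
          ∑ R (C b b′) - ∑[ δ ∈ R ] (e n δ 0 * C b b′ δ) - e n b′ b * ∑ R (C b b′) - ∑[ δ ∈ R ] (e n b′ (b ℕ.+ δ) * C b b′ δ) + q * e n b′ b * ∑[ δ ∈ R ] (e n δ 0 * C b b′ δ)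
            ≡⟨ cong₂ (λ s t → s - t - e n b′ b * s - ∑[ δ ∈ R ] (e n b′ (b ℕ.+ δ) * C b b′ δ) + q * e n b′ b * t) (∑C b b′) (∑-e₀ (C-periodic b b′)) ⟩
          row b * row b′ - C b b′ 0 - e n b′ b * (row b * row b′) - ∑[ δ ∈ R ] (e n b′ (b ℕ.+ δ) * C b b′ δ) + q * e n b′ b * C b b′ 0
            ≡⟨ cong (row b * row b′ - C b b′ 0 - e n b′ b * (row b * row b′) - ∑[ δ ∈ R ] (e n b′ (b ℕ.+ δ) * C b b′ δ) +_) (ℚ.*-assoc q (e n b′ b) (C b b′ 0)) ⟩
          row b * row b′ - C b b′ 0 - e n b′ b * (row b * row b′) - ∑[ δ ∈ R ] (e n b′ (b ℕ.+ δ) * C b b′ δ) + q * (e n b′ b * C b b′ 0) ∎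
          where
          expand : ∀ x y z q c → (1ℚ - x - y - z + q * (x * y)) * c ≡ c - x * c - y * c - z * c + q * y * (x * c)
          expand = solve 5 (λ x y z q c → (con 1ℚ :- x :- y :- z :+ q :* (x :* y)) :* c := c :- x :* c :- y :* c :- z :* c :+ q :* y :* (x :* c)) refl

        row-periodic : Periodic n row
        row-periodic b = ∑-cong R λ y → Fᵇ y b

        cols : ∑[ b ∈ R ] ∑[ b′ ∈ R ] C b b′ 0 ≡ ∑[ y ∈ R ] (col y * col y)
        cols = begin
          ∑[ b ∈ R ] ∑[ b′ ∈ R ] ∑[ y ∈ R ] (F b y * F b′ (y ℕ.+ 0))
            ≡⟨ trans (∑-cong R λ b → ∑-swap R R _) (∑-swap R R _) ⟩
          ∑[ y ∈ R ] ∑[ b ∈ R ] ∑[ b′ ∈ R ] (F b y * F b′ (y ℕ.+ 0))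
            ≡⟨ ∑-cong R (λ y → trans (∑-×ˡ R R _ _) (cong (λ z → col y * col z) (ℕ.+-identityʳ y))) ⟩
          ∑[ y ∈ R ] (col y * col y) ∎

        -- The delta forces b′ = b + δ. Substituting y = t + b puts both arguments of F on the
        -- diagonal t, and b and b + δ then range over it independently.
        diags : ∑[ b ∈ R ] ∑[ b′ ∈ R ] ∑[ δ ∈ R ] (e n b′ (b ℕ.+ δ) * C b b′ δ) ≡ ∑[ t ∈ R ] (diag t * diag t)
        diags = begin
          ∑[ b ∈ R ] ∑[ b′ ∈ R ] ∑[ δ ∈ R ] (e n b′ (b ℕ.+ δ) * C b b′ δ)
            ≡⟨ ∑-cong R (λ b → trans (∑-swap R R _) (∑-cong R λ δ → ∑-e n (λ b′ → ∑-cong R λ y → cong (F b y *_) (Fᵇ (y ℕ.+ δ) b′)) (b ℕ.+ δ))) ⟩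
          ∑[ b ∈ R ] ∑[ δ ∈ R ] C b (b ℕ.+ δ) δ
            ≡⟨ ∑∑-cong R R (λ b δ → trans (cong (λ z → C b z δ) (ℕ.+-comm b δ)) (sym (C-shift b (δ ℕ.+ b) δ b))) ⟩
          ∑[ b ∈ R ] ∑[ δ ∈ R ] ∑[ t ∈ R ] (F b (t ℕ.+ b) * F (δ ℕ.+ b) (t ℕ.+ (δ ℕ.+ b)))
            ≡⟨ trans (∑-cong R λ b → ∑-swap R R _) (∑-swap R R _) ⟩
          ∑[ t ∈ R ] ∑[ b ∈ R ] ∑[ δ ∈ R ] (F b (t ℕ.+ b) * F (δ ℕ.+ b) (t ℕ.+ (δ ℕ.+ b)))
            ≡⟨ ∑∑-cong R R (λ t b → trans (∑-*ˡ (F b (t ℕ.+ b)) R _) (cong (F b (t ℕ.+ b) *_) (∑-shift n (λ b′ → trans (Fᵇ _ b′) (+-periodic b′ t b′)) b))) ⟩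
          ∑[ t ∈ R ] ∑[ b ∈ R ] (F b (t ℕ.+ b) * diag t)
            ≡⟨ ∑-cong R (λ t → ∑-*ʳ (diag t) R _) ⟩
          ∑[ t ∈ R ] (diag t * diag t) ∎

      -- This is the statement on T*T in the form of a norm: the coefficient q of `L-gram` yields
      -- the multiple of `normSq F`, its constant 1 yields S², and its three deltas yield the
      -- marginals.
      T-normSq : ∑[ c ∈ R ] ∑[ y ∈ R ] (T F c y * T F c y) ≡
        q * normSq F + S * S - ∑[ b ∈ R ] (row b * row b) - ∑[ y ∈ R ] (col y * col y) - ∑[ t ∈ R ] (diag t * diag t)
      T-normSq = begin
        ∑[ c ∈ R ] ∑[ y ∈ R ] (T F c y * T F c y)
          ≡⟨ ∑∑-cong R R (λ c y → ∑-× R R _ _) ⟩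
        ∑[ c ∈ R ] ∑[ y ∈ R ] ∑[ b ∈ R ] ∑[ b′ ∈ R ] (U b c y * U b′ c y)
          ≡⟨ trans (∑-cong R λ c → trans (∑-swap R R _) (∑-cong R λ b → ∑-swap R R _)) (trans (∑-swap R R _) (∑-cong R λ b → ∑-swap R R _)) ⟩
        ∑[ b ∈ R ] ∑[ b′ ∈ R ] ∑[ c ∈ R ] ∑[ y ∈ R ] (U b c y * U b′ c y)
          ≡⟨ ∑∑-cong R R U-gram ⟩
        ∑[ b ∈ R ] ∑[ b′ ∈ R ] (row b * row b′ - C b b′ 0 - e n b′ b * (row b * row b′) - ∑[ δ ∈ R ] (e n b′ (b ℕ.+ δ) * C b b′ δ) + q * (e n b′ b * C b b′ 0))
          ≡⟨ trans (∑∑-+ R R _ _) (cong₂ _+_ (trans (∑∑-- R R _ _) (cong₂ _-_ (trans (∑∑-- R R _ _) (cong₂ _-_ (trans (∑∑-- R R _ _) (cong₂ _-_ (∑-×ˡ R R row row) cols)) (∑-cong R λ b → ∑-e n (λ b′ → cong (row b *_) (row-periodic b′)) b))) diags)) (trans (∑∑-*ˡ q R R _) (cong (q *_) (∑-cong R λ b → trans (∑-e n (λ b′ → ∑-cong R λ y → cong (F b y *_) (Fᵇ (y ℕ.+ 0) b′)) b) (∑-cong R λ y → cong (λ z → F b y * F b z) (ℕ.+-identityʳ y)))))) ⟩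
        S * S - ∑[ y ∈ R ] (col y * col y) - ∑[ b ∈ R ] (row b * row b) - ∑[ t ∈ R ] (diag t * diag t) + q * normSq F
          ≡⟨ solve 5 (λ s c r d f → s :- c :- r :- d :+ f := f :+ s :- r :- c :- d) refl (S * S) _ _ _ (q * normSq F) ⟩
        q * normSq F + S * S - ∑[ b ∈ R ] (row b * row b) - ∑[ y ∈ R ] (col y * col y) - ∑[ t ∈ R ] (diag t * diag t) ∎

      T-total : ∑[ c ∈ R ] ∑[ y ∈ R ] T F c y ≡ (m - 1ℚ) * S
      T-total = begin
        ∑[ c ∈ R ] ∑[ y ∈ R ] ∑[ b ∈ R ] ∑[ a ∈ R ] (L a b c * F b (y ℕ.+ a))
          ≡⟨ ∑-cong R (λ c → trans (∑-swap R R _) (∑-cong R λ b → trans (∑-swap R R _) (∑-cong R λ a → trans (∑-*ˡ (L a b c) R _) (cong (L a b c *_) (∑-shift n (Fʸ b) a))))) ⟩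
        ∑[ c ∈ R ] ∑[ b ∈ R ] ∑[ a ∈ R ] (L a b c * row b)
          ≡⟨ trans (∑-swap R R _) (∑-cong R λ b → trans (∑-swap R R _) (trans (∑-cong R λ a → ∑-*ʳ (row b) R _) (trans (∑-*ʳ (row b) R _) (cong (_* row b) (L-total b))))) ⟩
        ∑[ b ∈ R ] ((m - 1ℚ) * row b)
          ≡⟨ ∑-*ˡ (m - 1ℚ) R row ⟩
        (m - 1ℚ) * S ∎

      private
        total-col : S ≡ ∑ R col
        total-col = ∑-swap R R _

        total-diag : S ≡ ∑ R diag
        total-diag = trans (∑-cong R λ b → sym (∑-shift n (Fʸ b) b)) (∑-swap R R _)

      -- Expanding the square needs only `T-normSq` and `T-total`. The result is the right side
      -- minus two non-negative quantities.
      T-bound : 3 ℕ.≤ n →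
        ∑[ c ∈ R ] ∑[ y ∈ R ] ((m * m * T F c y - q * S) * (m * m * T F c y - q * S)) ≤ m * m * (m * m) * q * normSq F
      T-bound 3≤n = ℚ.≤-trans (ℚ.≤-reflexive expansion) (ℚ.≤-trans (p-q≤p _ square≥0) (p-q≤p _ marginals≥0))
        where
        r₁ = ∑[ b ∈ R ] (row b * row b)
        r₂ = ∑[ y ∈ R ] (col y * col y)
        r₃ = ∑[ t ∈ R ] (diag t * diag t)
        gap≥0 : ∀ {f} → S ≡ ∑ R f → 0ℚ ≤ m * ∑[ x ∈ R ] (f x * f x) - S * S
        gap≥0 {f} eq = q≤p⇒0≤p-q (subst (λ s → s * s ≤ m * ∑[ x ∈ R ] (f x * f x)) (sym eq) (∑-square-≤ n f))
        0≤m = 0≤ι n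
        marginals≥0 : 0ℚ ≤ m * m * m * ((m * r₁ - S * S) + (m * r₂ - S * S) + (m * r₃ - S * S))
        marginals≥0 = 0≤p*q (0≤p*q (0≤p*p m) 0≤m) (0≤p+q (0≤p+q (gap≥0 refl) (gap≥0 total-col)) (gap≥0 total-diag))
        -- When each marginal r is replaced by m r - S², the multiples of S² that remain add up to
        -- -m²(m - 3); here n ≥ 3 enters.
        square≥0 : 0ℚ ≤ m * m * (m - ι 3) * (S * S)
        square≥0 = 0≤p*q (0≤p*q (0≤p*p m) (q≤p⇒0≤p-q (ι-mono 3≤n))) (0≤p*p S)
        expansion : ∑[ c ∈ R ] ∑[ y ∈ R ] ((m * m * T F c y - q * S) * (m * m * T F c y - q * S)) ≡
          m * m * (m * m) * q * normSq F - m * m * m * ((m * r₁ - S * S) + (m * r₂ - S * S) + (m * r₃ - S * S)) - m * m * (m - ι 3) * (S * S)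
        expansion = begin
          ∑[ c ∈ R ] ∑[ y ∈ R ] ((m * m * T F c y - q * S) * (m * m * T F c y - q * S))
            ≡⟨ ∑∑-cong R R (λ c y → solve 4 (λ m q s t → (m :* m :* t :- q :* s) :* (m :* m :* t :- q :* s) := m :* m :* (m :* m) :* (t :* t) :- con (ι 2) :* (m :* m) :* (q :* s) :* t :+ q :* s :* (q :* s)) refl m q S (T F c y)) ⟩
          ∑[ c ∈ R ] ∑[ y ∈ R ] (m * m * (m * m) * (T F c y * T F c y) - ι 2 * (m * m) * (q * S) * T F c y + q * S * (q * S))
            ≡⟨ trans (∑∑-+ R R _ _) (cong₂ _+_ (trans (∑∑-- R R _ _) (cong₂ _-_ (trans (∑∑-*ˡ (m * m * (m * m)) R R _) (cong (m * m * (m * m) *_) T-normSq)) (trans (∑∑-*ˡ (ι 2 * (m * m) * (q * S)) R R _) (cong (ι 2 * (m * m) * (q * S) *_) T-total)))) (trans (∑-cong R λ c → ∑-upTo-const n _) (∑-upTo-const n _))) ⟩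
          m * m * (m * m) * (q * normSq F + S * S - r₁ - r₂ - r₃) - ι 2 * (m * m) * (q * S) * ((m - 1ℚ) * S) + m * (m * (q * S * (q * S)))
            ≡⟨ cong (λ q → m * m * (m * m) * (q * normSq F + S * S - r₁ - r₂ - r₃) - ι 2 * (m * m) * (q * S) * ((m - 1ℚ) * S) + m * (m * (q * S * (q * S)))) (ι-suc n) ⟩
          m * m * (m * m) * ((1ℚ + m) * normSq F + S * S - r₁ - r₂ - r₃) - ι 2 * (m * m) * ((1ℚ + m) * S) * ((m - 1ℚ) * S) + m * (m * ((1ℚ + m) * S * ((1ℚ + m) * S)))
            ≡⟨ arithmetic m S (normSq F) r₁ r₂ r₃ ⟩
          m * m * (m * m) * (1ℚ + m) * normSq F - m * m * m * ((m * r₁ - S * S) + (m * r₂ - S * S) + (m * r₃ - S * S)) - m * m * (m - ι 3) * (S * S)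
            ≡⟨ cong (λ q → m * m * (m * m) * q * normSq F - m * m * m * ((m * r₁ - S * S) + (m * r₂ - S * S) + (m * r₃ - S * S)) - m * m * (m - ι 3) * (S * S)) (ι-suc n) ⟨
          m * m * (m * m) * q * normSq F - m * m * m * ((m * r₁ - S * S) + (m * r₂ - S * S) + (m * r₃ - S * S)) - m * m * (m - ι 3) * (S * S) ∎
          where
          arithmetic : ∀ m S N r₁ r₂ r₃ →
            m * m * (m * m) * ((1ℚ + m) * N + S * S - r₁ - r₂ - r₃) - ι 2 * (m * m) * ((1ℚ + m) * S) * ((m - 1ℚ) * S) + m * (m * ((1ℚ + m) * S * ((1ℚ + m) * S))) ≡
            m * m * (m * m) * (1ℚ + m) * N - m * m * m * ((m * r₁ - S * S) + (m * r₂ - S * S) + (m * r₃ - S * S)) - m * m * (m - ι 3) * (S * S)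
          arithmetic = solve 6 (λ m S N r₁ r₂ r₃ →
            m :* m :* (m :* m) :* ((con 1ℚ :+ m) :* N :+ S :* S :- r₁ :- r₂ :- r₃) :- con (ι 2) :* (m :* m) :* ((con 1ℚ :+ m) :* S) :* ((m :- con 1ℚ) :* S) :+ m :* (m :* ((con 1ℚ :+ m) :* S :* ((con 1ℚ :+ m) :* S))) :=
            m :* m :* (m :* m) :* (con 1ℚ :+ m) :* N :- m :* m :* m :* ((m :* r₁ :- S :* S) :+ (m :* r₂ :- S :* S) :+ (m :* r₃ :- S :* S)) :- m :* m :* (m :- con (ι 3)) :* (S :* S)) refl

  -- Factorisation of kernels

  -- A factorisation of the kernel k through a weighted ℓ² space. The constant C, an upper bound for the
  -- Schur multiplier norm of k, takes over the role of the sum of the absolute values of the Fourier coefficients.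
  record Factorisation (n : ℕ) (k : ℕ → ℕ → ℚ) (C : ℚ) : Set₁ where
    field
      {Index}    : Set
      indices    : List Index
      weight     : Index → ℚ
      0≤weight   : ∀ i → 0ℚ ≤ weight i
      p r        : Index → ℕ → ℚ
      p-periodic : ∀ i → Periodic n (p i)
      r-periodic : ∀ i → Periodic n (r i)
      factors    : ∀ x y → ∑[ i ∈ indices ] (weight i * (p i x * r i y)) ≡ k x y
      p-norm     : ∀ x → ∑[ i ∈ indices ] (weight i * (p i x * p i x)) ≡ C
      r-norm     : ∀ x → ∑[ i ∈ indices ] (weight i * (r i x * r i x)) ≡ C

  -- The scalar `s` carries the factors that do not depend on the indices, such as `g b * g c` in
  -- `pairing`.
  ∑-tensor : ∀ {a b} {A : Set a} {B : Set b} (xs : List A) (ys : List B) (w₁ u₁ : A → ℚ) (w₂ u₂ : B → ℚ) s →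
    ∑[ k ∈ cartesianProduct xs ys ] (w₁ (proj₁ k) * w₂ (proj₂ k) * (s * (u₁ (proj₁ k) * u₂ (proj₂ k)))) ≡
    s * (∑[ x ∈ xs ] (w₁ x * u₁ x) * ∑[ y ∈ ys ] (w₂ y * u₂ y))
  ∑-tensor xs ys w₁ u₁ w₂ u₂ s = begin
    ∑[ k ∈ cartesianProduct xs ys ] (w₁ (proj₁ k) * w₂ (proj₂ k) * (s * (u₁ (proj₁ k) * u₂ (proj₂ k))))
      ≡⟨ ∑-cartesianProduct xs ys _ ⟩
    ∑[ x ∈ xs ] ∑[ y ∈ ys ] (w₁ x * w₂ y * (s * (u₁ x * u₂ y)))
      ≡⟨ ∑∑-cong xs ys (λ x y → solve 5 (λ w₁ w₂ s u₁ u₂ → w₁ :* w₂ :* (s :* (u₁ :* u₂)) := s :* (w₁ :* u₁ :* (w₂ :* u₂))) refl (w₁ x) (w₂ y) s (u₁ x) (u₂ y)) ⟩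
    ∑[ x ∈ xs ] ∑[ y ∈ ys ] (s * (w₁ x * u₁ x * (w₂ y * u₂ y)))
      ≡⟨ ∑∑-*ˡ s xs ys _ ⟩
    s * ∑[ x ∈ xs ] ∑[ y ∈ ys ] (w₁ x * u₁ x * (w₂ y * u₂ y))
      ≡⟨ cong (s *_) (∑-×ˡ xs ys _ _) ⟩
    s * (∑[ x ∈ xs ] (w₁ x * u₁ x) * ∑[ y ∈ ys ] (w₂ y * u₂ y)) ∎

  module _ {n : ℕ} {k₁ k₂ : ℕ → ℕ → ℚ} {C₁ C₂ : ℚ} (φ₁ : Factorisation n k₁ C₁) (φ₂ : Factorisation n k₂ C₂) where

    private
      module φ₁ = Factorisation φ₁
      module φ₂ = Factorisation φ₂

    -- Schur multiplier norms are submultiplicative: the tensor product of the two weighted spaces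
    -- factors the pointwise product of the kernels.
    tensor : Factorisation n (λ x y → k₁ x y * k₂ x y) (C₁ * C₂)
    tensor = record
      { indices    = cartesianProduct φ₁.indices φ₂.indices
      ; weight     = λ k → φ₁.weight (proj₁ k) * φ₂.weight (proj₂ k)
      ; 0≤weight   = λ k → 0≤p*q (φ₁.0≤weight (proj₁ k)) (φ₂.0≤weight (proj₂ k))
      ; p          = λ k x → φ₁.p (proj₁ k) x * φ₂.p (proj₂ k) x
      ; r          = λ k x → φ₁.r (proj₁ k) x * φ₂.r (proj₂ k) x
      ; p-periodic = λ k x → cong₂ _*_ (φ₁.p-periodic (proj₁ k) x) (φ₂.p-periodic (proj₂ k) x)
      ; r-periodic = λ k x → cong₂ _*_ (φ₁.r-periodic (proj₁ k) x) (φ₂.r-periodic (proj₂ k) x)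
      ; factors    = λ x y → multiply φ₁.p φ₁.r φ₂.p φ₂.r x y (φ₁.factors x y) (φ₂.factors x y)
      ; p-norm     = λ x → multiply φ₁.p φ₁.p φ₂.p φ₂.p x x (φ₁.p-norm x) (φ₂.p-norm x)
      ; r-norm     = λ x → multiply φ₁.r φ₁.r φ₂.r φ₂.r x x (φ₁.r-norm x) (φ₂.r-norm x)
      }
      where
      multiply : ∀ (s t : φ₁.Index → ℕ → ℚ) (u v : φ₂.Index → ℕ → ℚ) x y {a b} →
        ∑[ i ∈ φ₁.indices ] (φ₁.weight i * (s i x * t i y)) ≡ a →
        ∑[ j ∈ φ₂.indices ] (φ₂.weight j * (u j x * v j y)) ≡ b →
        ∑[ k ∈ cartesianProduct φ₁.indices φ₂.indices ]
          (φ₁.weight (proj₁ k) * φ₂.weight (proj₂ k) * (s (proj₁ k) x * u (proj₂ k) x * (t (proj₁ k) y * v (proj₂ k) y))) ≡ a * b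
      multiply s t u v x y eq₁ eq₂ = trans
        (∑-cong (cartesianProduct φ₁.indices φ₂.indices) λ k → cong (φ₁.weight (proj₁ k) * φ₂.weight (proj₂ k) *_)
          (solve 4 (λ s t u v → s :* u :* (t :* v) := con 1ℚ :* (s :* t :* (u :* v))) refl (s (proj₁ k) x) (t (proj₁ k) y) (u (proj₂ k) x) (v (proj₂ k) y)))
        (trans (∑-tensor φ₁.indices φ₂.indices φ₁.weight (λ i → s i x * t i y) φ₂.weight (λ j → u j x * v j y) 1ℚ)
        (trans (ℚ.*-identityˡ _) (cong₂ _*_ eq₁ eq₂)))

  -- The sum over a, b, c as a weighted sum of pairings

  module QuadrupleSum
    (n : ℕ) .{{_ : NonZero n}}
    (L : ℕ → ℕ → ℕ → ℚ)
    (L-periodic : ∀ b c → Periodic n (λ a → L a b c))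
    (L-idem : ∀ a b c → L a b c * L a b c ≡ L a b c)
    (L-gram : ∀ b b′ δ → ∑[ a ∈ upTo n ] ∑[ c ∈ upTo n ] (L a b c * L (a ℕ.+ δ) b′ c) ≡
       1ℚ - e n δ 0 - e n b′ b - e n b′ (b ℕ.+ δ) + ι (suc n) * (e n δ 0 * e n b′ b))
    {K : ℕ → ℕ → ℚ} {C : ℚ} (φ : Factorisation n K C)
    (K-+ : ∀ x y z → K (x ℕ.+ z) (y ℕ.+ z) ≡ K x y)
    (Kˡ : ∀ y → Periodic n (λ x → K x y))
    (g : ℕ → ℚ) (g-periodic : Periodic n g)
    where

    open Incidence n L L-periodic L-idem L-gram
    open Factorisation φ

    private
      R = upTo n
      m = ι n
      q = ι (suc n)
      I² = cartesianProduct indices indices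
      I²R² = cartesianProduct I² (cartesianProduct R R)
      w : Index × Index → ℚ
      w k = weight (proj₁ k) * weight (proj₂ k)
      -- The first index of `k` belongs to the factor K(a,0), rewritten as K(y + a, y), and the
      -- second to K(a + b, c), rewritten as K(y + a + b, y + c). The same formula serves for both
      -- sides of the pairing, once with `p` and once with `r`.
      test : (Index → ℕ → ℚ) → Index × Index → ℕ → ℕ → ℚ
      test p k b y = g b * (p (proj₁ k) y * p (proj₂ k) (y ℕ.+ b))

    ∑g² : ℚ
    ∑g² = ∑[ b ∈ R ] (g b * g b)

    weighted all : ℚ
    weighted = ∑[ c ∈ R ] ∑[ b ∈ R ] ∑[ a ∈ R ] (L a b c * (g b * g c * (K a 0 * K (a ℕ.+ b) c)))
    all      = ∑[ c ∈ R ] ∑[ b ∈ R ] ∑[ a ∈ R ] (g b * g c * (K a 0 * K (a ℕ.+ b) c))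

    private
      -- Norms are controlled only after the weighted summation over `k`: at each point (b,y) the
      -- index sums are C and C, whatever y is, and the sum over y contributes the factor m.
      test-norm : ∀ (p : Index → ℕ → ℚ) → (∀ x → ∑[ i ∈ indices ] (weight i * (p i x * p i x)) ≡ C) →
        ∑[ k ∈ I² ] (w k * normSq (test p k)) ≡ m * (C * C * ∑g²)
      test-norm p norm = begin
        ∑[ k ∈ I² ] (w k * normSq (test p k))
          ≡⟨ ∑-cong I² (λ k → sym (∑∑-*ˡ (w k) R R _)) ⟩
        ∑[ k ∈ I² ] ∑[ b ∈ R ] ∑[ y ∈ R ] (w k * (test p k b y * test p k b y))
          ≡⟨ trans (∑-swap I² R _) (∑-cong R λ b → ∑-swap I² R _) ⟩
        ∑[ b ∈ R ] ∑[ y ∈ R ] ∑[ k ∈ I² ] (w k * (test p k b y * test p k b y))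
          ≡⟨ ∑∑-cong R R (λ b y → trans (∑-cong I² λ k → cong (w k *_) (square (g b) (p (proj₁ k) y) (p (proj₂ k) (y ℕ.+ b)))) (∑-tensor indices indices weight _ weight _ (g b * g b))) ⟩
        ∑[ b ∈ R ] ∑[ y ∈ R ] (g b * g b * (∑[ i ∈ indices ] (weight i * (p i y * p i y)) * ∑[ i ∈ indices ] (weight i * (p i (y ℕ.+ b) * p i (y ℕ.+ b)))))
          ≡⟨ ∑-cong R (λ b → trans (∑-cong R λ y → cong₂ (λ s t → g b * g b * (s * t)) (norm y) (norm (y ℕ.+ b))) (∑-upTo-const n _)) ⟩
        ∑[ b ∈ R ] (m * (g b * g b * (C * C)))
          ≡⟨ trans (∑-*ˡ m R _) (cong (m *_) (trans (∑-*ʳ (C * C) R _) (ℚ.*-comm ∑g² (C * C)))) ⟩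
        m * (C * C * ∑g²) ∎
        where
        square : ∀ g s t → g * (s * t) * (g * (s * t)) ≡ g * g * (s * s * (t * t))
        square = solve 3 (λ g s t → g :* (s :* t) :* (g :* (s :* t)) := g :* g :* (s :* s :* (t :* t))) refl

      pairing : ∀ b c x y → ∑[ k ∈ I² ] (w k * (test p k b x * test r k c y)) ≡ g b * g c * (K x y * K (x ℕ.+ b) (y ℕ.+ c))
      pairing b c x y = begin
        ∑[ k ∈ I² ] (w k * (test p k b x * test r k c y))
          ≡⟨ ∑-cong I² (λ k → cong (w k *_) (rearrange (g b) (g c) (p (proj₁ k) x) (p (proj₂ k) (x ℕ.+ b)) (r (proj₁ k) y) (r (proj₂ k) (y ℕ.+ c)))) ⟩
        ∑[ k ∈ I² ] (w k * (g b * g c * (p (proj₁ k) x * r (proj₁ k) y * (p (proj₂ k) (x ℕ.+ b) * r (proj₂ k) (y ℕ.+ c)))))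
          ≡⟨ ∑-tensor indices indices weight _ weight _ (g b * g c) ⟩
        g b * g c * (∑[ i ∈ indices ] (weight i * (p i x * r i y)) * ∑[ i ∈ indices ] (weight i * (p i (x ℕ.+ b) * r i (y ℕ.+ c))))
          ≡⟨ cong₂ (λ s t → g b * g c * (s * t)) (factors x y) (factors (x ℕ.+ b) (y ℕ.+ c)) ⟩
        g b * g c * (K x y * K (x ℕ.+ b) (y ℕ.+ c)) ∎
        where
        rearrange : ∀ s t u v x y → s * (u * v) * (t * (x * y)) ≡ s * t * (u * x * (v * y))
        rearrange = solve 6 (λ s t u v x y → s :* (u :* v) :* (t :* (x :* y)) := s :* t :* (u :* x :* (v :* y))) refl

      -- `K` depends only on the difference of its arguments, so the auxiliary y drops out.
      pairing-shift : ∀ b c a y → g b * g c * (K (a ℕ.+ y) y * K (a ℕ.+ y ℕ.+ b) (y ℕ.+ c)) ≡ g b * g c * (K a 0 * K (a ℕ.+ b) c)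
      pairing-shift b c a y = cong₂ (λ s t → g b * g c * (s * t)) (K-+ a 0 y)
        (trans (cong₂ K (trans (ℕ.+-assoc a y b) (trans (cong (a ℕ.+_) (ℕ.+-comm y b)) (sym (ℕ.+-assoc a b y)))) (ℕ.+-comm y c)) (K-+ (a ℕ.+ b) c y))

      -- Undoing the two factorisations under the sum recovers the wanted summand for every y alike;
      -- the n values of y give the factor m.
      weighted-pairing : ∑[ k ∈ I² ] ∑[ c ∈ R ] ∑[ y ∈ R ] (w k * (T (test p k) c y * test r k c y)) ≡ m * weighted
      weighted-pairing = begin
        ∑[ k ∈ I² ] ∑[ c ∈ R ] ∑[ y ∈ R ] (w k * (T (test p k) c y * test r k c y))
          ≡⟨ trans (∑-swap I² R _) (∑-cong R λ c → ∑-swap I² R _) ⟩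
        ∑[ c ∈ R ] ∑[ y ∈ R ] ∑[ k ∈ I² ] (w k * (T (test p k) c y * test r k c y))
          ≡⟨ ∑∑-cong R R (λ c y → ∑-cong I² λ k → expand k c y) ⟩
        ∑[ c ∈ R ] ∑[ y ∈ R ] ∑[ k ∈ I² ] ∑[ b ∈ R ] ∑[ a ∈ R ] (L a b c * (w k * (test p k b (y ℕ.+ a) * test r k c y)))
          ≡⟨ ∑∑-cong R R (λ c y → trans (∑-swap I² R _) (∑-cong R λ b → trans (∑-swap I² R _) (∑-cong R λ a → trans (∑-*ˡ (L a b c) I² _) (cong (L a b c *_) (trans (pairing b c (y ℕ.+ a) y) (trans (cong (λ x → g b * g c * (K x y * K (x ℕ.+ b) (y ℕ.+ c))) (ℕ.+-comm y a)) (pairing-shift b c a y))))))) ⟩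
        ∑[ c ∈ R ] ∑[ y ∈ R ] ∑[ b ∈ R ] ∑[ a ∈ R ] (L a b c * (g b * g c * (K a 0 * K (a ℕ.+ b) c)))
          ≡⟨ trans (∑-cong R λ c → ∑-upTo-const n _) (∑-*ˡ m R _) ⟩
        m * weighted ∎
        where
        expand : ∀ k c y → w k * (T (test p k) c y * test r k c y) ≡ ∑[ b ∈ R ] ∑[ a ∈ R ] (L a b c * (w k * (test p k b (y ℕ.+ a) * test r k c y)))
        expand k c y = begin
          w k * (T (test p k) c y * test r k c y)
            ≡⟨ solve 3 (λ w t h → w :* (t :* h) := w :* h :* t) refl (w k) _ (test r k c y) ⟩
          w k * test r k c y * T (test p k) c y
            ≡⟨ ∑∑-*ˡ (w k * test r k c y) R R _ ⟨
          ∑[ b ∈ R ] ∑[ a ∈ R ] (w k * test r k c y * (L a b c * test p k b (y ℕ.+ a)))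
            ≡⟨ ∑∑-cong R R (λ b a → solve 4 (λ w h l t → w :* h :* (l :* t) := l :* (w :* (t :* h))) refl (w k) (test r k c y) (L a b c) (test p k b (y ℕ.+ a))) ⟩
          ∑[ b ∈ R ] ∑[ a ∈ R ] (L a b c * (w k * (test p k b (y ℕ.+ a) * test r k c y))) ∎

      -- The same computation with the incidence `L` replaced by 1. Since the summation variable is
      -- now x instead of y + a, a shift by y is made first.
      total-pairing : ∑[ k ∈ I² ] ∑[ c ∈ R ] ∑[ y ∈ R ] (w k * (total (test p k) * test r k c y)) ≡ m * all
      total-pairing = begin
        ∑[ k ∈ I² ] ∑[ c ∈ R ] ∑[ y ∈ R ] (w k * (total (test p k) * test r k c y))
          ≡⟨ trans (∑-swap I² R _) (∑-cong R λ c → ∑-swap I² R _) ⟩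
        ∑[ c ∈ R ] ∑[ y ∈ R ] ∑[ k ∈ I² ] (w k * (total (test p k) * test r k c y))
          ≡⟨ ∑∑-cong R R (λ c y → ∑-cong I² λ k → expand k c y) ⟩
        ∑[ c ∈ R ] ∑[ y ∈ R ] ∑[ k ∈ I² ] ∑[ b ∈ R ] ∑[ x ∈ R ] (w k * (test p k b x * test r k c y))
          ≡⟨ ∑∑-cong R R (λ c y → trans (∑-swap I² R _) (∑-cong R λ b → trans (∑-swap I² R _) (trans (∑-cong R λ x → pairing b c x y) (trans (sym (∑-shift n (periodic b c y) y)) (∑-cong R λ a → pairing-shift b c a y))))) ⟩
        ∑[ c ∈ R ] ∑[ y ∈ R ] ∑[ b ∈ R ] ∑[ a ∈ R ] (g b * g c * (K a 0 * K (a ℕ.+ b) c))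
          ≡⟨ trans (∑-cong R λ c → ∑-upTo-const n _) (∑-*ˡ m R _) ⟩
        m * all ∎
        where
        periodic : ∀ b c y → Periodic n (λ x → g b * g c * (K x y * K (x ℕ.+ b) (y ℕ.+ c)))
        periodic b c y x = cong₂ (λ s t → g b * g c * (s * t)) (Kˡ y x)
          (trans (cong (λ z → K z (y ℕ.+ c)) (trans (ℕ.+-assoc x n b) (trans (cong (x ℕ.+_) (ℕ.+-comm n b)) (sym (ℕ.+-assoc x b n))))) (Kˡ (y ℕ.+ c) (x ℕ.+ b)))
        expand : ∀ k c y → w k * (total (test p k) * test r k c y) ≡ ∑[ b ∈ R ] ∑[ x ∈ R ] (w k * (test p k b x * test r k c y))
        expand k c y = begin
          w k * (total (test p k) * test r k c y)
            ≡⟨ solve 3 (λ w t h → w :* (t :* h) := w :* h :* t) refl (w k) _ (test r k c y) ⟩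
          w k * test r k c y * total (test p k)
            ≡⟨ ∑∑-*ˡ (w k * test r k c y) R R _ ⟨
          ∑[ b ∈ R ] ∑[ x ∈ R ] (w k * test r k c y * test p k b x)
            ≡⟨ ∑∑-cong R R (λ b x → solve 3 (λ w h t → w :* h :* t := w :* (t :* h)) refl (w k) (test r k c y) (test p k b x)) ⟩
          ∑[ b ∈ R ] ∑[ x ∈ R ] (w k * (test p k b x * test r k c y)) ∎

      deviation : Index × Index → ℕ → ℕ → ℚ
      deviation k c y = m * m * T (test p k) c y - q * total (test p k)

      testᵇ : ∀ k y → Periodic n (λ b → test p k b y)
      testᵇ k y b = cong₂ (λ s t → s * (p (proj₁ k) y * t)) (g-periodic b) (trans (cong (p (proj₂ k)) (sym (ℕ.+-assoc y b n))) (p-periodic (proj₂ k) (y ℕ.+ b)))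

      testʸ : ∀ k b → Periodic n (test p k b)
      testʸ k b y = cong₂ (λ s t → g b * (s * t)) (p-periodic (proj₁ k) y)
        (trans (cong (p (proj₂ k)) (trans (ℕ.+-assoc y n b) (trans (cong (y ℕ.+_) (ℕ.+-comm n b)) (sym (ℕ.+-assoc y b n))))) (p-periodic (proj₂ k) (y ℕ.+ b)))

      flatten : ∀ (f : Index × Index → ℕ → ℕ → ℚ) →
        ∑[ z ∈ I²R² ] (w (proj₁ z) * f (proj₁ z) (proj₁ (proj₂ z)) (proj₂ (proj₂ z))) ≡ ∑[ k ∈ I² ] (w k * ∑[ c ∈ R ] ∑[ y ∈ R ] f k c y)
      flatten f = trans (∑-cartesianProduct I² _ _) (∑-cong I² λ k → trans (∑-cartesianProduct R R _) (∑∑-*ˡ (w k) R R (f k)))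

      deviation-pairing : ∑[ k ∈ I² ] (w k * ∑[ c ∈ R ] ∑[ y ∈ R ] (deviation k c y * test r k c y)) ≡ m * m * (m * weighted) - q * (m * all)
      deviation-pairing = begin
        ∑[ k ∈ I² ] (w k * ∑[ c ∈ R ] ∑[ y ∈ R ] (deviation k c y * test r k c y))
          ≡⟨ ∑-cong I² (λ k → trans (sym (∑∑-*ˡ (w k) R R _)) (trans (∑∑-cong R R λ c y → split (w k) m q (T (test p k) c y) (total (test p k)) (test r k c y)) (trans (∑∑-- R R _ _) (cong₂ _-_ (∑∑-*ˡ (m * m) R R _) (∑∑-*ˡ q R R _))))) ⟩
        ∑[ k ∈ I² ] (m * m * (∑[ c ∈ R ] ∑[ y ∈ R ] (w k * (T (test p k) c y * test r k c y))) - q * (∑[ c ∈ R ] ∑[ y ∈ R ] (w k * (total (test p k) * test r k c y))))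
          ≡⟨ trans (∑-- I² _ _) (cong₂ _-_ (∑-*ˡ (m * m) I² _) (∑-*ˡ q I² _)) ⟩
        m * m * (∑[ k ∈ I² ] ∑[ c ∈ R ] ∑[ y ∈ R ] (w k * (T (test p k) c y * test r k c y))) - q * (∑[ k ∈ I² ] ∑[ c ∈ R ] ∑[ y ∈ R ] (w k * (total (test p k) * test r k c y)))
          ≡⟨ cong₂ (λ s t → m * m * s - q * t) weighted-pairing total-pairing ⟩
        m * m * (m * weighted) - q * (m * all) ∎
        where
        split : ∀ w m q t s h → w * ((m * m * t - q * s) * h) ≡ m * m * (w * (t * h)) - q * (w * (s * h))
        split = solve 6 (λ w m q t s h → w :* ((m :* m :* t :- q :* s) :* h) := m :* m :* (w :* (t :* h)) :- q :* (w :* (s :* h))) refl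

    -- Cauchy-Schwarz is applied once, over index pairs and points (c,y) jointly, because only the
    -- norms summed over `k` are known. `T-bound` is then used for each `k` separately.
    deviation-bound : 3 ℕ.≤ n →
      (m * m * (m * weighted) - q * (m * all)) * (m * m * (m * weighted) - q * (m * all)) ≤
      m * m * (m * m) * q * (m * (C * C * ∑g²)) * (m * (C * C * ∑g²))
    deviation-bound 3≤n = ℚ.≤-trans
      (subst₂ _≤_ (cong₂ _*_ pairing≡ pairing≡) (cong₂ _*_ (flatten _) (flatten _)) (cauchy-schwarz I²R² (w ∘ proj₁) dev tst (0≤w ∘ proj₁)))
      (*-mono-≤ 0≤dev 0≤X dev≤ (ℚ.≤-reflexive (test-norm r r-norm)))
      where
      dev tst : (Index × Index) × (ℕ × ℕ) → ℚ
      dev z = deviation (proj₁ z) (proj₁ (proj₂ z)) (proj₂ (proj₂ z))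
      tst z = test r (proj₁ z) (proj₁ (proj₂ z)) (proj₂ (proj₂ z))
      0≤w : ∀ k → 0ℚ ≤ w k
      0≤w k = 0≤p*q (0≤weight (proj₁ k)) (0≤weight (proj₂ k))
      pairing≡ = trans (flatten (λ k c y → deviation k c y * test r k c y)) deviation-pairing
      0≤dev : 0ℚ ≤ ∑[ k ∈ I² ] (w k * ∑[ c ∈ R ] ∑[ y ∈ R ] (deviation k c y * deviation k c y))
      0≤dev = 0≤∑ I² λ k → 0≤p*q (0≤w k) (0≤∑ R λ c → 0≤∑ R λ y → 0≤p*p (deviation k c y))
      0≤X : 0ℚ ≤ m * (C * C * ∑g²)
      0≤X = 0≤p*q (0≤ι n) (0≤p*q (0≤p*p C) (0≤∑ R λ b → 0≤p*p (g b)))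
      dev≤ : ∑[ k ∈ I² ] (w k * ∑[ c ∈ R ] ∑[ y ∈ R ] (deviation k c y * deviation k c y)) ≤ m * m * (m * m) * q * (m * (C * C * ∑g²))
      dev≤ = ℚ.≤-trans
        (∑-mono I² λ k → ℚ.*-monoˡ-≤-nonNeg (w k) {{ℚ.nonNegative (0≤w k)}} (T-bound (testᵇ k) (testʸ k) 3≤n))
        (ℚ.≤-reflexive (trans
          (∑-cong I² λ k → solve 3 (λ w c s → w :* (c :* s) := c :* (w :* s)) refl (w k) (m * m * (m * m) * q) (normSq (test p k)))
          (trans (∑-*ˡ (m * m * (m * m) * q) I² _) (cong (m * m * (m * m) * q *_) (test-norm p p-norm)))))

  -- Independence of residues modulo distinct primes

  module _ {a} {A : Set a} where

    ∏ : List A → (A → ℚ) → ℚ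
    ∏ []       f = 1ℚ
    ∏ (x ∷ xs) f = f x * ∏ xs f

    foldr≡∏ : ∀ xs (f : A → ℚ) → foldr (λ x r → f x * r) 1ℚ xs ≡ ∏ xs f
    foldr≡∏ []       f = refl
    foldr≡∏ (x ∷ xs) f = cong (f x *_) (foldr≡∏ xs f)

    ∏-cong : ∀ {p} {P : Pred A p} {xs} {f g : A → ℚ} → All P xs → (∀ {x} → P x → f x ≡ g x) → ∏ xs f ≡ ∏ xs g
    ∏-cong []         f≗g = refl
    ∏-cong (px ∷ pxs) f≗g = cong₂ _*_ (f≗g px) (∏-cong pxs f≗g)

    ∏-* : ∀ xs (f g : A → ℚ) → ∏ xs f * ∏ xs g ≡ ∏ xs (λ x → f x * g x)
    ∏-* []       f g = refl
    ∏-* (x ∷ xs) f g = trans (solve 4 (λ a b c d → a :* b :* (c :* d) := a :* c :* (b :* d)) refl (f x) (∏ xs f) (g x) (∏ xs g))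
                             (cong (f x * g x *_) (∏-* xs f g))

    1≤∏ : ∀ {p} {P : Pred A p} {xs} {f : A → ℚ} → All P xs → (∀ {x} → P x → 1ℚ ≤ f x) → 1ℚ ≤ ∏ xs f
    1≤∏ []         1≤f = ℚ.≤-refl
    1≤∏ (px ∷ pxs) 1≤f = *-mono-≤ (0≤ι 1) (ℚ.≤-trans (0≤ι 1) (1≤∏ pxs 1≤f)) (1≤f px) (1≤∏ pxs 1≤f)

    ∑-filter : ∀ {p} {P : Pred A p} (P? : Decidable P) xs → ι (length (filter P? xs)) ≡ ∑[ x ∈ xs ] 𝟙 (P? x)
    ∑-filter P? []       = refl
    ∑-filter P? (x ∷ xs) with P? x
    ... | true  because _ = trans (ι-suc (length (filter P? xs))) (cong (1ℚ +_) (∑-filter P? xs))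
    ... | false because _ = trans (∑-filter P? xs) (sym (ℚ.+-identityˡ _))

  ∏-periodic : ∀ {n ls} {F : ℕ → ℕ → ℚ} → All (_∣ n) ls → (∀ l → Periodic l (F l)) → Periodic n (λ x → ∏ ls (λ l → F l x))
  ∏-periodic []               per x = refl
  ∏-periodic {F = F} (_∷_ {x = l} l∣n ls∣n) per x = cong₂ _*_ (periodic-∣ {f = F l} (per l) l∣n x) (∏-periodic ls∣n per x)

  ∤⇒coprime : ∀ {l r} → Prime l → ¬ l ∣ r → Coprime r l
  ∤⇒coprime pl l∤r (d∣r , d∣l) with prime⇒irreducible pl d∣l
  ... | inj₁ d≡1  = d≡1
  ... | inj₂ refl = contradiction d∣r l∤r

  ∣product⇒∈ : ∀ {l ls} → Prime l → All Prime ls → l ∣ product ls → l ∈ ls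
  ∣product⇒∈ {l} pl []                     l∣1 = contradiction (∣1⇒≡1 l∣1) (ℕ.nonTrivial⇒≢1 {{prime⇒nonTrivial pl}})
  ∣product⇒∈ {l} pl (_∷_ {x = l′} {xs = ls} pl′ pls) l∣ with euclidsLemma l′ (product ls) pl l∣
  ... | inj₂ l∣ls = there (∣product⇒∈ pl pls l∣ls)
  ... | inj₁ l∣l′ with prime⇒irreducible pl′ l∣l′
  ...   | inj₁ l≡1  = contradiction l≡1 (ℕ.nonTrivial⇒≢1 {{prime⇒nonTrivial pl}})
  ...   | inj₂ l≡l′ = here l≡l′

  coprime-product : ∀ {l ls} → Prime l → All Prime ls → All (l ≢_) ls → Coprime (product ls) l
  coprime-product pl pls l∉ls = ∤⇒coprime pl λ l∣ → All.lookup l∉ls (∣product⇒∈ pl pls l∣) refl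

  ∣-product : ∀ ls → All (_∣ product ls) ls
  ∣-product []       = []
  ∣-product (l ∷ ls) = m∣m*n (product ls) ∷ All.map (λ d → ∣-trans d (n∣m*n l)) (∣-product ls)

  ∃-primeDivisor : ∀ n .{{_ : NonZero n}} → n ≢ 1 → ∃[ l ] (Prime l × l ∣ n)
  ∃-primeDivisor n n≢1 with factorise n
  ... | record { factors = []     ; isFactorisation = eq } = contradiction eq n≢1
  ... | record { factors = l ∷ ls ; isFactorisation = refl ; factorsPrime = pl ∷ _ } = l , pl , m∣m*n (product ls)

  0<ι-nonZero : ∀ l .{{_ : NonZero l}} → 0ℚ < ι l
  0<ι-nonZero (suc l) = 0<ι l

  -- A form of the Chinese remainder theorem: the product over the other primes has period
  -- `product ls`, which is prime to l, so the factor at l is independent of it. Multiplying by l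
  -- avoids a division.
  ∑-∏ : ∀ {n ls} {F : ℕ → ℕ → ℚ} {M : ℕ → ℚ} → All Prime ls → Unique ls → All (_∣ n) ls →
    (∀ l → Periodic l (F l)) → (∀ {l} → Prime l → ∑ (upTo l) (F l) ≡ ι l * M l) →
    ∑[ x ∈ upTo n ] ∏ ls (λ l → F l x) ≡ ι n * ∏ ls M
  ∑-∏ {n} []                                          _               _             per mean = ∑-upTo-const n 1ℚ
  ∑-∏ {n} {l ∷ ls} {F} {M} (pl ∷ pls) (l∉ls ∷ uls) (l∣n ∷ ls∣n) per mean =
    *-cancelˡ (0<ι-nonZero l {{prime⇒nonZero pl}}) (begin
      ι l * ∑[ x ∈ upTo n ] (F l x * u x)   ≡⟨ cong (ι l *_) (∑-cong (upTo n) λ x → ℚ.*-comm (F l x) (u x)) ⟩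
      ι l * ∑[ x ∈ upTo n ] (u x * F l x)   ≡⟨ ∑-*-coprime-periods n {u = u} {f = F l} (∏-periodic ls∣n per) (periodic-∣ {f = F l} (per l) l∣n) (∏-periodic (∣-product ls) per) (per l) (coprime-product pl pls l∉ls) ⟩
      ∑ (upTo n) u * ∑ (upTo l) (F l)       ≡⟨ cong₂ _*_ (∑-∏ pls uls ls∣n per mean) (mean pl) ⟩
      ι n * ∏ ls M * (ι l * M l)            ≡⟨ solve 4 (λ n p l m → n :* p :* (l :* m) := l :* (n :* (m :* p))) refl (ι n) (∏ ls M) (ι l) (M l) ⟩
      ι l * (ι n * (M l * ∏ ls M))          ∎)
    where
    u : ℕ → ℚ
    u x = ∏ ls (λ l → F l x)

  inv : ℕ → ℚ
  inv zero    = 0ℚ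
  inv (suc l) = ℤ.+ 1 ℚ./ suc l

  ι*inv : ∀ l .{{_ : NonZero l}} → ι l * inv l ≡ 1ℚ
  ι*inv (suc l) = trans (ℚ.*-comm (ι (suc l)) (inv (suc l))) (/-*-cancel 1 l)

  ι*[x*inv] : ∀ l .{{_ : NonZero l}} x → ι l * (x * inv l) ≡ x
  ι*[x*inv] l x = begin
    ι l * (x * inv l)   ≡⟨ solve 3 (λ t x i → t :* (x :* i) := t :* i :* x) refl (ι l) x (inv l) ⟩
    ι l * inv l * x     ≡⟨ cong (_* x) (ι*inv l) ⟩
    1ℚ * x              ≡⟨ ℚ.*-identityˡ x ⟩
    x                   ∎

  -- Densities and the kernel factorisation at a single prime

  ne : ℕ → ℕ → ℕ → ℚ
  ne l x y = 1ℚ - e l x y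

  ne-periodicˡ : ∀ y l → Periodic l (λ x → ne l x y)
  ne-periodicˡ y l x = cong (λ s → 1ℚ - s) (e-periodicˡ l y x)

  ne-idem : ∀ l x y → ne l x y * ne l x y ≡ ne l x y
  ne-idem l x y = trans (solve 1 (λ e → (con 1ℚ :- e) :* (con 1ℚ :- e) := con 1ℚ :- e :- e :+ e :* e) refl (e l x y))
    (trans (cong (1ℚ - e l x y - e l x y +_) (𝟙-idem (mod l x ℕ.≟ mod l y)))
    (solve 1 (λ e → con 1ℚ :- e :- e :+ e := con 1ℚ :- e) refl (e l x y)))

  θₗ : ℕ → ℚ
  θₗ l = 1ℚ - inv l

  module _ (l : ℕ) .{{_ : NonZero l}} where

    private
      t = ι l
      i = inv l

    ∑-affine-e : ∀ a b y → ∑[ x ∈ upTo l ] (a + b * e l x y) ≡ t * a + b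
    ∑-affine-e a b y = begin
      ∑[ x ∈ upTo l ] (a + b * e l x y)                    ≡⟨ ∑-+ (upTo l) _ _ ⟩
      ∑[ x ∈ upTo l ] a + ∑[ x ∈ upTo l ] (b * e l x y)    ≡⟨ cong₂ _+_ (∑-upTo-const l a) (∑-*ˡ b (upTo l) _) ⟩
      t * a + b * ∑[ x ∈ upTo l ] e l x y                  ≡⟨ cong (λ s → t * a + b * s) (∑-e-1 l y) ⟩
      t * a + b * 1ℚ                                       ≡⟨ cong (t * a +_) (ℚ.*-identityʳ b) ⟩
      t * a + b                                            ∎

    ∑-ne : ∀ y → ∑[ x ∈ upTo l ] ne l x y ≡ t - 1ℚ
    ∑-ne y = begin
      ∑[ x ∈ upTo l ] ne l x y                     ≡⟨ ∑-cong (upTo l) (λ x → solve 1 (λ e → con 1ℚ :- e := con 1ℚ :+ con (- 1ℚ) :* e) refl (e l x y)) ⟩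
      ∑[ x ∈ upTo l ] (1ℚ + - 1ℚ * e l x y)        ≡⟨ ∑-affine-e 1ℚ (- 1ℚ) y ⟩
      t * 1ℚ + - 1ℚ                                ≡⟨ cong (λ s → s + - 1ℚ) (ℚ.*-identityʳ t) ⟩
      t - 1ℚ                                       ∎

    ∑-ne-* : ∀ {f : ℕ → ℚ} → Periodic l f → ∀ y → ∑[ x ∈ upTo l ] (ne l x y * f x) ≡ ∑ (upTo l) f - f y
    ∑-ne-* {f} per y = begin
      ∑[ x ∈ upTo l ] (ne l x y * f x)
        ≡⟨ ∑-cong (upTo l) (λ x → solve 2 (λ e f → (con 1ℚ :- e) :* f := f :- e :* f) refl (e l x y) (f x)) ⟩
      ∑[ x ∈ upTo l ] (f x - e l x y * f x)              ≡⟨ ∑-- (upTo l) _ _ ⟩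
      ∑ (upTo l) f - ∑[ x ∈ upTo l ] (e l x y * f x)     ≡⟨ cong (λ s → ∑ (upTo l) f - s) (∑-e l per y) ⟩
      ∑ (upTo l) f - f y                                 ∎

    mean-θ : ∑[ x ∈ upTo l ] ne l x 0 ≡ t * θₗ l
    mean-θ = trans (∑-ne 0) (sym (trans (solve 2 (λ t i → t :* (con 1ℚ :- i) := t :- t :* i) refl t i) (cong (λ s → t - s) (ι*inv l))))

    -- These are densities modulo l of the conditions a ≠ 0, b ≠ 0, c ≠ 0, a + b ≠ c: `mean₁`
    -- averages over a, `mean₂` over a and b, `mean₃` over all three, and each imposes the
    -- non-vanishing only of the variables already averaged.
    mean₁ : ℕ → ℕ → ℚ
    mean₁ b c = (t - ι 2 + e l b c) * i

    mean₂ : ℕ → ℚ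
    mean₂ c = ((t - 1ℚ) * (t - ι 2) + ne l c 0) * i * i

    mean₃ : ℚ
    mean₃ = ((t - 1ℚ) * (t - 1ℚ) * (t - ι 2) + (t - 1ℚ)) * i * i * i

    -- Of the l residues, a = 0 and a = c - b are excluded; these two coincide exactly when b = c.
    ∑-mean₁ : ∀ b c → ∑[ a ∈ upTo l ] (ne l a 0 * ne l (a ℕ.+ b) c) ≡ t * mean₁ b c
    ∑-mean₁ b c = begin
      ∑[ a ∈ upTo l ] (ne l a 0 * ne l (a ℕ.+ b) c)    ≡⟨ ∑-ne-* per 0 ⟩
      ∑[ a ∈ upTo l ] ne l (a ℕ.+ b) c - ne l b c      ≡⟨ cong (λ s → s - ne l b c) (trans (∑-shift l (ne-periodicˡ c l) b) (∑-ne c)) ⟩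
      t - 1ℚ - (1ℚ - e l b c)                          ≡⟨ solve 2 (λ t e → t :- con 1ℚ :- (con 1ℚ :- e) := t :- con (ι 2) :+ e) refl t (e l b c) ⟩
      t - ι 2 + e l b c                                ≡⟨ ι*[x*inv] l _ ⟨
      t * mean₁ b c                                    ∎
      where
      per : Periodic l (λ a → ne l (a ℕ.+ b) c)
      per a = trans (cong (λ x → ne l x c) (trans (ℕ.+-assoc a l b) (trans (cong (a ℕ.+_) (ℕ.+-comm l b)) (sym (ℕ.+-assoc a b l))))) (ne-periodicˡ c l (a ℕ.+ b))

    mean₁-periodic : ∀ c → Periodic l (λ b → mean₁ b c)
    mean₁-periodic c b = cong (λ x → (t - ι 2 + x) * i) (e-periodicˡ l c b)

    ∑-mean₂ : ∀ c → ∑[ b ∈ upTo l ] (ne l b 0 * mean₁ b c) ≡ t * mean₂ c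
    ∑-mean₂ c = begin
      ∑[ b ∈ upTo l ] (ne l b 0 * mean₁ b c)
        ≡⟨ ∑-ne-* (mean₁-periodic c) 0 ⟩
      ∑[ b ∈ upTo l ] mean₁ b c - mean₁ 0 c
        ≡⟨ cong (λ s → s - mean₁ 0 c) (trans (∑-*ʳ i (upTo l) _) (cong (_* i) (trans (∑-cong (upTo l) λ b → cong (t - ι 2 +_) (sym (ℚ.*-identityˡ (e l b c)))) (∑-affine-e (t - ι 2) 1ℚ c)))) ⟩
      (t * (t - ι 2) + 1ℚ) * i - (t - ι 2 + e l 0 c) * i
        ≡⟨ cong (λ x → (t * (t - ι 2) + 1ℚ) * i - (t - ι 2 + x) * i) (e-sym l 0 c) ⟩
      (t * (t - ι 2) + 1ℚ) * i - (t - ι 2 + e l c 0) * i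
        ≡⟨ solve 3 (λ t i e → (t :* (t :- con (ι 2)) :+ con 1ℚ) :* i :- (t :- con (ι 2) :+ e) :* i := ((t :- con 1ℚ) :* (t :- con (ι 2)) :+ (con 1ℚ :- e)) :* i) refl t i (e l c 0) ⟩
      ((t - 1ℚ) * (t - ι 2) + ne l c 0) * i
        ≡⟨ ι*[x*inv] l _ ⟨
      t * mean₂ c ∎

    ∑-mean₃ : ∑[ c ∈ upTo l ] (ne l c 0 * mean₂ c) ≡ t * mean₃
    ∑-mean₃ = begin
      ∑[ c ∈ upTo l ] (ne l c 0 * mean₂ c)
        ≡⟨ ∑-cong (upTo l) (λ c → trans (solve 3 (λ s x i → s :* ((x :+ s) :* i :* i) := (x :* s :+ s :* s) :* i :* i) refl (ne l c 0) ((t - 1ℚ) * (t - ι 2)) i) (cong (λ s → ((t - 1ℚ) * (t - ι 2) * ne l c 0 + s) * i * i) (ne-idem l c 0))) ⟩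
      ∑[ c ∈ upTo l ] (((t - 1ℚ) * (t - ι 2) * ne l c 0 + ne l c 0) * i * i)
        ≡⟨ trans (∑-*ʳ i (upTo l) _) (cong (_* i) (trans (∑-*ʳ i (upTo l) _) (cong (_* i) (trans (∑-+ (upTo l) _ _) (cong₂ _+_ (trans (∑-*ˡ ((t - 1ℚ) * (t - ι 2)) (upTo l) _) (cong ((t - 1ℚ) * (t - ι 2) *_) (∑-ne 0))) (∑-ne 0)))))) ⟩
      ((t - 1ℚ) * (t - ι 2) * (t - 1ℚ) + (t - 1ℚ)) * i * i
        ≡⟨ solve 2 (λ t i → ((t :- con 1ℚ) :* (t :- con (ι 2)) :* (t :- con 1ℚ) :+ (t :- con 1ℚ)) :* i :* i := ((t :- con 1ℚ) :* (t :- con 1ℚ) :* (t :- con (ι 2)) :+ (t :- con 1ℚ)) :* i :* i) refl t i ⟩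
      ((t - 1ℚ) * (t - 1ℚ) * (t - ι 2) + (t - 1ℚ)) * i * i
        ≡⟨ ι*[x*inv] l _ ⟨
      t * mean₃ ∎

    -- The projections e_x - 1/l of the basis vectors to the hyperplane of sum zero have Gram matrix
    -- e - 1/l, and 1 - e = (1 - 1/l) - (e - 1/l). The constant part and the hyperplane part each
    -- contribute 1 - 1/l to the norm. The total is the sum of the absolute Fourier coefficients of
    -- the indicator of the non-zero residues: 1 - 1/l once and 1/l taken l - 1 times.
    ne-factorisation : ∀ {n} → l ∣ n → Factorisation n (ne l) (ι 2 * θₗ l)
    ne-factorisation l∣n = record
      { indices    = nothing ∷ map just (upTo l)
      ; weight     = weight
      ; 0≤weight   = 0≤weight
      ; p          = p
      ; r          = r
      ; p-periodic = λ { nothing x → refl ; (just z) → periodic-∣ (λ x → cong (λ s → s - i) (e-periodicˡ l z x)) l∣n }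
      ; r-periodic = λ { nothing x → refl ; (just z) → periodic-∣ (λ x → cong (λ s → - (s - i)) (e-periodicˡ l z x)) l∣n }
      ; factors    = factors
      ; p-norm     = λ x → norm p x (λ z → ℚ.*-identityˡ _) refl
      ; r-norm     = λ x → norm r x (λ z → solve 1 (λ u → con 1ℚ :* ((:- u) :* (:- u)) := u :* u) refl (e l x z - i)) refl
      }
      where
      weight : Maybe ℕ → ℚ
      weight nothing  = θₗ l
      weight (just _) = 1ℚ
      p r : Maybe ℕ → ℕ → ℚ
      p nothing  x = 1ℚ
      p (just z) x = e l x z - i
      r nothing  x = 1ℚ
      -- Only `r` takes the sign of the negative part of the kernel; the norms do not see it, and
      -- the weights stay non-negative.
      r (just z) x = - (e l x z - i)
      0≤weight : ∀ z → 0ℚ ≤ weight z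
      0≤weight nothing  = q≤p⇒0≤p-q (ℚ.*-cancelˡ-≤-pos t {{ℚ.positive (0<ι-nonZero l)}} (subst₂ _≤_ (sym (ι*inv l)) (sym (ℚ.*-identityʳ t)) (ι-mono {1} {l} (ℕ.>-nonZero⁻¹ l))))
      0≤weight (just _) = 0≤ι 1
      gram : ∀ x y → ∑[ z ∈ upTo l ] ((e l x z - i) * (e l y z - i)) ≡ e l x y - i
      gram x y = begin
        ∑[ z ∈ upTo l ] ((e l x z - i) * (e l y z - i))
          ≡⟨ ∑-cong (upTo l) (λ z → cong₂ (λ s t → (s - i) * (t - i)) (e-sym l x z) (e-sym l y z)) ⟩
        ∑[ z ∈ upTo l ] ((e l z x - i) * (e l z y - i))
          ≡⟨ ∑-cong (upTo l) (λ z → solve 3 (λ e f i → (e :- i) :* (f :- i) := e :* (f :- i) :+ (i :* i :+ (con 0ℚ :- i) :* f)) refl (e l z x) (e l z y) i) ⟩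
        ∑[ z ∈ upTo l ] (e l z x * (e l z y - i) + (i * i + (0ℚ - i) * e l z y))
          ≡⟨ trans (∑-+ (upTo l) _ _) (cong₂ _+_ (∑-e l (λ z → cong (λ s → s - i) (e-periodicˡ l y z)) x) (∑-affine-e (i * i) (0ℚ - i) y)) ⟩
        e l x y - i + (t * (i * i) + (0ℚ - i))
          ≡⟨ cong (λ s → e l x y - i + (s + (0ℚ - i))) (ι*[x*inv] l i) ⟩
        e l x y - i + (i + (0ℚ - i))
          ≡⟨ solve 2 (λ e i → e :- i :+ (i :+ (con 0ℚ :- i)) := e :- i) refl (e l x y) i ⟩
        e l x y - i ∎
      factors : ∀ x y → ∑[ z ∈ nothing ∷ map just (upTo l) ] (weight z * (p z x * r z y)) ≡ ne l x y
      factors x y = begin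
        θₗ l * (1ℚ * 1ℚ) + ∑ (map just (upTo l)) (λ z → weight z * (p z x * r z y))
          ≡⟨ cong (θₗ l * (1ℚ * 1ℚ) +_) (∑-map just (upTo l) _) ⟩
        θₗ l * (1ℚ * 1ℚ) + ∑[ z ∈ upTo l ] (1ℚ * ((e l x z - i) * - (e l y z - i)))
          ≡⟨ cong (θₗ l * (1ℚ * 1ℚ) +_) (trans (∑-cong (upTo l) λ z → solve 2 (λ u v → con 1ℚ :* (u :* (:- v)) := :- (u :* v)) refl (e l x z - i) (e l y z - i)) (∑-neg (upTo l) _)) ⟩
        θₗ l * (1ℚ * 1ℚ) - ∑[ z ∈ upTo l ] ((e l x z - i) * (e l y z - i))
          ≡⟨ cong (λ s → θₗ l * (1ℚ * 1ℚ) - s) (gram x y) ⟩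
        (1ℚ - i) * (1ℚ * 1ℚ) - (e l x y - i)
          ≡⟨ solve 2 (λ e i → (con 1ℚ :- i) :* (con 1ℚ :* con 1ℚ) :- (e :- i) := con 1ℚ :- e) refl (e l x y) i ⟩
        ne l x y ∎
      norm : ∀ (s : Maybe ℕ → ℕ → ℚ) x → (∀ z → 1ℚ * (s (just z) x * s (just z) x) ≡ (e l x z - i) * (e l x z - i)) → s nothing x ≡ 1ℚ →
        ∑[ z ∈ nothing ∷ map just (upTo l) ] (weight z * (s z x * s z x)) ≡ ι 2 * θₗ l
      norm s x eq eq₀ = begin
        θₗ l * (s nothing x * s nothing x) + ∑ (map just (upTo l)) (λ z → weight z * (s z x * s z x))
          ≡⟨ cong₂ (λ u v → θₗ l * (u * u) + v) eq₀ (∑-map just (upTo l) _) ⟩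
        θₗ l * (1ℚ * 1ℚ) + ∑[ z ∈ upTo l ] (1ℚ * (s (just z) x * s (just z) x))
          ≡⟨ cong (θₗ l * (1ℚ * 1ℚ) +_) (trans (∑-cong (upTo l) eq) (gram x x)) ⟩
        (1ℚ - i) * (1ℚ * 1ℚ) + (e l x x - i)
          ≡⟨ cong (λ s → (1ℚ - i) * (1ℚ * 1ℚ) + (s - i)) (e-refl l x) ⟩
        (1ℚ - i) * (1ℚ * 1ℚ) + (1ℚ - i)
          ≡⟨ solve 1 (λ i → (con 1ℚ :- i) :* (con 1ℚ :* con 1ℚ) :+ (con 1ℚ :- i) := con (ι 2) :* (con 1ℚ :- i)) refl i ⟩
        ι 2 * θₗ l ∎

  -- Exponents prime to n

  constant-factorisation : ∀ n → Factorisation n (λ _ _ → 1ℚ) 1ℚ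
  constant-factorisation n = record
    { indices    = tt ∷ []
    ; weight     = λ _ → 1ℚ
    ; 0≤weight   = λ _ → 0≤ι 1
    ; p          = λ _ _ → 1ℚ
    ; r          = λ _ _ → 1ℚ
    ; p-periodic = λ _ _ → refl
    ; r-periodic = λ _ _ → refl
    ; factors    = λ _ _ → refl
    ; p-norm     = λ _ → refl
    ; r-norm     = λ _ → refl
    }

  ∏-factorisation : ∀ {n ls} → All Prime ls → All (_∣ n) ls → Factorisation n (λ x y → ∏ ls (λ l → ne l x y)) (∏ ls (λ l → ι 2 * θₗ l))
  ∏-factorisation {n} []           _            = constant-factorisation n
  ∏-factorisation     (_∷_ {x = l} pl pls) (l∣n ∷ ls∣n) =
    tensor (ne-factorisation l {{prime⇒nonZero pl}} l∣n) (∏-factorisation pls ls∣n)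

  1≤2θₗ : ∀ {l} → Prime l → 1ℚ ≤ ι 2 * θₗ l
  1≤2θₗ {l} pl = ℚ.*-cancelˡ-≤-pos (ι l) {{ℚ.positive (0<ι-nonZero l)}} (0≤p-q⇒q≤p (subst (0ℚ ≤_) (sym eq) (q≤p⇒0≤p-q (ι-mono {2} {l} (ℕ.nonTrivial⇒n>1 l {{prime⇒nonTrivial pl}})))))
    where
    instance _ = prime⇒nonZero pl
    eq : ι l * (ι 2 * θₗ l) - ι l * 1ℚ ≡ ι l - ι 2
    eq = begin
      ι l * (ι 2 * (1ℚ - inv l)) - ι l * 1ℚ   ≡⟨ solve 2 (λ t i → t :* (con (ι 2) :* (con 1ℚ :- i)) :- t :* con 1ℚ := t :- con (ι 2) :* (t :* i)) refl (ι l) (inv l) ⟩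
      ι l - ι 2 * (ι l * inv l)               ≡⟨ cong (λ s → ι l - ι 2 * s) (ι*inv l) ⟩
      ι l - ι 2 * 1ℚ                          ∎

  -- With s = l - 1 and t = l this is s²(s - 1) + s = s³(1 - 1/s + 1/s²), divided by t³.
  mean₃≡ : ∀ {l} (pl : Prime l) → mean₃ l {{prime⇒nonZero pl}} ≡ θₗ l * θₗ l * θₗ l * τfactor l
  mean₃≡ {suc (suc k)} pl = begin
    ((t - 1ℚ) * (t - 1ℚ) * (t - ι 2) + (t - 1ℚ)) * i * i * i
      ≡⟨ cong (λ t → ((t - 1ℚ) * (t - 1ℚ) * (t - ι 2) + (t - 1ℚ)) * i * i * i) (ι-suc (suc k)) ⟩
    ((1ℚ + s - 1ℚ) * (1ℚ + s - 1ℚ) * (1ℚ + s - ι 2) + (1ℚ + s - 1ℚ)) * i * i * i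
      ≡⟨ solve 2 (λ s i → ((con 1ℚ :+ s :- con 1ℚ) :* (con 1ℚ :+ s :- con 1ℚ) :* (con 1ℚ :+ s :- con (ι 2)) :+ (con 1ℚ :+ s :- con 1ℚ)) :* i :* i :* i := i :* i :* i :* (s :* s :* s :- s :* s :* con 1ℚ :+ s :* con 1ℚ)) refl s i ⟩
    i * i * i * (s * s * s - s * s * 1ℚ + s * 1ℚ)
      ≡⟨ cong₂ (λ u v → i * i * i * (s * s * s - s * s * u + s * v)) (ι*inv (suc k)) (trans (cong (_* κ₂) (sym (ι-* (suc k) (suc k)))) (ι*inv (suc k ℕ.* suc k))) ⟨
    i * i * i * (s * s * s - s * s * (s * κ₁) + s * (s * s * κ₂))
      ≡⟨ solve 4 (λ s i κ₁ κ₂ → i :* i :* i :* (s :* s :* s :- s :* s :* (s :* κ₁) :+ s :* (s :* s :* κ₂)) := (s :* i) :* (s :* i) :* (s :* i) :* (con 1ℚ :- κ₁ :+ κ₂)) refl s i κ₁ κ₂ ⟩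
    (s * i) * (s * i) * (s * i) * (1ℚ - κ₁ + κ₂)
      ≡⟨ cong (λ u → u * u * u * (1ℚ - κ₁ + κ₂)) si ⟩
    θₗ (suc (suc k)) * θₗ (suc (suc k)) * θₗ (suc (suc k)) * τfactor (suc (suc k)) ∎
    where
    t = ι (suc (suc k))
    s = ι (suc k)
    i = inv (suc (suc k))
    κ₁ = inv (suc k)
    κ₂ = inv (suc k ℕ.* suc k)
    si : s * i ≡ 1ℚ - i
    si = begin
      s * i                  ≡⟨ solve 2 (λ s i → s :* i := (con 1ℚ :+ s) :* i :- i) refl s i ⟩
      (1ℚ + s) * i - i       ≡⟨ cong (λ t → t * i - i) (ι-suc (suc k)) ⟨
      t * i - i              ≡⟨ cong (λ u → u - i) (ι*inv (suc (suc k))) ⟩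
      1ℚ - i                 ∎

  ι2^ : ∀ (ls : List ℕ) → ι (2 ℕ.^ length ls) ≡ ∏ ls (λ _ → ι 2)
  ι2^ []       = refl
  ι2^ (l ∷ ls) = trans (ι-* 2 (2 ℕ.^ length ls)) (cong (ι 2 *_) (ι2^ ls))

  module PrimitiveExponents (n : ℕ) .{{_ : NonZero n}} where

    private
      ls = primeDivisors n
      R = upTo n
      m = ι n

      primeDivisor? : Decidable (λ l → Prime l × l ∣ n)
      primeDivisor? l = prime? l ×-dec (l ∣? n)

    primeDivisors-sound : All (λ l → Prime l × l ∣ n) ls
    primeDivisors-sound = all-filter primeDivisor? (upTo (suc n))

    primeDivisors-unique : Unique ls
    primeDivisors-unique = filter⁺ primeDivisor? (upTo⁺ (suc n))

    private
      ls-prime : All Prime ls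
      ls-prime = All.map proj₁ primeDivisors-sound

      ls-∣ : All (_∣ n) ls
      ls-∣ = All.map proj₂ primeDivisors-sound

    ∈-primeDivisors : ∀ {l} → Prime l → l ∣ n → l ∈ ls
    ∈-primeDivisors pl l∣n = ∈-filter⁺ primeDivisor? (∈-upTo⁺ (ℕ.s≤s (∣⇒≤ l∣n))) (pl , l∣n)

    -- This is g(x - y), with two arguments in place of a difference, since subtraction on ℕ
    -- truncates.
    coprimeKernel : ℕ → ℕ → ℚ
    coprimeKernel x y = ∏ ls (λ l → ne l x y)

    coprimeKernel-+ : ∀ x y z → coprimeKernel (x ℕ.+ z) (y ℕ.+ z) ≡ coprimeKernel x y
    coprimeKernel-+ x y z = ∏-cong ls-prime λ {l} _ → cong (λ s → 1ℚ - s) (e-+ l x y z)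

    coprimeKernel-periodicˡ : ∀ y → Periodic n (λ x → coprimeKernel x y)
    coprimeKernel-periodicˡ y = ∏-periodic {F = λ l x → ne l x y} ls-∣ (ne-periodicˡ y)

    coprimeKernel-sym : ∀ x y → coprimeKernel x y ≡ coprimeKernel y x
    coprimeKernel-sym x y = ∏-cong ls-prime λ {l} _ → cong (λ s → 1ℚ - s) (e-sym l x y)

    coprimeKernel-periodicʳ : ∀ x → Periodic n (coprimeKernel x)
    coprimeKernel-periodicʳ x y = trans (coprimeKernel-sym x (y ℕ.+ n)) (trans (coprimeKernel-periodicˡ x y) (coprimeKernel-sym y x))

    coprimeKernel-factorisation : Factorisation n coprimeKernel (∏ ls (λ l → ι 2 * θₗ l))
    coprimeKernel-factorisation = ∏-factorisation ls-prime ls-∣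

    g : ℕ → ℚ
    g x = coprimeKernel x 0

    g-idem : ∀ x → g x * g x ≡ g x
    g-idem x = trans (∏-* ls _ _) (∏-cong ls-prime λ {l} _ → ne-idem l x 0)

    g-coprime : ∀ {x} → gcd x n ≡ 1 → g x ≡ 1ℚ
    g-coprime {x} eq = go primeDivisors-sound
      where
      go : ∀ {ls} → All (λ l → Prime l × l ∣ n) ls → ∏ ls (λ l → ne l x 0) ≡ 1ℚ
      go []                                 = refl
      go (_∷_ {x = l} (pl , l∣n) primeDivisors-sound) = cong₂ _*_ (cong (λ s → 1ℚ - s) (𝟙-false (mod l x ℕ.≟ mod l 0) λ x≡0 →
        contradiction (∣1⇒≡1 (subst (l ∣_) eq (gcd-greatest (mod≡0⇒∣ x≡0) l∣n))) (ℕ.nonTrivial⇒≢1 {{prime⇒nonTrivial pl}}))) (go primeDivisors-sound)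

    g-¬coprime : ∀ {x} → gcd x n ≢ 1 → g x ≡ 0ℚ
    g-¬coprime {x} neq = go (∈-primeDivisors pl (∣-trans l∣gcd (gcd[m,n]∣n x n)))
      where
      instance _ = ℕ.≢-nonZero (gcd[m,n]≢0 x n (inj₂ (ℕ.≢-nonZero⁻¹ n)))
      divisor = ∃-primeDivisor (gcd x n) neq
      l = proj₁ divisor
      pl = proj₁ (proj₂ divisor)
      l∣gcd = proj₂ (proj₂ divisor)
      go : ∀ {ls} → l ∈ ls → ∏ ls (λ l → ne l x 0) ≡ 0ℚ
      go {_ ∷ ls} (here refl)  = trans (cong (λ s → (1ℚ - s) * ∏ ls (λ l → ne l x 0)) (𝟙-true (mod l x ℕ.≟ mod l 0) (∣⇒mod≡0 (∣-trans l∣gcd (gcd[m,n]∣m x n))))) (ℚ.*-zeroˡ (∏ ls (λ l → ne l x 0)))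
      go (there {x = l′} l∈ls) = trans (cong (ne l′ x 0 *_) (go l∈ls)) (ℚ.*-zeroʳ (ne l′ x 0))

    g≡𝟙 : ∀ x → g x ≡ 𝟙 (gcd x n ℕ.≟ 1)
    g≡𝟙 x = 𝟙-unique (gcd x n ℕ.≟ 1) g-coprime g-¬coprime

    -- `φ` counts among 1, ..., n whereas `R` is 0, ..., n - 1; periodicity allows the shift by one.
    ∑g≡φ : ∑ R g ≡ ι (φ n)
    ∑g≡φ = begin
      ∑ R g                                        ≡⟨ ∑-shift₁ n g (coprimeKernel-periodicˡ 0 0) ⟨
      ∑[ x ∈ R ] g (suc x)                         ≡⟨ ∑-cong R (λ x → g≡𝟙 (suc x)) ⟩
      ∑[ x ∈ R ] 𝟙 (gcd (suc x) n ℕ.≟ 1)           ≡⟨ ∑-map suc R (λ x → 𝟙 (gcd x n ℕ.≟ 1)) ⟨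
      ∑[ x ∈ map suc R ] 𝟙 (gcd x n ℕ.≟ 1)         ≡⟨ ∑-filter (λ x → gcd x n ℕ.≟ 1) (map suc R) ⟨
      ι (φ n)                                      ∎

    -- Euler's product formula, from two evaluations of the sum of g: as a count of integers prime
    -- to n, and prime by prime through `∑-∏`.
    θ≡∏ : θ n ≡ ∏ ls θₗ
    θ≡∏ = *-cancelˡ (0<ι-nonZero n) (begin
      m * θ n        ≡⟨ ℚ.*-comm m (θ n) ⟩
      θ n * m        ≡⟨ θ*n n ⟩
      ι (φ n)        ≡⟨ ∑g≡φ ⟨
      ∑ R g          ≡⟨ ∑-∏ {F = λ l x → ne l x 0} ls-prime primeDivisors-unique ls-∣ (ne-periodicˡ 0) (λ {l} pl → mean-θ l {{prime⇒nonZero pl}}) ⟩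
      m * ∏ ls θₗ    ∎)
      where
      θ*n : ∀ n .{{_ : NonZero n}} → θ n * ι n ≡ ι (φ n)
      θ*n (suc n) = /-*-cancel (φ (suc n)) n

    ∑g : ∑ R g ≡ m * θ n
    ∑g = trans (∑-∏ {F = λ l x → ne l x 0} ls-prime primeDivisors-unique ls-∣ (ne-periodicˡ 0) (λ {l} pl → mean-θ l {{prime⇒nonZero pl}})) (cong (m *_) (sym θ≡∏))

    Wθ≡∏ : ι (W n) * θ n ≡ ∏ ls (λ l → ι 2 * θₗ l)
    Wθ≡∏ = trans (cong₂ _*_ (ι2^ ls) θ≡∏) (∏-* ls _ _)

    1≤Wθ : 1ℚ ≤ ι (W n) * θ n
    1≤Wθ = subst (1ℚ ≤_) (sym Wθ≡∏) (1≤∏ ls-prime 1≤2θₗ)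

    -- Summing out a, then b, then c: each stage gives m times a product over the primes, so `∑-∏`
    -- applies again at the next.
    ∑-quadruples : ∑[ c ∈ R ] ∑[ b ∈ R ] ∑[ a ∈ R ] (g b * g c * (g a * coprimeKernel (a ℕ.+ b) c)) ≡ m * m * m * (θ n * θ n * θ n * τ n)
    ∑-quadruples = begin
      ∑[ c ∈ R ] ∑[ b ∈ R ] ∑[ a ∈ R ] (g b * g c * (g a * coprimeKernel (a ℕ.+ b) c))
        ≡⟨ ∑∑-cong R R (λ c b → trans (∑-*ˡ (g b * g c) R _) (cong (g b * g c *_) (sum₁ b c))) ⟩
      ∑[ c ∈ R ] ∑[ b ∈ R ] (g b * g c * (m * ∏ ls (M₁ b c)))
        ≡⟨ ∑-cong R (λ c → trans (∑-cong R λ b → solve 4 (λ x y m p → x :* y :* (m :* p) := m :* y :* (x :* p)) refl (g b) (g c) m (∏ ls (M₁ b c))) (trans (∑-*ˡ (m * g c) R _) (cong (m * g c *_) (sum₂ c)))) ⟩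
      ∑[ c ∈ R ] (m * g c * (m * ∏ ls (M₂ c)))
        ≡⟨ trans (∑-cong R λ c → solve 3 (λ x m p → m :* x :* (m :* p) := m :* m :* (x :* p)) refl (g c) m (∏ ls (M₂ c))) (trans (∑-*ˡ (m * m) R _) (cong (m * m *_) sum₃)) ⟩
      m * m * (m * ∏ ls (λ l → θₗ l * θₗ l * θₗ l * τfactor l))
        ≡⟨ trans (sym (ℚ.*-assoc (m * m) m _)) (cong (m * m * m *_) (sym θ³τ)) ⟩
      m * m * m * (θ n * θ n * θ n * τ n) ∎
      where
      -- `M₁` and `M₂` restate `mean₁` and `mean₂` without the instance argument, which inside `∏`
      -- is not at hand for a bare l.
      M₁ : ℕ → ℕ → ℕ → ℚ
      M₁ b c l = (ι l - ι 2 + e l b c) * inv l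
      M₂ : ℕ → ℕ → ℚ
      M₂ c l = ((ι l - 1ℚ) * (ι l - ι 2) + ne l c 0) * inv l * inv l
      θ³τ : θ n * θ n * θ n * τ n ≡ ∏ ls (λ l → θₗ l * θₗ l * θₗ l * τfactor l)
      θ³τ = begin
        θ n * θ n * θ n * τ n                                          ≡⟨ cong₂ (λ t u → t * t * t * u) θ≡∏ (foldr≡∏ ls τfactor) ⟩
        ∏ ls θₗ * ∏ ls θₗ * ∏ ls θₗ * ∏ ls τfactor                     ≡⟨ cong (λ s → s * ∏ ls θₗ * ∏ ls τfactor) (∏-* ls _ _) ⟩
        ∏ ls (λ l → θₗ l * θₗ l) * ∏ ls θₗ * ∏ ls τfactor              ≡⟨ cong (_* ∏ ls τfactor) (∏-* ls _ _) ⟩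
        ∏ ls (λ l → θₗ l * θₗ l * θₗ l) * ∏ ls τfactor                 ≡⟨ ∏-* ls _ _ ⟩
        ∏ ls (λ l → θₗ l * θₗ l * θₗ l * τfactor l)                    ∎
      shift-periodic : ∀ b c l → Periodic l (λ a → ne l (a ℕ.+ b) c)
      shift-periodic b c l a = trans (cong (λ x → ne l x c) (trans (ℕ.+-assoc a l b) (trans (cong (a ℕ.+_) (ℕ.+-comm l b)) (sym (ℕ.+-assoc a b l))))) (ne-periodicˡ c l (a ℕ.+ b))
      sum₁ : ∀ b c → ∑[ a ∈ R ] (g a * coprimeKernel (a ℕ.+ b) c) ≡ m * ∏ ls (M₁ b c)
      sum₁ b c = trans (∑-cong R λ a → ∏-* ls _ _)
        (∑-∏ {F = λ l a → ne l a 0 * ne l (a ℕ.+ b) c} ls-prime primeDivisors-unique ls-∣ (λ l a → cong₂ _*_ (ne-periodicˡ 0 l a) (shift-periodic b c l a)) (λ {l} pl → ∑-mean₁ l {{prime⇒nonZero pl}} b c))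
      sum₂ : ∀ c → ∑[ b ∈ R ] (g b * ∏ ls (M₁ b c)) ≡ m * ∏ ls (M₂ c)
      sum₂ c = trans (∑-cong R λ b → ∏-* ls _ _)
        (∑-∏ {F = λ l b → ne l b 0 * M₁ b c l} ls-prime primeDivisors-unique ls-∣ (λ l b → cong₂ _*_ (ne-periodicˡ 0 l b) (cong (λ s → (ι l - ι 2 + s) * inv l) (e-periodicˡ l c b))) (λ {l} pl → ∑-mean₂ l {{prime⇒nonZero pl}} c))
      sum₃ : ∑[ c ∈ R ] (g c * ∏ ls (M₂ c)) ≡ m * ∏ ls (λ l → θₗ l * θₗ l * θₗ l * τfactor l)
      sum₃ = trans (∑-cong R λ c → ∏-* ls _ _)
        (∑-∏ {F = λ l c → ne l c 0 * M₂ c l} ls-prime primeDivisors-unique ls-∣ (λ l c → cong₂ _*_ (ne-periodicˡ 0 l c) (cong (λ s → ((ι l - 1ℚ) * (ι l - ι 2) + s) * inv l * inv l) (ne-periodicˡ 0 l c)))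
          (λ {l} pl → trans (∑-mean₃ l {{prime⇒nonZero pl}}) (cong (ι l *_) (mean₃≡ pl))))

-- The multiplicative group of a finite field and the translation of N into exponents

module FiniteFields where

  open import Defs using (FiniteField; IsN; primeDivisors; ι)
  open import Level using (Level; _⊔_)
  open import Data.Nat as ℕ using (ℕ; zero; suc; NonZero; z≤n; s≤s)
  import Data.Nat.Properties as ℕ
  open import Data.Nat.Divisibility using (_∣_; _∣?_; divides; ∣1⇒≡1; m∣m*n; n∣m*n; ∣m⇒∣m*n)
  open import Data.Nat.GCD using (gcd; gcd-GCD; gcd[m,n]∣m; gcd[m,n]∣n; module Bézout)
  open import Data.Nat.Primality using (Prime; prime⇒nonZero; prime⇒nonTrivial; prime⇒irreducible; euclidsLemma)
  open import Data.Fin as Fin using (Fin; zero; suc; toℕ; punchIn; punchOut)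
  import Data.Fin.Properties as Fin
  open import Data.Fin.Permutation using (Permutation; permutation; _⟨$⟩ʳ_)
  open import Data.List using (List; []; _∷_; upTo; allFin)
  open import Data.List.Membership.Propositional using (_∈_; _∉_)
  open import Data.List.Relation.Unary.All as All using (All; []; _∷_)
  open import Data.List.Relation.Unary.AllPairs using ([]; _∷_)
  open import Data.List.Relation.Unary.Any using (here; there)
  open import Data.List.Relation.Unary.Unique.Propositional using (Unique)
  open import Data.Product using (∃-syntax; _×_; _,_; proj₁; proj₂)
  open import Data.Sum using (_⊎_; inj₁; inj₂)
  open import Data.Vec.Functional using (replicate)
  open import Function using (_∘_; id)
  open import Relation.Nullary using (Dec; yes; no; ¬_; contradiction)
  open import Relation.Nullary.Decidable using (map′; _×-dec_)
  open import Relation.Binary.PropositionalEquality as ≡ using (_≡_; _≢_; cong; subst; cong₂)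
  open import Data.Nat.Coprimality using (coprime⇒gcd≡1; coprime-Bézout; gcd≡1⇒coprime)
  open import Data.List.Membership.Propositional.Properties using (∈-allFin)
  open import Data.List.Properties using (length-tabulate)
  open import Data.List.Relation.Unary.Unique.Propositional.Properties using (allFin⁺)
  open import Data.Product.Properties using (≡-dec)
  open import Data.Rational as ℚ using (ℚ; 0ℚ; 1ℚ)
  import Data.Rational.Properties as ℚ
  open import Data.Rational.Solver using (module +-*-Solver)
  open import Relation.Binary.Definitions using (DecidableEquality)
  open Exponents

  -- Generators of the multiplicative group

  prime-∣-^ : ∀ {p} → Prime p → ∀ m k → p ∣ m ℕ.^ k → p ∣ m
  prime-∣-^ pp m zero    p∣1 = contradiction (∣1⇒≡1 p∣1) (ℕ.nonTrivial⇒≢1 {{prime⇒nonTrivial pp}})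
  prime-∣-^ pp m (suc k) p∣  with euclidsLemma m (m ℕ.^ k) pp p∣
  ... | inj₁ p∣m = p∣m
  ... | inj₂ p∣  = prime-∣-^ pp m k p∣

  distinct-primes-∤ : ∀ {p l} → Prime p → Prime l → p ≢ l → ¬ p ∣ l
  distinct-primes-∤ pp pl p≢l p∣l with prime⇒irreducible pl p∣l
  ... | inj₁ p≡1 = contradiction p≡1 (ℕ.nonTrivial⇒≢1 {{prime⇒nonTrivial pp}})
  ... | inj₂ p≡l = p≢l p≡l

  prime-part : ∀ {l} → Prime l → ∀ n .{{_ : NonZero n}} → ∃[ v ] ∃[ w ] (n ≡ l ℕ.^ v ℕ.* w × ¬ l ∣ w)
  prime-part {l} pl n = go n n ℕ.≤-refl
    where
    go : ∀ fuel n .{{_ : NonZero n}} → n ℕ.≤ fuel → ∃[ v ] ∃[ w ] (n ≡ l ℕ.^ v ℕ.* w × ¬ l ∣ w)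
    go zero       n n≤0 = contradiction (ℕ.n≤0⇒n≡0 n≤0) (ℕ.≢-nonZero⁻¹ n)
    go (suc fuel) n n≤  with l ∣? n
    ... | no  l∤n              = 0 , n , ≡.sym (ℕ.*-identityˡ n) , l∤n
    ... | yes (divides k ≡.refl) = let v , w , eq , l∤w = go fuel k {{k≢0}} (ℕ.≤-pred (ℕ.≤-trans k<n n≤))
                                   in suc v , w , ≡.trans (cong (ℕ._* l) eq) (shuffle (l ℕ.^ v) w) , l∤w
      where
      k≢0 : NonZero k
      k≢0 = ℕ.m*n≢0⇒m≢0 k
      k<n : k ℕ.< k ℕ.* l
      k<n = ℕ.m<m*n k l {{k≢0}} (ℕ.nonTrivial⇒n>1 l {{prime⇒nonTrivial pl}})
      shuffle : ∀ s w → s ℕ.* w ℕ.* l ≡ l ℕ.* s ℕ.* w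
      shuffle s w = ≡.trans (ℕ.*-comm (s ℕ.* w) l) (≡.sym (ℕ.*-assoc l s w))

  injective⇒surjective : ∀ {n} (f : Fin n → Fin n) → (∀ {i j} → f i ≡ f j → i ≡ j) → ∀ j → ∃[ i ] (f i ≡ j)
  injective⇒surjective {suc n} f inj j with Fin.any? (λ i → f i Fin.≟ j)
  ... | yes i,fi≡j = i,fi≡j
  ... | no  f≢j    = contradiction (Fin.injective⇒≤ {f = g} (λ eq → inj (Fin.punchOut-injective (j≢f _) (j≢f _) eq))) ℕ.1+n≰n
    where
    j≢f : ∀ i → j ≢ f i
    j≢f i j≡fi = f≢j (i , ≡.sym j≡fi)
    g : Fin (suc n) → Fin n
    g i = punchOut (j≢f i)

  module FieldProperties {c ℓ : Level} {n : ℕ} .{{_ : NonZero n}} (F : FiniteField c ℓ (suc n)) where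

    open FiniteField F hiding (zero) public
    open import Algebra.Properties.CommutativeSemiring.Exp commutativeSemiring public
    open import Algebra.Properties.Ring ring public using (x∙y⁻¹≈ε⇒x≈y; +-cancelˡ; +-cancelʳ)
    open import Algebra.Properties.CommutativeMonoid.Sum *-commutativeMonoid using (sum; sum-permute; ∑-distrib-+; sum-replicate; sum-cong-≋)
    open import Algebra.Solver.Ring.NaturalCoefficients.Default commutativeSemiring using (solve; _:=_; _:+_; _:*_)
    open import Relation.Binary.Reasoning.Setoid setoid

    pow≈^ : ∀ x k → pow x k ≈ x ^ k
    pow≈^ x zero    = refl
    pow≈^ x (suc k) = *-congˡ (pow≈^ x k)

    1^ : ∀ k → 1# ^ k ≈ 1#
    1^ zero    = refl
    1^ (suc k) = trans (*-identityˡ _) (1^ k)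

    -- The position in the enumeration turns `_≈_` into propositional equality, which is decidable
    -- and is what the rational indicators and `Periodic` work with.
    index : Carrier → Fin (suc n)
    index x = proj₁ (enum-surj x)

    enum-index : ∀ x → enum (index x) ≈ x
    enum-index x = proj₂ (enum-surj x)

    index-cong : ∀ {x y} → x ≈ y → index x ≡ index y
    index-cong x≈y = enum-inj _ _ (trans (enum-index _) (trans x≈y (sym (enum-index _))))

    index-injective : ∀ {x y} → index x ≡ index y → x ≈ y
    index-injective {x} {y} eq = trans (sym (enum-index x)) (trans (reflexive (cong enum eq)) (enum-index y))

    infix 4 _≈?_
    _≈?_ : ∀ x y → Dec (x ≈ y)
    x ≈? y = map′ index-injective index-cong (index x Fin.≟ index y)

    ⁻¹-cancelˡ : ∀ {x} y → x ≉ 0# → x ⁻¹ * (x * y) ≈ y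
    ⁻¹-cancelˡ {x} y x≉0 = begin
      x ⁻¹ * (x * y)  ≈⟨ solve 3 (λ i x y → i :* (x :* y) := x :* i :* y) refl (x ⁻¹) x y ⟩
      x * x ⁻¹ * y    ≈⟨ *-congʳ (⁻¹-inv x x≉0) ⟩
      1# * y          ≈⟨ *-identityˡ y ⟩
      y               ∎

    *-⁻¹-cancelˡ : ∀ {x} y → x ≉ 0# → x * (x ⁻¹ * y) ≈ y
    *-⁻¹-cancelˡ {x} y x≉0 = trans (solve 3 (λ i x y → x :* (i :* y) := i :* (x :* y)) refl (x ⁻¹) x y) (⁻¹-cancelˡ y x≉0)

    *-cancelˡ-≉0 : ∀ {x y z} → x ≉ 0# → x * y ≈ x * z → y ≈ z
    *-cancelˡ-≉0 {x} {y} {z} x≉0 eq = trans (sym (⁻¹-cancelˡ y x≉0)) (trans (*-congˡ eq) (⁻¹-cancelˡ z x≉0))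

    *-≉0 : ∀ {x y} → x ≉ 0# → y ≉ 0# → x * y ≉ 0#
    *-≉0 {x} {y} x≉0 y≉0 xy≈0 = y≉0 (*-cancelˡ-≉0 x≉0 (trans xy≈0 (sym (zeroʳ x))))

    ⁻¹-≉0 : ∀ {x} → x ≉ 0# → x ⁻¹ ≉ 0#
    ⁻¹-≉0 {x} x≉0 x⁻¹≈0 = 0≉1 (trans (sym (zeroʳ x)) (trans (*-congˡ (sym x⁻¹≈0)) (⁻¹-inv x x≉0)))

    ^-≉0 : ∀ {x} → x ≉ 0# → ∀ k → x ^ k ≉ 0#
    ^-≉0 x≉0 zero    = 0≉1 ∘ sym
    ^-≉0 x≉0 (suc k) = *-≉0 x≉0 (^-≉0 x≉0 k)

    x*z≈y*z⇒z≈0 : ∀ {x y z} → x ≉ y → x * z ≈ y * z → z ≈ 0#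
    x*z≈y*z⇒z≈0 {x} {y} {z} x≉y eq = *-cancelˡ-≉0 (x≉y ∘ x∙y⁻¹≈ε⇒x≈y x y) (begin
      (x - y) * z           ≈⟨ distribʳ z x (- y) ⟩
      x * z + - y * z       ≈⟨ +-congʳ eq ⟩
      y * z + - y * z       ≈⟨ distribʳ z y (- y) ⟨
      (y - y) * z           ≈⟨ *-congʳ (-‿inverseʳ y) ⟩
      0# * z                ≈⟨ zeroˡ z ⟩
      0#                    ≈⟨ zeroʳ (x - y) ⟨
      (x - y) * 0#          ∎)

    -- f is a polynomial function of degree ≤ k with k-th coefficient c, expressed through iterated divided
    -- differences: f x - f r = (x - r) q x, with both sides moved so that no subtraction occurs.
    HasDegree : ℕ → Carrier → (Carrier → Carrier) → Set (c ⊔ ℓ)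
    HasDegree zero    a f = Level.Lift c (∀ x → f x ≈ a)
    HasDegree (suc k) a f = ∀ r → ∃[ q ] (HasDegree k a q × (∀ x → f x + r * q x ≈ f r + x * q x))

    HasDegree-resp : ∀ k {a b f} → a ≈ b → HasDegree k a f → HasDegree k b f
    HasDegree-resp zero    a≈b (Level.lift h) = Level.lift λ x → trans (h x) a≈b
    HasDegree-resp (suc k) a≈b h r = let q , hq , eq = h r in q , HasDegree-resp k a≈b hq , eq

    HasDegree-+ : ∀ k {a b f g} → HasDegree k a f → HasDegree k b g → HasDegree k (a + b) (λ x → f x + g x)
    HasDegree-+ zero    (Level.lift h) (Level.lift h′) = Level.lift λ x → +-cong (h x) (h′ x)
    HasDegree-+ (suc k) {f = f} {g} h h′ r =
      let q , hq , eq = h r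
          q′ , hq′ , eq′ = h′ r
      in (λ x → q x + q′ x) , HasDegree-+ k hq hq′ , λ x → begin
        f x + g x + r * (q x + q′ x)         ≈⟨ solve 5 (λ f g r q q′ → f :+ g :+ r :* (q :+ q′) := f :+ r :* q :+ (g :+ r :* q′)) refl (f x) (g x) r (q x) (q′ x) ⟩
        f x + r * q x + (g x + r * q′ x)     ≈⟨ +-cong (eq x) (eq′ x) ⟩
        f r + x * q x + (g r + x * q′ x)     ≈⟨ solve 5 (λ f g x q q′ → f :+ x :* q :+ (g :+ x :* q′) := f :+ g :+ x :* (q :+ q′)) refl (f r) (g r) x (q x) (q′ x) ⟩
        f r + g r + x * (q x + q′ x)         ∎

    HasDegree-* : ∀ k {a f} s → HasDegree k a f → HasDegree k (s * a) (λ x → s * f x)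
    HasDegree-* zero    s (Level.lift h) = Level.lift λ x → *-congˡ (h x)
    HasDegree-* (suc k) {f = f} s h r =
      let q , hq , eq = h r
      in (λ x → s * q x) , HasDegree-* k s hq , λ x → begin
        s * f x + r * (s * q x)     ≈⟨ solve 4 (λ s f r q → s :* f :+ r :* (s :* q) := s :* (f :+ r :* q)) refl s (f x) r (q x) ⟩
        s * (f x + r * q x)         ≈⟨ *-congˡ (eq x) ⟩
        s * (f r + x * q x)         ≈⟨ solve 4 (λ s f x q → s :* (f :+ x :* q) := s :* f :+ x :* (s :* q)) refl s (f r) x (q x) ⟩
        s * f r + x * (s * q x)     ∎

    HasDegree-raise : ∀ k {a f} → HasDegree k a f → HasDegree (suc k) 0# f
    HasDegree-raise zero    (Level.lift h) r = (λ _ → 0#) , Level.lift (λ _ → refl) , λ x →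
      trans (+-cong (trans (h x) (sym (h r))) (trans (zeroʳ r) (sym (zeroʳ x)))) refl
    HasDegree-raise (suc k) h r = let q , hq , eq = h r in q , HasDegree-raise k hq , eq

    HasDegree-x* : ∀ k {a f} → HasDegree k a f → HasDegree (suc k) a (λ x → x * f x)
    HasDegree-x* zero {f = f} (Level.lift h) r = f , Level.lift h , λ x → begin
      x * f x + r * f x    ≈⟨ +-comm _ _ ⟩
      r * f x + x * f x    ≈⟨ +-congʳ (*-congˡ (trans (h x) (sym (h r)))) ⟩
      r * f r + x * f x    ∎
    HasDegree-x* (suc k) {a} {f} h r =
      let q , hq , eq = h r
      -- From x f(x) - r f(r) = (x - r) f(x) + r (f(x) - f(r)), where the last difference is (x - r)
      -- q(x). The summand `r * q x` has lower degree and leaves the leading coefficient alone.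
      in (λ x → f x + r * q x)
       , HasDegree-resp (suc k) (trans (+-congˡ (zeroʳ r)) (+-identityʳ a)) (HasDegree-+ (suc k) h (HasDegree-* (suc k) r (HasDegree-raise k hq)))
       , λ x → begin
        x * f x + r * (f x + r * q x)        ≈⟨ +-congˡ (*-congˡ (eq x)) ⟩
        x * f x + r * (f r + x * q x)        ≈⟨ solve 5 (λ x f r f′ q → x :* f :+ r :* (f′ :+ x :* q) := r :* f′ :+ x :* (f :+ r :* q)) refl x (f x) r (f r) (q x) ⟩
        r * f r + x * (f x + r * q x)        ∎

    HasDegree-^ : ∀ k → HasDegree k 1# (λ x → x ^ k)
    HasDegree-^ zero    = Level.lift λ _ → refl
    HasDegree-^ (suc k) = HasDegree-x* k (HasDegree-^ k)

    -- Dividing by x - r₀ for the first root r₀ leaves a quotient of degree one less with the same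
    -- leading coefficient, and the other roots are roots of it.
    root-bound : ∀ k {a f} → HasDegree k a f → a ≉ 0# → ∀ {m} (r : Fin m → Carrier) →
      (∀ {i j} → r i ≈ r j → i ≡ j) → (∀ i → f (r i) ≈ 0#) → m ℕ.≤ k
    root-bound k       h              a≉0 {zero}  r inj root = z≤n
    root-bound zero    (Level.lift h) a≉0 {suc m} r inj root = contradiction (trans (sym (h (r zero))) (root zero)) a≉0
    root-bound (suc k) {f = f} h      a≉0 {suc m} r inj root =
      let q , hq , eq = h (r zero)
      in s≤s (root-bound k hq a≉0 (r ∘ suc) (Fin.suc-injective ∘ inj) λ i →
        x*z≈y*z⇒z≈0 (λ r₀≈rᵢ → contradiction (inj r₀≈rᵢ) λ ()) (begin
          r zero * q (r (suc i))                       ≈⟨ +-identityˡ _ ⟨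
          0# + r zero * q (r (suc i))                  ≈⟨ +-congʳ (root (suc i)) ⟨
          f (r (suc i)) + r zero * q (r (suc i))       ≈⟨ eq (r (suc i)) ⟩
          f (r zero) + r (suc i) * q (r (suc i))       ≈⟨ +-congʳ (root zero) ⟩
          0# + r (suc i) * q (r (suc i))               ≈⟨ +-identityˡ _ ⟩
          r (suc i) * q (r (suc i))                    ∎))

    -- Fermat's little theorem and the k-th roots of unity

    unit : Fin n → Carrier
    unit i = enum (punchIn (index 0#) i)

    unit-≉0 : ∀ i → unit i ≉ 0#
    unit-≉0 i eq = Fin.punchInᵢ≢i (index 0#) i (enum-inj _ _ (trans eq (sym (enum-index 0#))))

    unit-injective : ∀ {i j} → unit i ≈ unit j → i ≡ j
    unit-injective {i} {j} eq = Fin.punchIn-injective (index 0#) i j (enum-inj _ _ eq)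

    unitIndex : ∀ x → x ≉ 0# → Fin n
    unitIndex x x≉0 = punchOut {i = index 0#} {j = index x} (x≉0 ∘ sym ∘ index-injective)

    unit-unitIndex : ∀ x (x≉0 : x ≉ 0#) → unit (unitIndex x x≉0) ≈ x
    unit-unitIndex x x≉0 = trans (reflexive (cong enum (Fin.punchIn-punchOut {i = index 0#} {j = index x} _))) (enum-index x)

    -- Multiplication by x permutes the non-zero elements, so their product absorbs the factor x ^
    -- n. `sum` is taken in the multiplicative monoid and is thus a product.
    fermat : ∀ {x} → x ≉ 0# → x ^ n ≈ 1#
    fermat {x} x≉0 = *-cancelˡ-≉0 (sum-≉0 n unit unit-≉0) (begin
      sum unit * x ^ n                ≈⟨ *-congˡ (sum-replicate n) ⟨
      sum unit * sum (replicate n x)  ≈⟨ *-comm _ _ ⟩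
      sum (replicate n x) * sum unit  ≈⟨ ∑-distrib-+ (replicate n x) unit ⟨
      sum (λ i → x * unit i)          ≈⟨ sum-cong-≋ (λ i → sym (unit-times x≉0 i)) ⟩
      sum (λ i → unit (π ⟨$⟩ʳ i))     ≈⟨ sum-permute unit π ⟨
      sum unit                        ≈⟨ *-identityʳ _ ⟨
      sum unit * 1#                   ∎)
      where
      sum-≉0 : ∀ k (f : Fin k → Carrier) → (∀ i → f i ≉ 0#) → sum f ≉ 0#
      sum-≉0 zero    f f≉0 = 0≉1 ∘ sym
      sum-≉0 (suc k) f f≉0 = *-≉0 (f≉0 zero) (sum-≉0 k (f ∘ suc) (f≉0 ∘ suc))
      times : ∀ {y} → y ≉ 0# → Fin n → Fin n
      times {y} y≉0 i = unitIndex (y * unit i) (*-≉0 y≉0 (unit-≉0 i))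
      unit-times : ∀ {y} (y≉0 : y ≉ 0#) i → unit (times y≉0 i) ≈ y * unit i
      unit-times {y} y≉0 i = unit-unitIndex (y * unit i) (*-≉0 y≉0 (unit-≉0 i))
      x⁻¹≉0 = ⁻¹-≉0 x≉0
      π : Permutation n n
      π = permutation (times x≉0) (times x⁻¹≉0)
        (λ i → unit-injective (trans (unit-times x≉0 (times x⁻¹≉0 i)) (trans (*-congˡ (unit-times x⁻¹≉0 i)) (*-⁻¹-cancelˡ (unit i) x≉0))))
        (λ i → unit-injective (trans (unit-times x⁻¹≉0 (times x≉0 i)) (trans (*-congˡ (unit-times x≉0 i)) (⁻¹-cancelˡ (unit i) x≉0))))

    -- The polynomial x ^ k - 1 has at most k roots, fewer than the n non-zero elements.
    ∃-^≉1 : ∀ k .{{_ : NonZero k}} → k ℕ.< n → ∃[ x ] (x ≉ 0# × x ^ k ≉ 1#)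
    ∃-^≉1 (suc k) k<n = let i , unit^≉1 = Fin.¬∀⟶∃¬ n (λ i → unit i ^ suc k ≈ 1#) (λ i → unit i ^ suc k ≈? 1#) ¬all
                        in unit i , unit-≉0 i , unit^≉1
      where
      ¬all : ¬ (∀ i → unit i ^ suc k ≈ 1#)
      ¬all all = ℕ.<⇒≱ k<n (root-bound (suc k)
        (HasDegree-resp (suc k) (+-identityʳ 1#) (HasDegree-+ (suc k) (HasDegree-^ (suc k)) (HasDegree-raise k (HasDegree-const k))))
        (0≉1 ∘ sym) unit unit-injective (λ i → trans (+-congʳ (all i)) (-‿inverseʳ 1#)))
        where
        -- The coefficient `a * 0# ^ k` covers both cases: a for k = 0, and 0 for a constant
        -- regarded as a polynomial of higher formal degree.
        HasDegree-const : ∀ k {a} → HasDegree k (a * 0# ^ k) (λ _ → a)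
        HasDegree-const zero    = Level.lift λ _ → sym (*-identityʳ _)
        HasDegree-const (suc k) = HasDegree-resp (suc k) (sym (trans (*-congˡ (zeroˡ _)) (zeroʳ _))) (HasDegree-raise k (HasDegree-const k))

    ^-≈1-∣ : ∀ {x a b} → a ∣ b → x ^ a ≈ 1# → x ^ b ≈ 1#
    ^-≈1-∣ {x} {a} (divides k ≡.refl) xᵃ≈1 = trans (^-congʳ x (ℕ.*-comm k a)) (trans (sym (^-assocʳ x a k)) (trans (^-congˡ k xᵃ≈1) (1^ k)))

    -- Bézout's identity arrives without subtraction, as d + j = i, so x ^ d is compared with x ^ i
    -- through the trivial factor x ^ j.
    ^-gcd : ∀ {x} a b → x ^ a ≈ 1# → x ^ b ≈ 1# → x ^ gcd a b ≈ 1#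
    ^-gcd {x} a b xᵃ≈1 xᵇ≈1 = go (Bézout.identity (gcd-GCD a b))
      where
      combine : ∀ d i j → d ℕ.+ j ≡ i → x ^ i ≈ 1# → x ^ j ≈ 1# → x ^ d ≈ 1#
      combine d i j eq xⁱ≈1 xʲ≈1 = begin
        x ^ d              ≈⟨ *-identityʳ _ ⟨
        x ^ d * 1#         ≈⟨ *-congˡ xʲ≈1 ⟨
        x ^ d * x ^ j      ≈⟨ ^-homo-* x d j ⟨
        x ^ (d ℕ.+ j)      ≈⟨ ^-congʳ x eq ⟩
        x ^ i              ≈⟨ xⁱ≈1 ⟩
        1#                 ∎
      go : Bézout.Identity (gcd a b) a b → x ^ gcd a b ≈ 1#
      go (Bézout.+- i j eq) = combine (gcd a b) (i ℕ.* a) (j ℕ.* b) eq (^-≈1-∣ (n∣m*n i) xᵃ≈1) (^-≈1-∣ (n∣m*n j) xᵇ≈1)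
      go (Bézout.-+ i j eq) = combine (gcd a b) (j ℕ.* b) (i ℕ.* a) eq (^-≈1-∣ (n∣m*n j) xᵇ≈1) (^-≈1-∣ (n∣m*n i) xᵃ≈1)

    -- For l in ls the order of γ has the same l-part as n; for the other primes it has none.
    Generates : List ℕ → Carrier → Set ℓ
    Generates ls γ = γ ≉ 0# × (∀ {l} → l ∈ ls → ∀ k → n ≡ l ℕ.* k → γ ^ k ≉ 1#) ×
      (∀ {p} → Prime p → p ∉ ls → ∀ k → n ≡ p ℕ.* k → γ ^ k ≈ 1#)

    -- For a prime p dividing n, raising to the power n/p makes at least one of the two factors 1,
    -- so the test at p is decided by the other one.
    Generates-∷ : ∀ {l ls y γ} → Prime l → All Prime ls → All (l ≢_) ls → Generates (l ∷ []) y → Generates ls γ → Generates (l ∷ ls) (y * γ)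
    Generates-∷ {l} {ls} {y} {γ} pl pls l∉ls (y≉0 , y-at , y-away) (γ≉0 , at , away) = *-≉0 y≉0 γ≉0 , at′ , away′
      where
      ∈[] : ∀ {p} → p ∈ l ∷ [] → p ≡ l
      ∈[] (here p≡l) = p≡l
      at′ : ∀ {p} → p ∈ l ∷ ls → ∀ k → n ≡ p ℕ.* k → (y * γ) ^ k ≉ 1#
      at′ (here ≡.refl) k n≡ eq = y-at (here ≡.refl) k n≡ (begin
        y ^ k              ≈⟨ *-identityʳ _ ⟨
        y ^ k * 1#         ≈⟨ *-congˡ (away pl (λ l∈ls → All.lookup l∉ls l∈ls ≡.refl) k n≡) ⟨
        y ^ k * γ ^ k      ≈⟨ ^-distrib-* y γ k ⟨
        (y * γ) ^ k        ≈⟨ eq ⟩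
        1#                 ∎)
      at′ {p} (there p∈ls) k n≡ eq = at p∈ls k n≡ (begin
        γ ^ k              ≈⟨ *-identityˡ _ ⟨
        1# * γ ^ k         ≈⟨ *-congʳ (y-away (All.lookup pls p∈ls) (λ p∈[l] → All.lookup l∉ls p∈ls (≡.sym (∈[] p∈[l]))) k n≡) ⟨
        y ^ k * γ ^ k      ≈⟨ ^-distrib-* y γ k ⟨
        (y * γ) ^ k        ≈⟨ eq ⟩
        1#                 ∎)
      away′ : ∀ {p} → Prime p → p ∉ l ∷ ls → ∀ k → n ≡ p ℕ.* k → (y * γ) ^ k ≈ 1#
      away′ pp p∉ k n≡ = trans (^-distrib-* y γ k) (trans (*-cong (y-away pp (λ p∈[l] → p∉ (here (∈[] p∈[l]))) k n≡) (away pp (p∉ ∘ there) k n≡)) (*-identityˡ 1#))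

    -- Write n = lᵛ w with w prime to l, and take x with x ^ (n/l) ≠ 1. Then x ^ w has order
    -- dividing lᵛ, and passing to it does not lose the l-part because w is prime to l.
    ∃-generates-prime : ∀ {l} → Prime l → l ∣ n → ∃[ y ] Generates (l ∷ []) y
    ∃-generates-prime {l} pl (divides h n≡hl) = go (prime-part pl n) (∃-^≉1 h h<n)
      where
      n≡lh : n ≡ l ℕ.* h
      n≡lh = ≡.trans n≡hl (ℕ.*-comm h l)
      instance
        h≢0 : NonZero h
        h≢0 = ℕ.m*n≢0⇒m≢0 h {l} {{subst NonZero n≡hl (ℕ.≢-nonZero (ℕ.≢-nonZero⁻¹ n))}}
      h<n : h ℕ.< n
      h<n = subst (h ℕ.<_) (≡.sym n≡hl) (ℕ.m<m*n h l (ℕ.nonTrivial⇒n>1 l {{prime⇒nonTrivial pl}}))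
      go : ∃[ v ] ∃[ w ] (n ≡ l ℕ.^ v ℕ.* w × ¬ l ∣ w) → ∃[ x ] (x ≉ 0# × x ^ h ≉ 1#) → ∃[ y ] Generates (l ∷ []) y
      go (v , w , n≡ , l∤w) (x , x≉0 , xʰ≉1) = x ^ w , ^-≉0 x≉0 w , at , away
        where
        at : ∀ {p} → p ∈ l ∷ [] → ∀ k → n ≡ p ℕ.* k → (x ^ w) ^ k ≉ 1#
        at (here ≡.refl) k n≡lk xʷᵏ≈1 = xʰ≉1 (begin
          x ^ h                ≈⟨ *-identityʳ _ ⟨
          (x ^ h) ^ 1          ≈⟨ ^-congʳ (x ^ h) (coprime⇒gcd≡1 (∤⇒coprime pl l∤w)) ⟨
          -- If the power of x ^ w were 1, then x ^ h would be killed both by w and by l, the latter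
          -- by Fermat, hence by their greatest common divisor 1.
          (x ^ h) ^ gcd w l    ≈⟨ ^-gcd w l (trans (^-assocʳ x h w) (trans (^-congʳ x (ℕ.*-comm h w)) (trans (sym (^-assocʳ x w h)) (trans (^-congʳ (x ^ w) h≡k) xʷᵏ≈1)))) (trans (^-assocʳ x h l) (trans (^-congʳ x (≡.sym n≡hl)) (fermat x≉0))) ⟩
          1#                   ∎)
          where
          h≡k : h ≡ k
          h≡k = ℕ.*-cancelˡ-≡ h k l {{prime⇒nonZero pl}} (≡.trans (≡.sym n≡lh) n≡lk)
        away : ∀ {p} → Prime p → p ∉ l ∷ [] → ∀ k → n ≡ p ℕ.* k → (x ^ w) ^ k ≈ 1#
        away {p} pp p≢l k n≡pk with euclidsLemma (l ℕ.^ v) w pp (subst (p ∣_) n≡ (subst (p ∣_) (≡.sym n≡pk) (m∣m*n k)))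
        ... | inj₁ p∣lᵛ = contradiction (prime-∣-^ pp l v p∣lᵛ) (distinct-primes-∤ pp pl (p≢l ∘ here))
        ... | inj₂ (divides w′ w≡) = trans (^-assocʳ x w k) (^-≈1-∣ (divides w′ (≡.trans (cong (ℕ._* k) w≡) (≡.trans (ℕ.*-assoc w′ p k) (cong (w′ ℕ.*_) (≡.sym n≡pk))))) (fermat x≉0))

    ∃-generates : ∀ {ls} → All (λ l → Prime l × l ∣ n) ls → Unique ls → ∃[ γ ] Generates ls γ
    ∃-generates []                 _            = 1# , 0≉1 ∘ sym , (λ ()) , λ _ _ k _ → 1^ k
    ∃-generates ((pl , l∣n) ∷ pls) (l∉ls ∷ uls) =
      _ , Generates-∷ pl (All.map proj₁ pls) l∉ls (proj₂ (∃-generates-prime pl l∣n)) (proj₂ (∃-generates pls uls))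

  -- The line uγᵃ + vγᵇ = γᶜ

  𝟙-× : ∀ {p q} {P : Set p} {Q : Set q} (P? : Dec P) (Q? : Dec Q) → 𝟙 (P? ×-dec Q?) ≡ 𝟙 P? ℚ.* 𝟙 Q?
  𝟙-× (yes _) (yes _) = ≡.refl
  𝟙-× (yes _) (no _)  = ≡.refl
  𝟙-× (no _)  (yes _) = ≡.refl
  𝟙-× (no _)  (no _)  = ≡.refl

  𝟙-absorb : ∀ {p q} {P : Set p} {Q : Set q} (P? : Dec P) (Q? : Dec Q) → (P → ¬ Q) → (1ℚ ℚ.- 𝟙 P?) ℚ.* 𝟙 Q? ≡ 𝟙 Q?
  𝟙-absorb (yes p) (yes q) P→¬Q = contradiction q (P→¬Q p)
  𝟙-absorb (yes p) (no _)  P→¬Q = ≡.refl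
  𝟙-absorb (no _)  (yes _) P→¬Q = ≡.refl
  𝟙-absorb (no _)  (no _)  P→¬Q = ≡.refl

  ∑-𝟙-≡ : ∀ {a} {A : Set a} (_≟_ : DecidableEquality A) {x xs} → Unique xs → x ∈ xs → ∑[ y ∈ xs ] 𝟙 (y ≟ x) ≡ 1ℚ
  ∑-𝟙-≡ _≟_ {x} (x∉xs ∷ _) (here ≡.refl) = cong₂ ℚ._+_ (𝟙-true (x ≟ x) ≡.refl) (absent x∉xs)
    where
    absent : ∀ {ys} → All (x ≢_) ys → ∑[ y ∈ ys ] 𝟙 (y ≟ x) ≡ 0ℚ
    absent []                  = ≡.refl
    absent (_∷_ {x = y} x≢y x∉ys) = cong₂ ℚ._+_ (𝟙-false (y ≟ x) (x≢y ∘ ≡.sym)) (absent x∉ys)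
  ∑-𝟙-≡ _≟_ {x} {y ∷ _} (y∉xs ∷ uxs) (there x∈xs) =
    cong₂ ℚ._+_ (𝟙-false (y ≟ x) (All.lookup y∉xs x∈xs)) (∑-𝟙-≡ _≟_ uxs x∈xs)

  -- Discrete logarithms to the base γ

  module DiscreteLogarithm {c ℓ : Level} {n : ℕ} .{{_ : NonZero n}} (F : FiniteField c ℓ (suc n)) where

    open FieldProperties F public

    module WithGenerator (γ : Carrier) (γ-generates : Generates (primeDivisors n) γ) where

      open PrimitiveExponents n
      open import Relation.Binary.Reasoning.Setoid setoid

      E : ℕ → Carrier
      E x = γ ^ x

      E-≉0 : ∀ x → E x ≉ 0#
      E-≉0 = ^-≉0 (proj₁ γ-generates)

      E-+ : ∀ x y → E (x ℕ.+ y) ≈ E x * E y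
      E-+ = ^-homo-* γ

      -- `Periodic` asks for propositional equality, while γ^(x+n) and γ^x agree only up to `_≈_`;
      -- composing with `index` bridges the two.
      index-E-periodic : Periodic n (index ∘ E)
      index-E-periodic x = index-cong (trans (E-+ x n) (trans (*-congˡ (fermat (proj₁ γ-generates))) (*-identityʳ (E x))))

      E-cong : ∀ {x y} → mod n x ≡ mod n y → E x ≈ E y
      E-cong eq = index-injective (periodic-cong index-E-periodic eq)

      -- With d = gcd(k,n) also γᵈ = 1. If d were a proper divisor of n, a prime l would divide n/d;
      -- then d divides n/l, so γ^(n/l) = 1, against `Generates`.
      E-order : ∀ k → E k ≈ 1# → n ∣ k
      E-order k Ek≈1 = go (gcd[m,n]∣n k n)
        where
        γᵈ≈1 : E (gcd k n) ≈ 1#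
        γᵈ≈1 = ^-gcd k n Ek≈1 (fermat (proj₁ γ-generates))
        go : gcd k n ∣ n → n ∣ k
        go (divides h n≡hd) with h ℕ.≟ 1
        ... | yes h≡1 = subst (_∣ k) (≡.sym (≡.trans n≡hd (≡.trans (cong (ℕ._* gcd k n) h≡1) (ℕ.*-identityˡ _)))) (gcd[m,n]∣m k n)
        ... | no  h≢1 = split (∃-primeDivisor h {{ℕ.m*n≢0⇒m≢0 h {{subst NonZero n≡hd (ℕ.≢-nonZero (ℕ.≢-nonZero⁻¹ n))}}}} h≢1)
          where
          split : ∃[ l ] (Prime l × l ∣ h) → n ∣ k
          split (l , pl , divides k′ h≡) = contradiction (^-≈1-∣ (n∣m*n k′) γᵈ≈1)
            (proj₁ (proj₂ γ-generates) (∈-primeDivisors pl (divides (k′ ℕ.* gcd k n) (≡.trans n≡ (ℕ.*-comm l _)))) (k′ ℕ.* gcd k n) n≡)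
            where
            n≡ : n ≡ l ℕ.* (k′ ℕ.* gcd k n)
            n≡ = ≡.trans n≡hd (≡.trans (cong (ℕ._* gcd k n) (≡.trans h≡ (ℕ.*-comm k′ l))) (ℕ.*-assoc l k′ (gcd k n)))

      E-injective : ∀ {x y} → E x ≈ E y → mod n x ≡ mod n y
      E-injective {x} {y} eq = go (ℕ.≤-total x y)
        where
        ordered : ∀ {x y} → x ℕ.≤ y → E x ≈ E y → mod n x ≡ mod n y
        ordered {x} {y} x≤y eq = ≡.trans (cong (mod n) (≡.sym (ℕ.+-identityʳ x)))
          (≡.trans (mod-+ˡ n x (≡.sym (∣⇒mod≡0 n∣y-x))) (cong (mod n) (ℕ.m+[n∸m]≡n x≤y)))
          where
          n∣y-x : n ∣ y ℕ.∸ x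
          n∣y-x = E-order (y ℕ.∸ x) (*-cancelˡ-≉0 (E-≉0 x) (begin
            E x * E (y ℕ.∸ x)      ≈⟨ E-+ x (y ℕ.∸ x) ⟨
            E (x ℕ.+ (y ℕ.∸ x))    ≈⟨ ^-congʳ γ (ℕ.m+[n∸m]≡n x≤y) ⟩
            E y                    ≈⟨ eq ⟨
            E x                    ≈⟨ *-identityʳ (E x) ⟨
            E x * 1#               ∎))
        go : x ℕ.≤ y ⊎ y ℕ.≤ x → mod n x ≡ mod n y
        go (inj₁ x≤y) = ordered x≤y eq
        go (inj₂ y≤x) = ≡.sym (ordered y≤x (sym eq))

      -- Pigeonhole: the exponents below n give n distinct elements among the n non-zero ones.
      ∃-log : ∀ z → z ≉ 0# → ∃[ x ] (E x ≈ z)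
      ∃-log z z≉0 = go (injective⇒surjective exponential exponential-injective (unitIndex z z≉0))
        where
        exponential : Fin n → Fin n
        exponential i = unitIndex (E (toℕ i)) (E-≉0 (toℕ i))
        unit-exponential : ∀ i → unit (exponential i) ≈ E (toℕ i)
        unit-exponential i = unit-unitIndex (E (toℕ i)) (E-≉0 (toℕ i))
        exponential-injective : ∀ {i j} → exponential i ≡ exponential j → i ≡ j
        exponential-injective {i} {j} eq = Fin.toℕ-injective (≡.trans (≡.sym (mod-< (Fin.toℕ<n i))) (≡.trans
          (E-injective (trans (sym (unit-exponential i)) (trans (reflexive (cong unit eq)) (unit-exponential j)))) (mod-< (Fin.toℕ<n j))))
        go : ∃[ i ] (exponential i ≡ unitIndex z z≉0) → ∃[ x ] (E x ≈ z)
        go (i , eq) = toℕ i , trans (sym (unit-exponential i)) (trans (reflexive (cong unit eq)) (unit-unitIndex z z≉0))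

      IsPrimitive-cong : ∀ {x y} → x ≈ y → IsPrimitive x → IsPrimitive y
      IsPrimitive-cong {x} {y} x≈y (x≉0 , powers) = x≉0 ∘ trans x≈y , λ z z≉0 →
        let k , xᵏ≈z = powers z z≉0
        in k , trans (pow≈^ y k) (trans (^-congˡ k (sym x≈y)) (trans (sym (pow≈^ x k)) xᵏ≈z))

      -- If (γˣ)ᵏ = γ then x k is 1 modulo n, hence modulo gcd(x,n), where it is also 0.
      primitive⇒gcd≡1 : ∀ x → IsPrimitive (E x) → gcd x n ≡ 1
      primitive⇒gcd≡1 x (_ , powers) = ∣1⇒≡1 (mod≡0⇒∣ (≡.sym (≡.trans (≡.sym (∣⇒mod≡0 (∣m⇒∣m*n k (gcd[m,n]∣m x n))))
        (periodic-cong (periodic-∣ (mod-periodic (gcd x n)) (gcd[m,n]∣n x n)) (E-injective (trans (sym (^-assocʳ γ x k)) (trans (sym (pow≈^ (E x) k)) Eˣᵏ≈γ)))))))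
        where
        k = proj₁ (powers (E 1) (E-≉0 1))
        Eˣᵏ≈γ = proj₂ (powers (E 1) (E-≉0 1))

      gcd≡1⇒primitive : ∀ x → gcd x n ≡ 1 → IsPrimitive (E x)
      gcd≡1⇒primitive x eq = E-≉0 x , λ z z≉0 →
        let s , Eˣˢ≈γ = inverse (coprime-Bézout (gcd≡1⇒coprime eq))
            y , Ey≈z = ∃-log z z≉0
        in s ℕ.* y , (begin
          pow (E x) (s ℕ.* y)    ≈⟨ pow≈^ (E x) (s ℕ.* y) ⟩
          E x ^ (s ℕ.* y)        ≈⟨ ^-assocʳ (E x) s y ⟨
          (E x ^ s) ^ y          ≈⟨ ^-congˡ y Eˣˢ≈γ ⟩
          E y                    ≈⟨ Ey≈z ⟩
          z                      ∎)
        where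
        inverse : Bézout.Identity 1 x n → ∃[ s ] (E x ^ s ≈ γ)
        inverse (Bézout.+- i j eq) = i , (begin
          E x ^ i                  ≈⟨ ^-assocʳ γ x i ⟩
          E (x ℕ.* i)              ≈⟨ ^-congʳ γ (≡.trans (ℕ.*-comm x i) (≡.sym eq)) ⟩
          E (1 ℕ.+ j ℕ.* n)        ≈⟨ E-cong (periodic-* (mod-periodic n) j 1) ⟩
          E 1                      ≈⟨ *-identityʳ γ ⟩
          γ                        ∎)
        -- Here 1 + i x = j n, so the inverse of x modulo n is -i; the natural number i (n - 1)
        -- represents it.
        inverse (Bézout.-+ i j eq) = i ℕ.* ℕ.pred n , (begin
          E x ^ (i ℕ.* ℕ.pred n)       ≈⟨ ^-assocʳ (E x) i (ℕ.pred n) ⟨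
          (E x ^ i) ^ ℕ.pred n         ≈⟨ *-cancelˡ-≉0 (^-≉0 (E-≉0 x) i) (begin
            E x ^ i * (E x ^ i) ^ ℕ.pred n   ≈⟨ ^-congʳ (E x ^ i) (ℕ.suc-pred n) ⟩
            (E x ^ i) ^ n                    ≈⟨ fermat (^-≉0 (E-≉0 x) i) ⟩
            1#                               ≈⟨ fermat (E-≉0 j) ⟨
            E j ^ n                          ≈⟨ ^-assocʳ γ j n ⟩
            E (j ℕ.* n)                      ≈⟨ ^-congʳ γ eq ⟨
            γ * E (i ℕ.* x)                  ≈⟨ *-congˡ (trans (^-congʳ γ (ℕ.*-comm i x)) (sym (^-assocʳ γ x i))) ⟩
            γ * E x ^ i                      ≈⟨ *-comm _ _ ⟩
            E x ^ i * γ                      ∎) ⟩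
          γ                            ∎)

      primitive? : ∀ z → Dec (IsPrimitive z)
      primitive? z = decide (z ≈? 0#)
        where
        decide : Dec (z ≈ 0#) → Dec (IsPrimitive z)
        decide (yes z≈0) = no (λ prim → proj₁ prim z≈0)
        decide (no z≉0)  = let x , Ex≈z = ∃-log z z≉0
                           in map′ (IsPrimitive-cong Ex≈z ∘ gcd≡1⇒primitive x) (primitive⇒gcd≡1 x ∘ IsPrimitive-cong (sym Ex≈z)) (gcd x n ℕ.≟ 1)

      𝟙-primitive : ∀ {x z} → E x ≈ z → 𝟙 (primitive? z) ≡ g x
      𝟙-primitive {x} {z} Ex≈z = ≡.sym (𝟙-unique (primitive? z)
        (λ prim → g-coprime (primitive⇒gcd≡1 x (IsPrimitive-cong (sym Ex≈z) prim)))
        (λ ¬prim → g-¬coprime (λ eq → ¬prim (IsPrimitive-cong Ex≈z (gcd≡1⇒primitive x eq)))))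

      module Line {u v : Carrier} (u≉0 : u ≉ 0#) (v≉0 : v ≉ 0#) where

        open import Algebra.Solver.Ring.NaturalCoefficients.Default commutativeSemiring using (solve; _:=_; _:+_; _:*_)

        private
          R = upTo n

        X : ℕ → ℕ → Carrier
        X a b = u * E a + v * E b

        L : ℕ → ℕ → ℕ → ℚ
        L a b c = 𝟙 (X a b ≈? E c)

        L-idem : ∀ a b c → L a b c ℚ.* L a b c ≡ L a b c
        L-idem a b c = 𝟙-idem (X a b ≈? E c)

        X-cong : ∀ a a′ b b′ → mod n a ≡ mod n a′ → mod n b ≡ mod n b′ → X a b ≈ X a′ b′
        X-cong a a′ b b′ a≡a′ b≡b′ = +-cong (*-congˡ (E-cong a≡a′)) (*-congˡ (E-cong b≡b′))

        L-periodic : ∀ b c → Periodic n (λ a → L a b c)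
        L-periodic b c a = 𝟙-cong (X (a ℕ.+ n) b ≈? E c) (X a b ≈? E c) (trans (sym eq)) (trans eq)
          where
          eq : X (a ℕ.+ n) b ≈ X a b
          eq = X-cong (a ℕ.+ n) a b b (mod-periodic n a) ≡.refl

        L-periodic-c : ∀ a b → Periodic n (L a b)
        L-periodic-c a b c = 𝟙-cong (X a b ≈? E (c ℕ.+ n)) (X a b ≈? E c) (λ h → trans h eq) (λ h → trans h (sym eq))
          where
          eq : E (c ℕ.+ n) ≈ E c
          eq = E-cong (mod-periodic n c)

        L-zero : ∀ a b c → X a b ≈ 0# → L a b c ≡ 0ℚ
        L-zero a b c X≈0 = 𝟙-false (X a b ≈? E c) λ X≈Ec → E-≉0 c (trans (sym X≈Ec) X≈0)

        L-log : ∀ a b {t} c → E t ≈ X a b → L a b c ≡ e n c t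
        L-log a b {t} c Et≈X = 𝟙-cong (X a b ≈? E c) (mod n c ℕ.≟ mod n t)
          (λ X≈Ec → E-injective (trans (sym X≈Ec) (sym Et≈X))) (λ c≡t → trans (sym Et≈X) (sym (E-cong c≡t)))

        0-or-log : ∀ z → z ≈ 0# ⊎ ∃[ t ] (E t ≈ z)
        0-or-log z = decide (z ≈? 0#)
          where
          decide : Dec (z ≈ 0#) → z ≈ 0# ⊎ ∃[ t ] (E t ≈ z)
          decide (yes z≈0) = inj₁ z≈0
          decide (no z≉0)  = inj₂ (∃-log z z≉0)

        -- At most one residue c satisfies the incidence, and none does when uγᵃ + vγᵇ = 0. The
        -- value `y` is prescribed for every logarithm, so the statement does not have to choose
        -- one.
        ∑-L* : ∀ a b {f : ℕ → ℚ} → Periodic n f → ∀ {y} → (∀ t → E t ≈ X a b → f t ≡ y) →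
          ∑[ c ∈ R ] (L a b c ℚ.* f c) ≡ (1ℚ ℚ.- 𝟙 (X a b ≈? 0#)) ℚ.* y
        ∑-L* a b {f} per {y} eq = go (0-or-log (X a b))
          where
          go : X a b ≈ 0# ⊎ ∃[ t ] (E t ≈ X a b) → ∑[ c ∈ R ] (L a b c ℚ.* f c) ≡ (1ℚ ℚ.- 𝟙 (X a b ≈? 0#)) ℚ.* y
          go (inj₁ X≈0) = ≡.trans
            (≡.trans (∑-cong R λ c → ≡.trans (cong (ℚ._* f c) (L-zero a b c X≈0)) (ℚ.*-zeroˡ (f c))) (∑-zero R))
            (≡.sym (≡.trans (cong (λ s → (1ℚ ℚ.- s) ℚ.* y) (𝟙-true (X a b ≈? 0#) X≈0)) (ℚ.*-zeroˡ y)))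
          go (inj₂ (t , Et≈X)) = ≡.trans
            (≡.trans (∑-cong R λ c → cong (ℚ._* f c) (L-log a b c Et≈X)) (≡.trans (∑-e n per t) (eq t Et≈X)))
            (≡.sym (≡.trans (cong (λ s → (1ℚ ℚ.- s) ℚ.* y) (𝟙-false (X a b ≈? 0#) (λ X≈0 → E-≉0 t (trans Et≈X X≈0)))) (ℚ.*-identityˡ y)))

        ∑-L*L : ∀ a b a′ b′ → ∑[ c ∈ R ] (L a b c ℚ.* L a′ b′ c) ≡ (1ℚ ℚ.- 𝟙 (X a b ≈? 0#)) ℚ.* 𝟙 (X a b ≈? X a′ b′)
        ∑-L*L a b a′ b′ = ∑-L* a b (L-periodic-c a′ b′) λ t Et≈X →
          𝟙-cong (X a′ b′ ≈? E t) (X a b ≈? X a′ b′) (λ h → sym (trans h Et≈X)) (λ h → trans (sym h) (sym Et≈X))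

        solve-linear : ∀ {s t} → s ≉ 0# → t ≉ 0# → ∃[ a ] (s * E a ≈ t)
        solve-linear {s} {t} s≉0 t≉0 =
          let a , Ea≈ = ∃-log (s ⁻¹ * t) (*-≉0 (⁻¹-≉0 s≉0) t≉0)
          in a , trans (*-congˡ Ea≈) (*-⁻¹-cancelˡ t s≉0)

        ∑-X≈0 : ∀ b → ∑[ a ∈ R ] 𝟙 (X a b ≈? 0#) ≡ 1ℚ
        ∑-X≈0 b = ≡.trans (∑-cong R λ a → 𝟙-cong (X a b ≈? 0#) (mod n a ℕ.≟ mod n a₀)
            (λ X≈0 → E-injective (*-cancelˡ-≉0 u≉0 (trans (+-cancelʳ (v * E b) _ _ (trans X≈0 (sym (-‿inverseˡ _)))) (sym uEa₀≈))))
            (λ a≡a₀ → trans (X-cong a a₀ b b a≡a₀ ≡.refl) (trans (+-congʳ uEa₀≈) (-‿inverseˡ _))))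
          (∑-e-1 n a₀)
          where
          -vEb≉0 : - (v * E b) ≉ 0#
          -vEb≉0 eq = *-≉0 v≉0 (E-≉0 b) (trans (sym (+-identityʳ _)) (trans (+-congˡ (sym eq)) (-‿inverseʳ _)))
          a₀ = proj₁ (solve-linear u≉0 -vEb≉0)
          uEa₀≈ = proj₂ (solve-linear u≉0 -vEb≉0)

        -- Equality of the two points means uγᵃ(1 - γᵟ) = v(γᵇ′ - γᵇ). If both differences vanish,
        -- every a qualifies except the one with value 0: n - 1 solutions. If exactly one vanishes,
        -- there are none. Otherwise there is one solution, which is discarded when the common value
        -- is 0, that is, when b′ = b + δ.
        L-gram : ∀ b b′ δ → ∑[ a ∈ R ] ∑[ c ∈ R ] (L a b c ℚ.* L (a ℕ.+ δ) b′ c) ≡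
          1ℚ ℚ.- e n δ 0 ℚ.- e n b′ b ℚ.- e n b′ (b ℕ.+ δ) ℚ.+ ι (suc n) ℚ.* (e n δ 0 ℚ.* e n b′ b)
        L-gram b b′ δ = ≡.trans (∑-cong R λ a → ∑-L*L a b (a ℕ.+ δ) b′) (cases (mod n δ ℕ.≟ mod n 0) (mod n b′ ℕ.≟ mod n b))
          where
          open +-*-Solver using () renaming (solve to ℚ-solve; _:=_ to _⊜_; _:+_ to _⊕_; _:*_ to _⊗_; _:-_ to _⊖_; con to κ)
          q = ι (suc n)
          rhs : ℚ → ℚ → ℚ → ℚ
          rhs x y z = 1ℚ ℚ.- x ℚ.- y ℚ.- z ℚ.+ q ℚ.* (x ℚ.* y)
          lhs = ∑[ a ∈ R ] ((1ℚ ℚ.- 𝟙 (X a b ≈? 0#)) ℚ.* 𝟙 (X a b ≈? X (a ℕ.+ δ) b′))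
          rhs-cong : ∀ {x y z} → e n δ 0 ≡ x → e n b′ b ≡ y → e n b′ (b ℕ.+ δ) ≡ z → rhs (e n δ 0) (e n b′ b) (e n b′ (b ℕ.+ δ)) ≡ rhs x y z
          rhs-cong ≡.refl ≡.refl ≡.refl = ≡.refl
          vanish : (∀ a → ¬ X a b ≈ X (a ℕ.+ δ) b′) → lhs ≡ 0ℚ
          vanish X≉X′ = ≡.trans (∑-cong R λ a → ≡.trans (cong ((1ℚ ℚ.- 𝟙 (X a b ≈? 0#)) ℚ.*_) (𝟙-false (X a b ≈? X (a ℕ.+ δ) b′) (X≉X′ a))) (ℚ.*-zeroʳ (1ℚ ℚ.- 𝟙 (X a b ≈? 0#)))) (∑-zero R)
          a+δ≡a : mod n δ ≡ mod n 0 → ∀ a → mod n (a ℕ.+ δ) ≡ mod n a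
          a+δ≡a δ≡0 a = ≡.trans (mod-+ˡ n a δ≡0) (cong (mod n) (ℕ.+-identityʳ a))
          cases : Dec (mod n δ ≡ mod n 0) → Dec (mod n b′ ≡ mod n b) → lhs ≡ rhs (e n δ 0) (e n b′ b) (e n b′ (b ℕ.+ δ))
          cases (yes δ≡0) (yes b′≡b) = ≡.trans (all-solutions) (≡.sym (≡.trans (rhs-cong (𝟙-true (mod n δ ℕ.≟ mod n 0) δ≡0) (𝟙-true (mod n b′ ℕ.≟ mod n b) b′≡b) (𝟙-true (mod n b′ ℕ.≟ mod n (b ℕ.+ δ)) (≡.trans b′≡b (≡.sym (a+δ≡a δ≡0 b)))))
            (≡.trans (cong (λ q → 1ℚ ℚ.- 1ℚ ℚ.- 1ℚ ℚ.- 1ℚ ℚ.+ q ℚ.* (1ℚ ℚ.* 1ℚ)) (ι-suc n)) (ℚ-solve 1 (λ m → κ 1ℚ ⊖ κ 1ℚ ⊖ κ 1ℚ ⊖ κ 1ℚ ⊕ (κ 1ℚ ⊕ m) ⊗ (κ 1ℚ ⊗ κ 1ℚ) ⊜ m ⊗ κ 1ℚ ⊖ κ 1ℚ) ≡.refl (ι n)))))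
            where
            all-solutions : lhs ≡ ι n ℚ.* 1ℚ ℚ.- 1ℚ
            all-solutions = ≡.trans (∑-cong R λ a → ≡.trans (cong ((1ℚ ℚ.- 𝟙 (X a b ≈? 0#)) ℚ.*_) (𝟙-true (X a b ≈? X (a ℕ.+ δ) b′) (X-cong a (a ℕ.+ δ) b b′ (≡.sym (a+δ≡a δ≡0 a)) (≡.sym b′≡b)))) (ℚ.*-identityʳ _))
              (≡.trans (∑-- R _ _) (cong₂ ℚ._-_ (∑-upTo-const n 1ℚ) (∑-X≈0 b)))
          cases (yes δ≡0) (no b′≢b) = ≡.trans (vanish X≉X′) (≡.sym (≡.trans
              (rhs-cong (𝟙-true (mod n δ ℕ.≟ mod n 0) δ≡0) (𝟙-false (mod n b′ ℕ.≟ mod n b) b′≢b) (𝟙-false (mod n b′ ℕ.≟ mod n (b ℕ.+ δ)) (λ eq → b′≢b (≡.trans eq (a+δ≡a δ≡0 b)))))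
              (ℚ-solve 1 (λ q → κ 1ℚ ⊖ κ 1ℚ ⊖ κ 0ℚ ⊖ κ 0ℚ ⊕ q ⊗ (κ 1ℚ ⊗ κ 0ℚ) ⊜ κ 0ℚ) ≡.refl q)))
            where
            X≉X′ : ∀ a → ¬ X a b ≈ X (a ℕ.+ δ) b′
            X≉X′ a eq = b′≢b (≡.sym (E-injective (*-cancelˡ-≉0 v≉0 (+-cancelˡ (u * E a) _ _ (trans eq (X-cong (a ℕ.+ δ) a b′ b′ (a+δ≡a δ≡0 a) ≡.refl))))))
          cases (no δ≢0) (yes b′≡b) = ≡.trans (vanish X≉X′) (≡.sym (≡.trans
              (rhs-cong (𝟙-false (mod n δ ℕ.≟ mod n 0) δ≢0) (𝟙-true (mod n b′ ℕ.≟ mod n b) b′≡b) (𝟙-false (mod n b′ ℕ.≟ mod n (b ℕ.+ δ)) (λ eq → δ≢0 (cancel b (≡.trans (≡.sym eq) b′≡b)))))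
              (ℚ-solve 1 (λ q → κ 1ℚ ⊖ κ 0ℚ ⊖ κ 1ℚ ⊖ κ 0ℚ ⊕ q ⊗ (κ 0ℚ ⊗ κ 1ℚ) ⊜ κ 0ℚ) ≡.refl q)))
            where
            cancel : ∀ x → mod n (x ℕ.+ δ) ≡ mod n x → mod n δ ≡ mod n 0
            cancel x eq = mod-cancelˡ n x (≡.trans eq (cong (mod n) (≡.sym (ℕ.+-identityʳ x))))
            X≉X′ : ∀ a → ¬ X a b ≈ X (a ℕ.+ δ) b′
            X≉X′ a eq = δ≢0 (cancel a (≡.sym (E-injective (*-cancelˡ-≉0 u≉0 (+-cancelʳ (v * E b) _ _ (trans eq (X-cong (a ℕ.+ δ) (a ℕ.+ δ) b′ b ≡.refl b′≡b)))))))
          cases (no δ≢0) (no b′≢b) = ≡.trans sum≡ (≡.sym (≡.trans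
              (rhs-cong (𝟙-false (mod n δ ℕ.≟ mod n 0) δ≢0) (𝟙-false (mod n b′ ℕ.≟ mod n b) b′≢b) ≡.refl)
              (ℚ-solve 2 (λ z q → κ 1ℚ ⊖ κ 0ℚ ⊖ κ 0ℚ ⊖ z ⊕ q ⊗ (κ 0ℚ ⊗ κ 0ℚ) ⊜ κ 1ℚ ⊖ z) ≡.refl (e n b′ (b ℕ.+ δ)) q)))
            where
            d w : Carrier
            -- The solver handles semirings only, so d and w enter through d + γᵟ = 1 and w + γᵇ =
            -- γᵇ′. The term `common a` is split off from both points and cancelled, leaving the
            -- equation u d γᵃ = v w.
            d = 1# - E δ
            w = E b′ - E b
            d+Eδ≈1 : d + E δ ≈ 1#
            d+Eδ≈1 = trans (+-assoc 1# (- E δ) (E δ)) (trans (+-congˡ (-‿inverseˡ (E δ))) (+-identityʳ 1#))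
            w+Eb≈Eb′ : w + E b ≈ E b′
            w+Eb≈Eb′ = trans (+-assoc (E b′) (- E b) (E b)) (trans (+-congˡ (-‿inverseˡ (E b))) (+-identityʳ (E b′)))
            d≉0 : d ≉ 0#
            d≉0 d≈0 = δ≢0 (E-injective (trans (sym (+-identityˡ (E δ))) (trans (+-congʳ (sym d≈0)) d+Eδ≈1)))
            w≉0 : w ≉ 0#
            w≉0 w≈0 = b′≢b (≡.sym (E-injective (trans (sym (+-identityˡ (E b))) (trans (+-congʳ (sym w≈0)) w+Eb≈Eb′))))
            linear = solve-linear (*-≉0 u≉0 d≉0) (*-≉0 v≉0 w≉0)
            a₀ = proj₁ linear
            common : ℕ → Carrier
            common a = u * (E a * E δ) + v * E b
            X≈ : ∀ a → X a b ≈ u * d * E a + common a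
            X≈ a = begin
              u * E a + v * E b                                    ≈⟨ +-congʳ (*-congˡ (*-identityʳ (E a))) ⟨
              u * (E a * 1#) + v * E b                             ≈⟨ +-congʳ (*-congˡ (*-congˡ d+Eδ≈1)) ⟨
              u * (E a * (d + E δ)) + v * E b                      ≈⟨ solve 5 (λ u a d δ b → u :* (a :* (d :+ δ)) :+ b := u :* d :* a :+ (u :* (a :* δ) :+ b)) refl u (E a) d (E δ) (v * E b) ⟩
              u * d * E a + common a                               ∎
            X′≈ : ∀ a → X (a ℕ.+ δ) b′ ≈ v * w + common a
            X′≈ a = begin
              u * E (a ℕ.+ δ) + v * E b′                           ≈⟨ +-cong (*-congˡ (E-+ a δ)) (*-congˡ (sym w+Eb≈Eb′)) ⟩
              u * (E a * E δ) + v * (w + E b)                      ≈⟨ solve 4 (λ x v w b → x :+ v :* (w :+ b) := v :* w :+ (x :+ v :* b)) refl (u * (E a * E δ)) v w (E b) ⟩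
              v * w + common a                                     ∎
            X≈X′⇔ : ∀ a → 𝟙 (X a b ≈? X (a ℕ.+ δ) b′) ≡ e n a a₀
            X≈X′⇔ a = 𝟙-cong (X a b ≈? X (a ℕ.+ δ) b′) (mod n a ℕ.≟ mod n a₀)
              (λ h → E-injective (*-cancelˡ-≉0 (*-≉0 u≉0 d≉0) (trans (+-cancelʳ (common a) _ _ (trans (sym (X≈ a)) (trans h (X′≈ a)))) (sym (proj₂ linear)))))
              (λ h → trans (X≈ a) (trans (+-congʳ (trans (*-congˡ (E-cong h)) (proj₂ linear))) (sym (X′≈ a))))
            -- At the solution, d times the common value is v(γᵇ′ - γᵇ⁺ᵟ); this decides when that
            -- value is 0.
            dX≈ : d * X a₀ b + v * (E b * E δ) ≈ v * E b′
            dX≈ = begin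
              d * (u * E a₀ + v * E b) + v * (E b * E δ)           ≈⟨ solve 6 (λ d u a v b δ → d :* (u :* a :+ v :* b) :+ v :* (b :* δ) := u :* d :* a :+ v :* (b :* (d :+ δ))) refl d u (E a₀) v (E b) (E δ) ⟩
              u * d * E a₀ + v * (E b * (d + E δ))                 ≈⟨ +-cong (proj₂ linear) (*-congˡ (trans (*-congˡ d+Eδ≈1) (*-identityʳ (E b)))) ⟩
              v * w + v * E b                                      ≈⟨ distribˡ v w (E b) ⟨
              v * (w + E b)                                        ≈⟨ *-congˡ w+Eb≈Eb′ ⟩
              v * E b′                                             ∎
            X₀≈0⇔ : 𝟙 (X a₀ b ≈? 0#) ≡ e n b′ (b ℕ.+ δ)
            X₀≈0⇔ = 𝟙-cong (X a₀ b ≈? 0#) (mod n b′ ℕ.≟ mod n (b ℕ.+ δ))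
              (λ X≈0 → E-injective (*-cancelˡ-≉0 v≉0 (begin
                v * E b′                              ≈⟨ dX≈ ⟨
                d * X a₀ b + v * (E b * E δ)          ≈⟨ +-congʳ (trans (*-congˡ X≈0) (zeroʳ d)) ⟩
                0# + v * (E b * E δ)                  ≈⟨ +-identityˡ _ ⟩
                v * (E b * E δ)                       ≈⟨ *-congˡ (E-+ b δ) ⟨
                v * E (b ℕ.+ δ)                       ∎)))
              (λ b′≡b+δ → *-cancelˡ-≉0 d≉0 (trans (+-cancelʳ (v * (E b * E δ)) _ _ (begin
                d * X a₀ b + v * (E b * E δ)          ≈⟨ dX≈ ⟩
                v * E b′                              ≈⟨ *-congˡ (trans (E-cong b′≡b+δ) (E-+ b δ)) ⟩
                v * (E b * E δ)                       ≈⟨ +-identityˡ _ ⟨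
                0# + v * (E b * E δ)                  ∎)) (sym (zeroʳ d))))
            X-periodic : Periodic n (λ a → 1ℚ ℚ.- 𝟙 (X a b ≈? 0#))
            X-periodic a = cong (λ s → 1ℚ ℚ.- s) (𝟙-cong (X (a ℕ.+ n) b ≈? 0#) (X a b ≈? 0#) (trans (sym X≈X)) (trans X≈X))
              where
              X≈X : X (a ℕ.+ n) b ≈ X a b
              X≈X = X-cong (a ℕ.+ n) a b b (mod-periodic n a) ≡.refl
            sum≡ : lhs ≡ 1ℚ ℚ.- e n b′ (b ℕ.+ δ)
            sum≡ = ≡.trans (∑-cong R λ a → ≡.trans (cong ((1ℚ ℚ.- 𝟙 (X a b ≈? 0#)) ℚ.*_) (X≈X′⇔ a)) (ℚ.*-comm _ (e n a a₀)))
              (≡.trans (∑-e n X-periodic a₀) (cong (λ s → 1ℚ ℚ.- s) X₀≈0⇔))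

        -- From pairs of field elements to triples of exponents

        uvPrimitive? : ∀ x y → Dec (IsUVPrimitive u v x y)
        uvPrimitive? x y = primitive? x ×-dec primitive? y ×-dec primitive? (u * x + v * y) ×-dec primitive? (v * x ⁻¹ + u * y ⁻¹)

        -- This makes the second linear form a quotient of the first by xy, so its logarithm is c -
        -- a - b and all four primitivity conditions concern exponents.
        reciprocal-combination : ∀ {x y} → x ≉ 0# → y ≉ 0# → (v * x ⁻¹ + u * y ⁻¹) * (x * y) ≈ u * x + v * y
        reciprocal-combination {x} {y} x≉0 y≉0 = begin
          (v * x ⁻¹ + u * y ⁻¹) * (x * y)                    ≈⟨ solve 6 (λ u v x y x′ y′ → (v :* x′ :+ u :* y′) :* (x :* y) := u :* (x :* (y :* y′)) :+ v :* (y :* (x :* x′))) refl u v x y (x ⁻¹) (y ⁻¹) ⟩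
          u * (x * (y * y ⁻¹)) + v * (y * (x * x ⁻¹))        ≈⟨ +-cong (*-congˡ (*-congˡ (⁻¹-inv y y≉0))) (*-congˡ (*-congˡ (⁻¹-inv x x≉0))) ⟩
          u * (x * 1#) + v * (y * 1#)                        ≈⟨ +-cong (*-congˡ (*-identityʳ x)) (*-congˡ (*-identityʳ y)) ⟩
          u * x + v * y                                      ∎

        ∑-line : ∀ {a b x y} → E a ≈ x → E b ≈ y →
          ∑[ c ∈ R ] (L a b c ℚ.* (g b ℚ.* g c ℚ.* (g a ℚ.* coprimeKernel (a ℕ.+ b) c))) ≡ 𝟙 (uvPrimitive? x y)
        ∑-line {a} {b} {x} {y} Ea≈x Eb≈y = ≡.trans
          (∑-L* a b (λ c → cong₂ (λ s t → g b ℚ.* s ℚ.* (g a ℚ.* t)) (coprimeKernel-periodicˡ 0 c) (coprimeKernel-periodicʳ (a ℕ.+ b) c))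
            (λ t Et≈X → cong₂ (λ s t → g b ℚ.* s ℚ.* (g a ℚ.* t)) (≡.sym (𝟙-primitive (trans Et≈X X≈Z))) (kernel t Et≈X)))
          (≡.trans (ℚ-solve 5 (λ z b p a q → z ⊗ (b ⊗ p ⊗ (a ⊗ q)) ⊜ a ⊗ (b ⊗ ((z ⊗ p) ⊗ q))) ≡.refl (1ℚ ℚ.- 𝟙 (X a b ≈? 0#)) (g b) (𝟙 (primitive? Z)) (g a) (𝟙 (primitive? Z′)))
          -- A primitive element is not 0, so the factor that excludes the value 0 is absorbed by
          -- the indicator of primitivity.
          (≡.trans (cong (λ s → g a ℚ.* (g b ℚ.* (s ℚ.* 𝟙 (primitive? Z′)))) (𝟙-absorb (X a b ≈? 0#) (primitive? Z) (λ X≈0 prim → proj₁ prim (trans (sym X≈Z) X≈0))))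
          (≡.trans (cong₂ (λ s t → s ℚ.* (t ℚ.* (𝟙 (primitive? Z) ℚ.* 𝟙 (primitive? Z′)))) (≡.sym (𝟙-primitive Ea≈x)) (≡.sym (𝟙-primitive Eb≈y)))
          (≡.sym (≡.trans (𝟙-× (primitive? x) (primitive? y ×-dec primitive? Z ×-dec primitive? Z′)) (cong (𝟙 (primitive? x) ℚ.*_) (≡.trans (𝟙-× (primitive? y) (primitive? Z ×-dec primitive? Z′)) (cong (𝟙 (primitive? y) ℚ.*_) (𝟙-× (primitive? Z) (primitive? Z′))))))))))
          where
          open +-*-Solver using () renaming (solve to ℚ-solve; _:=_ to _⊜_; _:*_ to _⊗_)
          Z Z′ : Carrier
          Z = u * x + v * y
          Z′ = v * x ⁻¹ + u * y ⁻¹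
          X≈Z : X a b ≈ Z
          X≈Z = +-cong (*-congˡ Ea≈x) (*-congˡ Eb≈y)
          Z′xy≈Z : Z′ * (x * y) ≈ Z
          Z′xy≈Z = reciprocal-combination (λ x≈0 → E-≉0 a (trans Ea≈x x≈0)) (λ y≈0 → E-≉0 b (trans Eb≈y y≈0))
          kernel : ∀ t → E t ≈ X a b → coprimeKernel (a ℕ.+ b) t ≡ 𝟙 (primitive? Z′)
          kernel t Et≈X = go (∃-log Z′ (λ Z′≈0 → E-≉0 t (trans Et≈X (trans X≈Z (trans (sym Z′xy≈Z) (trans (*-congʳ Z′≈0) (zeroˡ _)))))))
            where
            go : ∃[ s ] (E s ≈ Z′) → coprimeKernel (a ℕ.+ b) t ≡ 𝟙 (primitive? Z′)
            go (s , Es≈Z′) = ≡.trans (periodic-cong (coprimeKernel-periodicʳ (a ℕ.+ b)) (E-injective (begin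
                E t                          ≈⟨ trans Et≈X X≈Z ⟩
                Z                            ≈⟨ Z′xy≈Z ⟨
                Z′ * (x * y)                 ≈⟨ *-cong Es≈Z′ (*-cong Ea≈x Eb≈y) ⟨
                E s * (E a * E b)            ≈⟨ *-congˡ (E-+ a b) ⟨
                E s * E (a ℕ.+ b)            ≈⟨ E-+ s (a ℕ.+ b) ⟨
                E (s ℕ.+ (a ℕ.+ b))          ∎)))
              (≡.trans (coprimeKernel-+ 0 s (a ℕ.+ b)) (≡.trans (coprimeKernel-sym 0 s) (≡.sym (𝟙-primitive Es≈Z′))))

        _≟²_ : DecidableEquality (Fin (suc n) × Fin (suc n))
        _≟²_ = ≡-dec Fin._≟_ Fin._≟_

        -- Each non-zero entry has exactly one logarithm modulo n, so the double sum is a product of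
        -- two sums of deltas.
        ∑-fibre : ∀ i j → enum i ≉ 0# → enum j ≉ 0# → ∑[ b ∈ R ] ∑[ a ∈ R ] 𝟙 ((i , j) ≟² (index (E a) , index (E b))) ≡ 1ℚ
        ∑-fibre i j i≉0 j≉0 = go (∃-log (enum i) i≉0) (∃-log (enum j) j≉0)
          where
          toLog : ∀ {i s} a → E s ≈ enum i → i ≡ index (E a) → mod n a ≡ mod n s
          toLog a Es≈i i≡ = E-injective (trans (sym (enum-index (E a))) (trans (reflexive (cong enum (≡.sym i≡))) (sym Es≈i)))
          fromLog : ∀ {i s} a → E s ≈ enum i → mod n a ≡ mod n s → i ≡ index (E a)
          fromLog a Es≈i a≡s = enum-inj _ _ (trans (sym Es≈i) (trans (sym (E-cong a≡s)) (sym (enum-index (E a)))))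
          go : ∃[ s ] (E s ≈ enum i) → ∃[ t ] (E t ≈ enum j) → ∑[ b ∈ R ] ∑[ a ∈ R ] 𝟙 ((i , j) ≟² (index (E a) , index (E b))) ≡ 1ℚ
          go (s , Es≈i) (t , Et≈j) = ≡.trans
            (∑∑-cong R R λ b a → ≡.trans
              (𝟙-cong ((i , j) ≟² (index (E a) , index (E b))) ((mod n b ℕ.≟ mod n t) ×-dec (mod n a ℕ.≟ mod n s))
                (λ eq → toLog b Et≈j (cong proj₂ eq) , toLog a Es≈i (cong proj₁ eq))
                (λ (b≡t , a≡s) → cong₂ _,_ (fromLog a Es≈i a≡s) (fromLog b Et≈j b≡t)))
              (𝟙-× (mod n b ℕ.≟ mod n t) (mod n a ℕ.≟ mod n s)))
            (≡.trans (∑-×ˡ R R (λ b → e n b t) (λ a → e n a s)) (cong₂ ℚ._*_ (∑-e-1 n t) (∑-e-1 n s)))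

        -- Double counting: each listed pair contributes 1 as the number of its exponent pairs.
        -- After the sums are interchanged, an exponent pair is met once or never, according to the
        -- indicator of (u,v)-primitivity, and `∑-line` spreads that indicator over c.
        count : ∀ {N} → IsN F u v N → ι N ≡
          ∑[ c ∈ R ] ∑[ b ∈ R ] ∑[ a ∈ R ] (L a b c ℚ.* (g b ℚ.* g c ℚ.* (g a ℚ.* coprimeKernel (a ℕ.+ b) c)))
        count {N} (f , f-injective , f-sound , f-complete) = ≡.trans ι≡
          (≡.trans (∑-cong K λ k → ≡.sym (∑-fibre (proj₁ (f k)) (proj₂ (f k)) (proj₁ (proj₁ (f-sound k))) (proj₁ (proj₁ (proj₂ (f-sound k))))))
          (≡.trans (∑-swap K R _) (≡.trans (∑-cong R λ b → ∑-swap K R _)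
          (≡.trans (∑∑-cong R R λ b a → ≡.trans (fibre a b) (≡.sym (∑-line (sym (enum-index (E a))) (sym (enum-index (E b))))))
          (≡.trans (∑-cong R λ b → ∑-swap R R _) (∑-swap R R _))))))
          where
          K = allFin N
          ι≡ : ι N ≡ ∑[ k ∈ K ] 1ℚ
          ι≡ = ≡.sym (≡.trans (∑-const K 1ℚ) (≡.trans (ℚ.*-identityʳ _) (cong ι (length-tabulate {n = N} id))))
          fibre : ∀ a b → ∑[ k ∈ K ] 𝟙 (f k ≟² (index (E a) , index (E b))) ≡ 𝟙 (uvPrimitive? (enum (index (E a))) (enum (index (E b))))
          fibre a b = 𝟙-unique (uvPrimitive? (enum (index (E a))) (enum (index (E b)))) present absent
            where
            ij = index (E a) , index (E b)
            present : IsUVPrimitive u v (enum (index (E a))) (enum (index (E b))) → ∑[ k ∈ K ] 𝟙 (f k ≟² ij) ≡ 1ℚ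
            present prim = let k₀ , fk₀≡ij = f-complete ij prim in ≡.trans
              (∑-cong K λ k → 𝟙-cong (f k ≟² ij) (k Fin.≟ k₀) (λ fk≡ij → f-injective (≡.trans fk≡ij (≡.sym fk₀≡ij))) (λ k≡k₀ → ≡.trans (cong f k≡k₀) fk₀≡ij))
              (∑-𝟙-≡ Fin._≟_ (allFin⁺ N) (∈-allFin k₀))
            absent : ¬ IsUVPrimitive u v (enum (index (E a))) (enum (index (E b))) → ∑[ k ∈ K ] 𝟙 (f k ≟² ij) ≡ 0ℚ
            absent ¬prim = ≡.trans (∑-cong K λ k → 𝟙-false (f k ≟² ij) λ fk≡ij →
              ¬prim (subst (λ (i , j) → IsUVPrimitive u v (enum i) (enum j)) fk≡ij (f-sound k))) (∑-zero K)

-- The bound for n ≥ 3 and the case q = 3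

module Bounds where

  open import Defs
  open import Level using (Level)
  open import Data.Nat as ℕ using (ℕ; suc; NonZero; z≤n; s≤s; _<_)
  import Data.Nat.Properties as ℕ
  open import Data.Product using (∃-syntax; _,_)
  open import Data.List using (upTo)
  open import Data.Rational as ℚ using (ℚ; 0ℚ; 1ℚ; _+_; _*_; _-_; _≤_)
  import Data.Rational.Properties as ℚ
  open import Data.Rational.Solver using (module +-*-Solver)
  open import Relation.Nullary using (Dec; yes; no; contradiction)
  open import Relation.Nullary.Decidable using (toWitness; ¬?)
  open import Relation.Binary.PropositionalEquality
  open Exponents
  open FiniteFields
  open +-*-Solver using (solve; _:=_; _:+_; _:*_; _:-_; con)

  -- Dividing by m⁶ gives D² ≤ q (m w² t³)², the bound with θ³W². Multiplying its right side by (w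
  -- t)² ≥ 1 produces θ⁴W³.
  clear-denominators : ∀ n .{{_ : NonZero n}} {q N t s w C G Q} →
    let m = ι n in
    0ℚ ≤ q → 1ℚ ≤ w * t → C ≡ w * t → G ≡ m * t → Q ≡ m * m * m * (t * t * t * s) →
    (m * m * (m * N) - q * (m * Q)) * (m * m * (m * N) - q * (m * Q)) ≤ m * m * (m * m) * q * (m * (C * C * G)) * (m * (C * C * G)) →
    (N - t * t * t * s * (m * q)) * (N - t * t * t * s * (m * q)) ≤
    t * t * t * t * (w * w * w) * m * (t * t * t * t * (w * w * w) * m) * q
  clear-denominators n {q} {N} {t} {s} {w} 0≤q 1≤wt refl refl refl bound = ℚ.≤-trans
    (ℚ.*-cancelˡ-≤-pos m⁶ {{ℚ.positive 0<m⁶}} (subst₂ _≤_ lhs rhs bound))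
    (subst₂ _≤_ (ℚ.*-identityʳ Y) final (ℚ.*-monoˡ-≤-nonNeg Y {{ℚ.nonNegative 0≤Y}} (*-mono-≤ (0≤ι 1) (ℚ.≤-trans (0≤ι 1) 1≤wt) 1≤wt 1≤wt)))
    where
    m = ι n
    m⁶ = m * m * m * (m * m * m)
    Y = q * (m * (w * w * (t * t * t)) * (m * (w * w * (t * t * t))))
    D = N - t * t * t * s * (m * q)
    0<p*q : ∀ {x y} → 0ℚ ℚ.< x → 0ℚ ℚ.< y → 0ℚ ℚ.< x * y
    0<p*q {x} {y} 0<x 0<y = ℚ.positive⁻¹ (x * y) {{ℚ.pos*pos⇒pos x {{ℚ.positive 0<x}} y {{ℚ.positive 0<y}}}}
    0<m = 0<ι-nonZero n
    0<m⁶ = 0<p*q (0<p*q (0<p*q 0<m 0<m) 0<m) (0<p*q (0<p*q 0<m 0<m) 0<m)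
    0≤Y : 0ℚ ≤ Y
    0≤Y = 0≤p*q 0≤q (0≤p*p (m * (w * w * (t * t * t))))
    lhs : (m * m * (m * N) - q * (m * (m * m * m * (t * t * t * s)))) * (m * m * (m * N) - q * (m * (m * m * m * (t * t * t * s)))) ≡ m⁶ * (D * D)
    lhs = trans (cong (λ x → x * x) (solve 5 (λ m N q t s → m :* m :* (m :* N) :- q :* (m :* (m :* m :* m :* (t :* t :* t :* s))) := m :* m :* m :* (N :- t :* t :* t :* s :* (m :* q))) refl m N q t s))
                (solve 2 (λ c d → c :* d :* (c :* d) := c :* c :* (d :* d)) refl (m * m * m) D)
    rhs : m * m * (m * m) * q * (m * (w * t * (w * t) * (m * t))) * (m * (w * t * (w * t) * (m * t))) ≡ m⁶ * Y
    rhs = solve 4 (λ m q w t → m :* m :* (m :* m) :* q :* (m :* (w :* t :* (w :* t) :* (m :* t))) :* (m :* (w :* t :* (w :* t) :* (m :* t))) :=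
      m :* m :* m :* (m :* m :* m) :* (q :* (m :* (w :* w :* (t :* t :* t)) :* (m :* (w :* w :* (t :* t :* t)))))) refl m q w t
    final : Y * (w * t * (w * t)) ≡ t * t * t * t * (w * w * w) * m * (t * t * t * t * (w * w * w) * m) * q
    final = solve 4 (λ m q w t → q :* (m :* (w :* w :* (t :* t :* t)) :* (m :* (w :* w :* (t :* t :* t)))) :* (w :* t :* (w :* t)) :=
      t :* t :* t :* t :* (w :* w :* w) :* m :* (t :* t :* t :* t :* (w :* w :* w) :* m) :* q) refl m q w t

  module _ {c ℓ : Level} {n : ℕ} .{{_ : NonZero n}} (F : FiniteField c ℓ (suc n)) where

    open DiscreteLogarithm F using (Carrier; _≉_; 0#; Generates; ∃-generates; module WithGenerator)
    open PrimitiveExponents n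

    mainBound-≥3 : 3 ℕ.≤ n → ∀ {u v} → u ≉ 0# → v ≉ 0# → ∀ {N} → IsN F u v N → MainBound (suc n) N
    mainBound-≥3 3≤n {u} {v} u≉0 v≉0 {N} isN = go (∃-generates primeDivisors-sound primeDivisors-unique)
      where
      go : ∃[ γ ] Generates (primeDivisors n) γ → MainBound (suc n) N
      go (γ , γ-generates) = clear-denominators n {q} {ι N} {θ n} {τ n} {ι (W n)} {C} {∑g²} {all} (0≤ι (suc n)) 1≤Wθ (sym Wθ≡∏) (trans (∑-cong (upTo n) g-idem) ∑g) ∑-quadruples
        (subst (λ N → (m * m * (m * N) - q * (m * all)) * (m * m * (m * N) - q * (m * all)) ≤ bound) (sym (count isN)) (deviation-bound 3≤n))
        where
        open WithGenerator γ γ-generates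
        open Line u≉0 v≉0
        open QuadrupleSum n L L-periodic L-idem L-gram coprimeKernel-factorisation coprimeKernel-+ coprimeKernel-periodicˡ g (coprimeKernel-periodicˡ 0)
        m = ι n
        q = ι (suc n)
        C = ∏ (primeDivisors n) (λ l → ι 2 * θₗ l)
        bound = m * m * (m * m) * q * (m * (C * C * ∑g²)) * (m * (C * C * ∑g²))

  -- For q = 3 the operator bound T-bound fails, but N is the value of a single indicator.
  mainBound-3 : ∀ {c ℓ} (F : FiniteField c ℓ 3) → let open FiniteField F in
    ∀ {u v} → u ≉ 0# → v ≉ 0# → ∀ {N} → IsN F u v N → MainBound 3 N
  mainBound-3 F {u} {v} u≉0 v≉0 {N} isN = go (∃-generates primeDivisors-sound primeDivisors-unique)
    where
    open DiscreteLogarithm F using (Generates; ∃-generates; _≈?_; module WithGenerator)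
    open PrimitiveExponents 2
    go : ∃[ γ ] Generates (primeDivisors 2) γ → MainBound 3 N
    go (γ , γ-generates) = small N (subst (_≤ 1ℚ) (sym (trans (count isN) only)) (𝟙≤1 (X 1 1 ≈? E 1)))
      where
      open WithGenerator γ γ-generates
      open Line u≉0 v≉0
      𝟙≤1 : ∀ {p} {P : Set p} (P? : Dec P) → 𝟙 P? ≤ 1ℚ
      𝟙≤1 (yes _) = ℚ.≤-refl
      𝟙≤1 (no _)  = 0≤ι 1
      coefficient : ℕ → ℕ → ℕ → ℚ
      coefficient a b c = g b * g c * (g a * coprimeKernel (a ℕ.+ b) c)
      -- The coefficients are closed terms, which the solver takes as constants. Modulo 2 only the
      -- exponent 1 is prime to n, and 1 - 1 - 1 is odd as well, so only a = b = c = 1 remains, with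
      -- coefficient 1.
      only : ∑[ c ∈ upTo 2 ] ∑[ b ∈ upTo 2 ] ∑[ a ∈ upTo 2 ] (L a b c * coefficient a b c) ≡ L 1 1 1
      only = solve 8 (λ x₀ x₁ x₂ x₃ x₄ x₅ x₆ x₇ →
          (x₀ :* con (coefficient 0 0 0) :+ (x₁ :* con (coefficient 1 0 0) :+ con 0ℚ)) :+ ((x₂ :* con (coefficient 0 1 0) :+ (x₃ :* con (coefficient 1 1 0) :+ con 0ℚ)) :+ con 0ℚ)
          :+ (((x₄ :* con (coefficient 0 0 1) :+ (x₅ :* con (coefficient 1 0 1) :+ con 0ℚ)) :+ ((x₆ :* con (coefficient 0 1 1) :+ (x₇ :* con (coefficient 1 1 1) :+ con 0ℚ)) :+ con 0ℚ)) :+ con 0ℚ)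
          := x₇)
        refl (L 0 0 0) (L 1 0 0) (L 0 1 0) (L 1 1 0) (L 0 0 1) (L 1 0 1) (L 0 1 1) (L 1 1 1)
      small : ∀ N → ι N ≤ 1ℚ → MainBound 3 N
      -- At q = 3 one has θ = 1/2, τ = 1 and W = 2, so the bound reads (N - 3/4)² ≤ 3.
      small 0             _   = toWitness {a? = _ ℚ.≤? _} _
      small 1             _   = toWitness {a? = _ ℚ.≤? _} _
      small (suc (suc N)) N≤1 = contradiction (ℚ.≤-trans (ι-mono {2} {suc (suc N)} (s≤s (s≤s z≤n))) N≤1) (λ 2≤1 → toWitness {a? = ¬? (ι 2 ℚ.≤? 1ℚ)} _ 2≤1)

open import Defs
open import Level using (Level)
open import Data.Nat using (ℕ; suc; _<_; s≤s; z≤n)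
open import Relation.Nullary using (¬_)
open Bounds

theorem1p3 : ∀ {c ℓ : Level} (q : ℕ) → 2 < q → IsPrimePower q
    → (F : FiniteField c ℓ q)
    → (u v : FiniteField.Carrier F)
    → ¬ (FiniteField._≈_ F u (FiniteField.0# F))
    → ¬ (FiniteField._≈_ F v (FiniteField.0# F))
    → (N : ℕ) → IsN F u v N
    → MainBound q N
theorem1p3 1                         (s≤s ())
theorem1p3 2                         (s≤s (s≤s ()))
theorem1p3 3                         _ _ F u v u≉0 v≉0 N isN = mainBound-3 F u≉0 v≉0 isN
theorem1p3 (suc (suc (suc (suc k)))) _ _ F u v u≉0 v≉0 N isN = mainBound-≥3 F (s≤s (s≤s (s≤s z≤n))) u≉0 v≉0 isN
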